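{- There exists an absolute constant $C_0$ such that the following holds. Let $d$ be a positive integer, let $G$ be a finite abelian group, and let $X\subset G$ with $0\in X$ satisfy $$|kX|\le\frac{k^d}{2^{2^{2^{7d+C_0}}}}|X|$$ for some integer $k\ge2$ (which may depend on $|X|$). Then there is a proper symmetric coset-progression $H+Q$ in $G$ of rank $r\le d$ with $$|H+Q|\le\frac{2^{2^{2^{7d+C_0}}}}{k^r}|kX|$$ such that $X\subset H+Q$.
   Context: $kX=\{x_1+\dots+x_k:x_i\in X\}$. A symmetric GAP of rank $r$ in $G$ is $Q=\{m_1g_1+\dots+m_rg_r: |m_i|\le N_i\}$ with $g_i\in G$ (rank $0$ means $Q=\{0\}$); it is proper if every element has a unique such representation. A symmetric coset-progression is $H+Q$ with $H$ a subgroup of $G$ and $Q$ a symmetric GAP; its rank is that of $Q$; it is proper if $Q$ is proper and $|H+Q|=|H||Q|$. -}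

module Defs where

open import Level using (0ℓ)
open import Data.Nat as ℕ using (ℕ; zero; suc)
open import Data.Integer as ℤ using (ℤ; +_; -[1+_]; ∣_∣)
open import Data.Fin using (Fin; zero; suc)
open import Data.Product using (Σ; ∃; _×_; _,_)
open import Relation.Binary.PropositionalEquality using (_≡_)
open import Relation.Binary.Definitions using (Decidable)
open import Relation.Nullary using (¬_)
open import Relation.Unary using (Pred)
open import Algebra.Bundles using (AbelianGroup)

module _ (G : AbelianGroup 0ℓ 0ℓ) where
  open AbelianGroup G

  Subset : Set₁
  Subset = Pred Carrier 0ℓ

  Respects : Subset → Set
  Respects S = ∀ {x y} → x ≈ y → S x → S y

  _⊆_ : Subset → Subset → Set
  S ⊆ T = ∀ {x} → S x → T x

  HasSize : Subset → ℕ → Set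
  HasSize S n = Σ (Fin n → Carrier) λ f →
      (∀ i → S (f i))
    × (∀ i j → f i ≈ f j → i ≡ j)
    × (∀ {x} → S x → ∃ λ i → x ≈ f i)

  IsFinite : Set
  IsFinite = Decidable _≈_ × ∃ λ n → HasSize (λ _ → Data.Unit.⊤) n
    where import Data.Unit

  natMul : ℕ → Carrier → Carrier
  natMul zero    g = ε
  natMul (suc n) g = g ∙ natMul n g

  intMul : ℤ → Carrier → Carrier
  intMul (+ n)      g = natMul n g
  intMul -[1+ n ]   g = natMul (suc n) g ⁻¹

  sumFin : ∀ {n} → (Fin n → Carrier) → Carrier
  sumFin {zero}  v = ε
  sumFin {suc n} v = v zero ∙ sumFin (λ i → v (suc i))

  sumset : ℕ → Subset → Subset
  sumset k X x = Σ (Fin k → Carrier) λ v → (∀ i → X (v i)) × (sumFin v ≈ x)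

  IsSubgroup : Subset → Set
  IsSubgroup H = Respects H × H ε
               × (∀ {x y} → H x → H y → H (x ∙ y))
               × (∀ {x} → H x → H (x ⁻¹))

  GAP : (r : ℕ) → (Fin r → Carrier) → (Fin r → ℕ) → Subset
  GAP r g N x = Σ (Fin r → ℤ) λ m →
      (∀ i → ∣ m i ∣ ℕ.≤ N i) × (sumFin (λ i → intMul (m i) (g i)) ≈ x)

  ProperGAP : (r : ℕ) → (Fin r → Carrier) → (Fin r → ℕ) → Set
  ProperGAP r g N = ∀ (m m′ : Fin r → ℤ)
    → (∀ i → ∣ m i ∣ ℕ.≤ N i) → (∀ i → ∣ m′ i ∣ ℕ.≤ N i)
    → sumFin (λ i → intMul (m i) (g i)) ≈ sumFin (λ i → intMul (m′ i) (g i))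
    → ∀ i → m i ≡ m′ i

  _⊕_ : Subset → Subset → Subset
  (A ⊕ B) x = Σ Carrier λ a → Σ Carrier λ b → A a × B b × (a ∙ b ≈ x)

  record CosetProgression : Set₁ where
    field
      H       : Subset
      H-sub   : IsSubgroup H
      rank    : ℕ
      gens    : Fin rank → Carrier
      bounds  : Fin rank → ℕ

    Q : Subset
    Q = GAP rank gens bounds

    set : Subset
    set = H ⊕ Q

  open CosetProgression public

  IsProper : CosetProgression → Set
  IsProper P = ProperGAP (rank P) (gens P) (bounds P)
             × ∃ λ h → ∃ λ q → HasSize (H P) h × HasSize (Q P) q
                                × HasSize (set P) (h ℕ.* q)

tower : ℕ → ℕ → ℕ
tower C₀ d = 2 ℕ.^ (2 ℕ.^ (2 ℕ.^ (7 ℕ.* d ℕ.+ C₀)))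

{-# OPTIONS --safe #-}

-- If W (4 m) > 4 ^ d W m held at all scales m = 4 ^ i up to k / M, where W j = |jX|, then |kX| would be too
-- large; so some m ≤ k / M has bounded doubling, and the ball B (j m) = (j m)X - (j m)X is contained in
-- B m + { Σ v i F i : |v i| ≤ j } for n ≤ 16 ^ d elements F i ∈ B (2 m).  Now pass to a scale c comparable
-- with k.  Whenever a small combination of the generators lies in the ball, one generator can be dropped at
-- the cost of enlarging the constants, so after at most n steps the remaining generators f are independent
-- of the ball up to a large constant.  Then B c, taken modulo small combinations of f, is a finite set R
-- carrying a group law up to a cocycle with values in ℤ ^ D.  Averaging trivialises the cocycle and gives
-- exact coordinates: a subgroup L of G × ℤ ^ D in which small coordinates are determined by the element
-- of G.  With H = { g : L g 0 }, a reduced basis of the lattice of coordinates gives a proper progression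
-- Q, and X ⊆ H + Q because n x ∈ B c for x ∈ X and n ≤ c.  No Fourier analysis is used; the iterated
-- exponentials come from the n elimination steps, each of which raises the constants to a fixed power.
module Submission where

open import Defs
open import Level using (0ℓ)
open import Function using (_∘_; id; case_of_)
open import Data.Nat as ℕ using (ℕ; zero; suc; _+_; _*_; _∸_; _^_; _≤_; _<_; z≤n; s≤s; NonZero; _/_)
import Data.Nat.Properties as ℕₚ
import Data.Nat.DivMod as DM
open import Data.Integer as ℤ using (ℤ; +_; -[1+_]; ∣_∣; _⊖_)
import Data.Integer.Properties as ℤₚ
import Data.Integer.DivMod as ZDM
open import Data.Fin as Fin using (Fin; zero; suc; punchIn; toℕ; fromℕ<; combine; remQuot; funToFin; finToFun)
import Data.Fin.Properties as Finₚ
open import Data.Product using (Σ; ∃; _×_; _,_; proj₁; proj₂)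
open import Data.Sum using (_⊎_; inj₁; inj₂; [_,_]′)
open import Data.Unit using (tt)
open import Data.Vec using (Vec; []; _∷_; lookup)
open import Relation.Nullary using (¬_; Dec; yes; no; contradiction)
open import Relation.Nullary.Decidable using (True; toWitness; map′; _×-dec_; ¬?; decidable-stable)
open import Relation.Binary.PropositionalEquality using (_≡_; refl; sym; trans; cong; cong₂; subst; subst₂; _≗_; module ≡-Reasoning)
open import Algebra.Bundles using (AbelianGroup)
import Algebra.Properties.AbelianGroup as AGP
import Algebra.Properties.CommutativeSemigroup as CSP
import Algebra.Construct.Pointwise as Pointwise
import Relation.Binary.Reasoning.Setoid as SetoidReasoning
import Data.Nat.Tactic.RingSolver as ℕ-Solver
import Data.Integer.Tactic.RingSolver as ℤ-Solver

-- The difficulty is that a ball need not be a group and that the generators are independent only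
-- for bounded coefficients. Every later stage therefore spends part of a gap: combinations of size
-- at most `K u²` that fall into the ball have size at most `8 u`. The gap is quadratic in `u`
-- because a relation of size `8 u` is excluded by multiplying it by `8 u + 1`. Circularity is
-- avoided because the enlargements demanded later are linear in `u`, with a factor `E` that depends
-- on `n` alone and comes from the loss in the lattice reduction. So `E` fixes `K`, `K` fixes the
-- base `Y`, the elimination yields the bound `Ω = Y ^ (7 ^ n)`, and only then is `M` chosen, so
-- that what is counted at the final scale still fits into `kX`. Bounded doubling may occur at a
-- scale `m` far below `k`; the generators found there are multiplied by `θ`, about `k / (m M)`,
-- before the elimination starts.

-- Integer combinations in an abelian group, with a solver for linear identities.

module Linear (G : AbelianGroup 0ℓ 0ℓ) where
  open AbelianGroup G renaming (refl to ≈refl; sym to ≈sym; trans to ≈trans)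
  open AGP G using (⁻¹-∙-comm; ε⁻¹≈ε; inverseˡ-unique)
  open CSP commutativeSemigroup using (interchange) public
  open SetoidReasoning setoid

  infixl 6 _⊟_
  _⊟_ : Carrier → Carrier → Carrier
  x ⊟ y = x ∙ y ⁻¹

  private
    nat = natMul G
    int = intMul G

  natMul-cong : ∀ n {x y} → x ≈ y → nat n x ≈ nat n y
  natMul-cong zero    p = ≈refl
  natMul-cong (suc n) p = ∙-cong p (natMul-cong n p)

  natMul-∙ : ∀ n x y → nat n (x ∙ y) ≈ nat n x ∙ nat n y
  natMul-∙ zero    x y = ≈sym (identityˡ ε)
  natMul-∙ (suc n) x y =
    ≈trans (∙-congˡ (natMul-∙ n x y)) (interchange x y (nat n x) (nat n y))

  natMul-+ : ∀ m n x → nat (m + n) x ≈ nat m x ∙ nat n x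
  natMul-+ zero    n x = ≈sym (identityˡ _)
  natMul-+ (suc m) n x =
    ≈trans (∙-congˡ (natMul-+ m n x)) (≈sym (assoc _ _ _))

  intMul-⊖ : ∀ m n x → int (m ⊖ n) x ≈ nat m x ⊟ nat n x
  intMul-⊖ m       zero    x = ≈sym (≈trans (∙-congˡ ε⁻¹≈ε) (identityʳ _))
  intMul-⊖ zero    (suc n) x = ≈sym (identityˡ _)
  intMul-⊖ (suc m) (suc n) x = begin
    int (suc m ⊖ suc n) x                 ≡⟨ cong (λ z → int z x) (ℤₚ.[1+m]⊖[1+n]≡m⊖n m n) ⟩
    int (m ⊖ n) x                         ≈⟨ intMul-⊖ m n x ⟩
    nat m x ⊟ nat n x                     ≈⟨ identityˡ _ ⟨
    ε ∙ (nat m x ⊟ nat n x)               ≈⟨ ∙-congʳ (inverseʳ x) ⟨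
    (x ∙ x ⁻¹) ∙ (nat m x ∙ nat n x ⁻¹)   ≈⟨ interchange _ _ _ _ ⟩
    (x ∙ nat m x) ∙ (x ⁻¹ ∙ nat n x ⁻¹)   ≈⟨ ∙-congˡ (⁻¹-∙-comm _ _) ⟩
    (x ∙ nat m x) ⊟ (x ∙ nat n x)         ∎

  intMul-cong : ∀ a {x y} → x ≈ y → int a x ≈ int a y
  intMul-cong (+ n)      p = natMul-cong n p
  intMul-cong (-[1+ n ]) p = ⁻¹-cong (natMul-cong (suc n) p)

  intMul-∙ : ∀ a x y → int a (x ∙ y) ≈ int a x ∙ int a y
  intMul-∙ (+ n)    x y = natMul-∙ n x y
  intMul-∙ -[1+ n ] x y =
    ≈trans (⁻¹-cong (natMul-∙ (suc n) x y)) (≈sym (⁻¹-∙-comm _ _))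

  intMul-+ : ∀ a b x → int (a ℤ.+ b) x ≈ int a x ∙ int b x
  intMul-+ (+ m)    (+ n)    x = natMul-+ m n x
  intMul-+ (+ m)    -[1+ n ] x = intMul-⊖ m (suc n) x
  intMul-+ -[1+ m ] (+ n)    x = ≈trans (intMul-⊖ n (suc m) x) (comm _ _)
  intMul-+ -[1+ m ] -[1+ n ] x = begin
    nat (suc (suc (m + n))) x ⁻¹          ≡⟨ cong (λ z → nat z x ⁻¹) (sym (ℕₚ.+-suc (suc m) n)) ⟩
    nat (suc m + suc n) x ⁻¹              ≈⟨ ⁻¹-cong (natMul-+ (suc m) (suc n) x) ⟩
    (nat (suc m) x ∙ nat (suc n) x) ⁻¹    ≈⟨ ⁻¹-∙-comm _ _ ⟨
    nat (suc m) x ⁻¹ ∙ nat (suc n) x ⁻¹   ∎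

  intMul-neg : ∀ a x → int (ℤ.- a) x ≈ int a x ⁻¹
  intMul-neg a x = inverseˡ-unique _ _ (begin
    int (ℤ.- a) x ∙ int a x ≈⟨ intMul-+ (ℤ.- a) a x ⟨
    int (ℤ.- a ℤ.+ a) x     ≡⟨ cong (λ z → int z x) (ℤₚ.+-inverseˡ a) ⟩
    ε ∎)

  intMul-* : ∀ a b x → int (a ℤ.* b) x ≈ int a (int b x)
  intMul-* a b x = go a
    where
    goℕ : ∀ m → int (+ m ℤ.* b) x ≈ nat m (int b x)
    goℕ zero    = ≈refl
    goℕ (suc m) = begin
      int (+ suc m ℤ.* b) x           ≡⟨ cong (λ z → int z x) (ℤₚ.suc-* (+ m) b) ⟩
      int (b ℤ.+ + m ℤ.* b) x         ≈⟨ intMul-+ b _ x ⟩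
      int b x ∙ int (+ m ℤ.* b) x     ≈⟨ ∙-congˡ (goℕ m) ⟩
      int b x ∙ nat m (int b x)       ∎
    go : ∀ a → int (a ℤ.* b) x ≈ int a (int b x)
    go (+ m)    = goℕ m
    go -[1+ m ] = begin
      int (-[1+ m ] ℤ.* b) x      ≡⟨ cong (λ z → int z x) (sym (ℤₚ.neg-distribˡ-* (+ suc m) b)) ⟩
      int (ℤ.- (+ suc m ℤ.* b)) x ≈⟨ intMul-neg (+ suc m ℤ.* b) x ⟩
      int (+ suc m ℤ.* b) x ⁻¹    ≈⟨ ⁻¹-cong (goℕ (suc m)) ⟩
      nat (suc m) (int b x) ⁻¹    ∎

  intMul-ε : ∀ a → int a ε ≈ ε
  intMul-ε a = begin
    int a ε                ≡⟨⟩
    int a (int (+ 0) ε)    ≈⟨ intMul-* a (+ 0) ε ⟨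
    int (a ℤ.* + 0) ε      ≡⟨ cong (λ z → int z ε) (ℤₚ.*-zeroʳ a) ⟩
    ε                      ∎

  intMul-⁻¹ : ∀ a x → int a (x ⁻¹) ≈ int a x ⁻¹
  intMul-⁻¹ a x = inverseˡ-unique _ _ (begin
    int a (x ⁻¹) ∙ int a x  ≈⟨ intMul-∙ a (x ⁻¹) x ⟨
    int a (x ⁻¹ ∙ x)        ≈⟨ intMul-cong a (inverseˡ x) ⟩
    int a ε                 ≈⟨ intMul-ε a ⟩
    ε ∎)

  sum-cong : ∀ {n} {v w : Fin n → Carrier} → (∀ i → v i ≈ w i) → sumFin G v ≈ sumFin G w
  sum-cong {zero}  p = ≈refl
  sum-cong {suc n} p = ∙-cong (p zero) (sum-cong (λ i → p (suc i)))

  sum-ε : ∀ n → sumFin G {n} (λ _ → ε) ≈ ε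
  sum-ε zero    = ≈refl
  sum-ε (suc n) = ≈trans (identityˡ _) (sum-ε n)

  sum-∙ : ∀ {n} (v w : Fin n → Carrier) →
          sumFin G (λ i → v i ∙ w i) ≈ sumFin G v ∙ sumFin G w
  sum-∙ {zero}  v w = ≈sym (identityˡ ε)
  sum-∙ {suc n} v w = ≈trans (∙-congˡ (sum-∙ (v ∘ suc) (w ∘ suc))) (interchange _ _ _ _)

  sum-intMul : ∀ {n} a (v : Fin n → Carrier) →
               sumFin G (λ i → int a (v i)) ≈ int a (sumFin G v)
  sum-intMul {zero}  a v = ≈sym (intMul-ε a)
  sum-intMul {suc n} a v = ≈trans (∙-congˡ (sum-intMul a (v ∘ suc))) (≈sym (intMul-∙ a _ _))

  sum-const : ∀ n x → sumFin G {n} (λ _ → x) ≈ nat n x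
  sum-const zero    x = ≈refl
  sum-const (suc n) x = ∙-congˡ (sum-const n x)

  sum-remove : ∀ {n} (i : Fin (suc n)) (v : Fin (suc n) → Carrier) →
               sumFin G v ≈ v i ∙ sumFin G (λ l → v (punchIn i l))
  sum-remove zero v = ≈refl
  sum-remove {suc n} (suc i) v = begin
    v zero ∙ sumFin G (λ l → v (suc l))    ≈⟨ ∙-congˡ (sum-remove i (λ l → v (suc l))) ⟩
    v zero ∙ (v (suc i) ∙ rest)            ≈⟨ assoc _ _ _ ⟨
    (v zero ∙ v (suc i)) ∙ rest            ≈⟨ ∙-congʳ (comm _ _) ⟩
    (v (suc i) ∙ v zero) ∙ rest            ≈⟨ assoc _ _ _ ⟩
    v (suc i) ∙ (v zero ∙ rest)            ∎
    where rest = sumFin G (λ l → v (suc (punchIn i l)))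

  -- Injectivity suffices because a self-map of a finite index set is then a permutation. The
  -- application is to the translations `j ⋆_`, for which no inverse is constructed.
  sum-reindex : ∀ {n} (σ : Fin n → Fin n) → (∀ i j → σ i ≡ σ j → i ≡ j) →
                (v : Fin n → Carrier) → sumFin G (λ i → v (σ i)) ≈ sumFin G v
  sum-reindex {zero}  σ inj v = ≈refl
  sum-reindex {suc n} σ inj v = begin
    v i₀ ∙ sumFin G (λ i → v (σ (suc i)))
      ≈⟨ ∙-congˡ (sum-cong (λ i → reflexive (cong v (sym (Finₚ.punchIn-punchOut (i₀≢ i)))))) ⟩
    v i₀ ∙ sumFin G (λ i → v (punchIn i₀ (τ i)))
      ≈⟨ ∙-congˡ (sum-reindex τ (λ i j e → Finₚ.suc-injective (inj _ _
           (Finₚ.punchOut-injective (i₀≢ i) (i₀≢ j) e))) (v ∘ punchIn i₀)) ⟩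
    v i₀ ∙ sumFin G (v ∘ punchIn i₀)
      ≈⟨ sum-remove i₀ v ⟨
    sumFin G v ∎
    where
    i₀ = σ zero
    i₀≢ : ∀ i → ¬ i₀ ≡ σ (suc i)
    i₀≢ i e = Finₚ.0≢1+n (inj zero (suc i) e)
    τ : Fin n → Fin n
    τ i = Fin.punchOut (i₀≢ i)

  lin : ∀ {n} → (Fin n → Carrier) → (Fin n → ℤ) → Carrier
  lin g v = sumFin G (λ i → int (v i) (g i))

  lin-cong : ∀ {n} (g : Fin n → Carrier) {v w : Fin n → ℤ} → v ≗ w → lin g v ≈ lin g w
  lin-cong g p = sum-cong (λ i → reflexive (cong (λ z → int z (g i)) (p i)))

  lin-congᵍ : ∀ {n} {g h : Fin n → Carrier} (v : Fin n → ℤ) →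
              (∀ i → g i ≈ h i) → lin g v ≈ lin h v
  lin-congᵍ v p = sum-cong (λ i → intMul-cong (v i) (p i))

  lin-+ : ∀ {n} (g : Fin n → Carrier) v w →
          lin g (λ i → v i ℤ.+ w i) ≈ lin g v ∙ lin g w
  lin-+ g v w = ≈trans (sum-cong (λ i → intMul-+ (v i) (w i) (g i)))
    (sum-∙ (λ i → int (v i) (g i)) (λ i → int (w i) (g i)))

  lin-* : ∀ {n} (g : Fin n → Carrier) a v →
          lin g (λ i → a ℤ.* v i) ≈ int a (lin g v)
  lin-* g a v = ≈trans (sum-cong (λ i → intMul-* a (v i) (g i))) (sum-intMul a (λ i → int (v i) (g i)))

  lin-neg : ∀ {n} (g : Fin n → Carrier) v → lin g (λ i → ℤ.- v i) ≈ lin g v ⁻¹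
  lin-neg g v = begin
    lin g (λ i → ℤ.- v i)           ≈⟨ lin-cong g (λ i → sym (ℤₚ.-1*i≡-i (v i))) ⟩
    lin g (λ i → ℤ.-1ℤ ℤ.* v i)     ≈⟨ lin-* g ℤ.-1ℤ v ⟩
    int ℤ.-1ℤ (lin g v)             ≈⟨ ⁻¹-cong (identityʳ _) ⟩
    lin g v ⁻¹                      ∎

  lin-sub : ∀ {n} (g : Fin n → Carrier) v w →
            lin g (λ i → v i ℤ.- w i) ≈ lin g v ⊟ lin g w
  lin-sub g v w = ≈trans (lin-+ g v (λ i → ℤ.- w i)) (∙-congˡ (lin-neg g w))

  lin-0 : ∀ {n} (g : Fin n → Carrier) → lin g (λ _ → + 0) ≈ ε
  lin-0 {n} g = sum-ε n

  lin-scaleᵍ : ∀ {n} a (g : Fin n → Carrier) v →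
               lin (λ i → int a (g i)) v ≈ lin g (λ i → a ℤ.* v i)
  lin-scaleᵍ a g v = sum-cong (λ i → begin
    int (v i) (int a (g i)) ≈⟨ intMul-* (v i) a (g i) ⟨
    int (v i ℤ.* a) (g i)   ≡⟨ cong (λ z → int z (g i)) (ℤₚ.*-comm (v i) a) ⟩
    int (a ℤ.* v i) (g i)   ∎)

  δ : ∀ {n} → Fin n → Fin n → ℤ
  δ zero    zero    = + 1
  δ zero    (suc j) = + 0
  δ (suc i) zero    = + 0
  δ (suc i) (suc j) = δ i j

  lin-δ : ∀ {n} (g : Fin n → Carrier) i → lin g (δ i) ≈ g i
  lin-δ {suc n} g zero = ≈trans (∙-cong (identityʳ _) (sum-ε n)) (identityʳ _)
  lin-δ {suc n} g (suc i) = ≈trans (identityˡ _) (lin-δ (λ j → g (suc j)) i)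

  infixl 6 _:+_ _:-_
  data Expr (n : ℕ) : Set where
    var  : Fin n → Expr n
    :0   : Expr n
    _:+_ : Expr n → Expr n → Expr n
    :-_  : Expr n → Expr n

  _:-_ : ∀ {n} → Expr n → Expr n → Expr n
  a :- b = a :+ (:- b)

  ⟦_⟧ : ∀ {n} → Expr n → Vec Carrier n → Carrier
  ⟦ var i ⟧  ρ = lookup ρ i
  ⟦ :0 ⟧     ρ = ε
  ⟦ a :+ b ⟧ ρ = ⟦ a ⟧ ρ ∙ ⟦ b ⟧ ρ
  ⟦ :- a ⟧   ρ = ⟦ a ⟧ ρ ⁻¹

  coeffs : ∀ {n} → Expr n → Fin n → ℤ
  coeffs (var i)  j = δ i j
  coeffs :0       j = + 0
  coeffs (a :+ b) j = coeffs a j ℤ.+ coeffs b j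
  coeffs (:- a)   j = ℤ.- coeffs a j

  ⟦⟧-coeffs : ∀ {n} (e : Expr n) ρ → ⟦ e ⟧ ρ ≈ lin (lookup ρ) (coeffs e)
  ⟦⟧-coeffs (var i)  ρ = ≈sym (lin-δ (lookup ρ) i)
  ⟦⟧-coeffs :0       ρ = ≈sym (lin-0 (lookup ρ))
  ⟦⟧-coeffs (a :+ b) ρ =
    ≈trans (∙-cong (⟦⟧-coeffs a ρ) (⟦⟧-coeffs b ρ)) (≈sym (lin-+ (lookup ρ) (coeffs a) (coeffs b)))
  ⟦⟧-coeffs (:- a)   ρ =
    ≈trans (⁻¹-cong (⟦⟧-coeffs a ρ)) (≈sym (lin-neg (lookup ρ) (coeffs a)))

  -- An identity valid in all abelian groups is an equality of integer coefficient vectors, so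
  -- evaluation fills in the implicit argument.
  ab-solve : ∀ {n} (ρ : Vec Carrier n) (e f : Expr n)
             {_ : True (Finₚ.all? (λ i → coeffs e i ℤ.≟ coeffs f i))} → ⟦ e ⟧ ρ ≈ ⟦ f ⟧ ρ
  ab-solve ρ e f {p} = ≈trans (⟦⟧-coeffs e ρ)
    (≈trans (lin-cong (lookup ρ) (toWitness p)) (≈sym (⟦⟧-coeffs f ρ)))

  pattern v0 = var zero
  pattern v1 = var (suc zero)
  pattern v2 = var (suc (suc zero))
  pattern v3 = var (suc (suc (suc zero)))
  pattern v4 = var (suc (suc (suc (suc zero))))

-- Homomorphisms and integer combinations.

module Hom (G G′ : AbelianGroup 0ℓ 0ℓ)
           (h : AbelianGroup.Carrier G → AbelianGroup.Carrier G′)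
           (h-cong : ∀ {x y} → AbelianGroup._≈_ G x y → AbelianGroup._≈_ G′ (h x) (h y))
           (h-∙ : ∀ x y → AbelianGroup._≈_ G′ (h (AbelianGroup._∙_ G x y))
                            (AbelianGroup._∙_ G′ (h x) (h y))) where
  private
    module A = AbelianGroup G
    module B = AbelianGroup G′
    module LA = Linear G
    module LB = Linear G′
  open SetoidReasoning B.setoid

  hom-ε : h A.ε B.≈ B.ε
  hom-ε = begin
    h A.ε                                ≈⟨ LB.ab-solve (h A.ε ∷ []) LB.v0 ((LB.v0 LB.:+ LB.v0) LB.:- LB.v0) ⟩
    (h A.ε B.∙ h A.ε) B.∙ h A.ε B.⁻¹     ≈⟨ B.∙-congʳ (h-∙ A.ε A.ε) ⟨
    h (A.ε A.∙ A.ε) B.∙ h A.ε B.⁻¹       ≈⟨ B.∙-congʳ (h-cong (A.identityˡ A.ε)) ⟩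
    h A.ε B.∙ h A.ε B.⁻¹                 ≈⟨ B.inverseʳ _ ⟩
    B.ε                                  ∎

  hom-⁻¹ : ∀ x → h (x A.⁻¹) B.≈ h x B.⁻¹
  hom-⁻¹ x = AGP.inverseˡ-unique G′ _ _ (begin
    h (x A.⁻¹) B.∙ h x ≈⟨ h-∙ _ _ ⟨
    h (x A.⁻¹ A.∙ x)   ≈⟨ h-cong (A.inverseˡ x) ⟩
    h A.ε              ≈⟨ hom-ε ⟩
    B.ε ∎)

  hom-natMul : ∀ n x → h (natMul G n x) B.≈ natMul G′ n (h x)
  hom-natMul zero    x = hom-ε
  hom-natMul (suc n) x = B.trans (h-∙ _ _) (B.∙-congˡ (hom-natMul n x))

  hom-intMul : ∀ a x → h (intMul G a x) B.≈ intMul G′ a (h x)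
  hom-intMul (+ n)    x = hom-natMul n x
  hom-intMul -[1+ n ] x = B.trans (hom-⁻¹ _) (B.⁻¹-cong (hom-natMul (suc n) x))

  hom-sum : ∀ {n} (v : Fin n → A.Carrier) → h (sumFin G v) B.≈ sumFin G′ (λ i → h (v i))
  hom-sum {zero}  v = hom-ε
  hom-sum {suc n} v = B.trans (h-∙ _ _) (B.∙-congˡ (hom-sum (v ∘ suc)))

  hom-lin : ∀ {n} (g : Fin n → A.Carrier) v → h (LA.lin g v) B.≈ LB.lin (λ i → h (g i)) v
  hom-lin g v = B.trans (hom-sum (λ i → intMul G (v i) (g i))) (LB.sum-cong (λ i → hom-intMul (v i) (g i)))

-- Finite codes, exhaustive search and separated nets.

funToFin-injective : ∀ {m n} (f g : Fin m → Fin n) → funToFin f ≡ funToFin g → f ≗ g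
funToFin-injective f g p i = trans (sym (Finₚ.finToFun-funToFin f i))
  (trans (cong (λ z → finToFun z i) p) (Finₚ.finToFun-funToFin g i))

funToFin-cong : ∀ {m n} {f g : Fin m → Fin n} → f ≗ g → funToFin f ≡ funToFin g
funToFin-cong {zero}  p = refl
funToFin-cong {suc m} p = cong₂ combine (p zero) (funToFin-cong (p ∘ suc))

finToFun-injective : ∀ {m n} (i j : Fin (n ^ m)) →
                     finToFun {n} {m} i ≗ finToFun {n} {m} j → i ≡ j
finToFun-injective {m} {n} i j p = trans (sym (Finₚ.funToFin-finToFin {m} {n} i))
  (trans (funToFin-cong p) (Finₚ.funToFin-finToFin {m} {n} j))

remQuot-injective : ∀ {m} n (i j : Fin (m * n)) →
                    proj₁ (remQuot {m} n i) ≡ proj₁ (remQuot {m} n j) →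
                    proj₂ (remQuot {m} n i) ≡ proj₂ (remQuot {m} n j) → i ≡ j
remQuot-injective {m} n i j p q = trans (sym (Finₚ.combine-remQuot {m} n i))
  (trans (cong₂ combine p q) (Finₚ.combine-remQuot {m} n j))

Bounded : ∀ {D} → ℕ → (Fin D → ℤ) → Set
Bounded b v = ∀ i → ∣ v i ∣ ≤ b

shift : ℕ → ℤ → ℕ
shift b (+ n)    = n + b
shift b -[1+ n ] = b ∸ suc n

shift-< : ∀ b z → ∣ z ∣ ≤ b → shift b z < suc (b + b)
shift-< b (+ n)    p = s≤s (ℕₚ.+-monoˡ-≤ b p)
shift-< b -[1+ n ] p = s≤s (ℕₚ.≤-trans (ℕₚ.m∸n≤m b (suc n)) (ℕₚ.m≤m+n b b))

shift-injective : ∀ b y z → ∣ y ∣ ≤ b → ∣ z ∣ ≤ b → shift b y ≡ shift b z → y ≡ z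
shift-injective b (+ m)    (+ n)    p q e = cong +_ (ℕₚ.+-cancelʳ-≡ b m n e)
shift-injective b (+ m)    -[1+ n ] p q e = contradiction e (ℕₚ.>⇒≢
  (ℕₚ.<-≤-trans (ℕₚ.∸-monoʳ-< (s≤s z≤n) q) (ℕₚ.m≤n+m b m)))
shift-injective b -[1+ m ] (+ n)    p q e = contradiction e (ℕₚ.<⇒≢
  (ℕₚ.<-≤-trans (ℕₚ.∸-monoʳ-< (s≤s z≤n) p) (ℕₚ.m≤n+m b n)))
shift-injective b -[1+ m ] -[1+ n ] p q e =
  cong -[1+_] (ℕₚ.suc-injective (ℕₚ.∸-cancelˡ-≡ p q e))

boxCode : ∀ {D} b (v : Fin D → ℤ) → Bounded b v → Fin (suc (b + b) ^ D)
boxCode b v p = funToFin (λ i → fromℕ< (shift-< b (v i) (p i)))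

boxCode-injective : ∀ {D} b (v w : Fin D → ℤ) (p : Bounded b v) (q : Bounded b w) →
                    boxCode b v p ≡ boxCode b w q → v ≗ w
boxCode-injective b v w p q e i = shift-injective b (v i) (w i) (p i) (q i)
  (Finₚ.fromℕ<-injective _ _ (shift-< b (v i) (p i)) (shift-< b (w i) (q i))
    (funToFin-injective _ _ e i))

searchℤ : ∀ b {P : ℤ → Set} → (∀ z → Dec (P z)) → Dec (∃ λ z → ∣ z ∣ ≤ b × P z)
searchℤ b {P} P? with Finₚ.any? {n = suc b} (λ i → P? (+ toℕ i))
                    | Finₚ.any? {n = suc b} (λ i → P? (ℤ.- (+ toℕ i)))
... | yes (i , p) | _           = yes (+ toℕ i , ℕₚ.≤-pred (Finₚ.toℕ<n i) , p)
... | no _        | yes (i , p) = yes (ℤ.- (+ toℕ i) ,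
  subst (_≤ b) (sym (ℤₚ.∣-i∣≡∣i∣ (+ toℕ i))) (ℕₚ.≤-pred (Finₚ.toℕ<n i)) , p)
... | no ¬p       | no ¬q       = no none
  where
  none : ¬ (∃ λ z → ∣ z ∣ ≤ b × P z)
  none (+ n , l , p)      = ¬p (fromℕ< (s≤s l) , subst (P ∘ +_) (sym (Finₚ.toℕ-fromℕ< (s≤s l))) p)
  none (-[1+ n ] , l , p) = ¬q (fromℕ< (s≤s l) ,
    subst (λ z → P (ℤ.- (+ z))) (sym (Finₚ.toℕ-fromℕ< (s≤s l))) p)

infixr 5 _◂_
_◂_ : ∀ {D} {A : Set} → A → (Fin D → A) → Fin (suc D) → A
(z ◂ v) zero    = z
(z ◂ v) (suc i) = v i

-- `P` must respect pointwise equality because a vector rebuilt from its head and tail agrees with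
-- the original only pointwise.
searchBox : ∀ D b {P : (Fin D → ℤ) → Set} → (∀ {v w} → v ≗ w → P v → P w) →
            (∀ v → Dec (P v)) → Dec (∃ λ v → Bounded b v × P v)
searchBox zero b resp P? =
  map′ (λ p → none , (λ ()) , p) (λ { (v , _ , p) → resp (λ ()) p }) (P? none)
  where
  none : Fin 0 → ℤ
  none ()
searchBox (suc D) b {P} resp P? = map′
  (λ { (z , l , v , ls , p) → z ◂ v , (λ { zero → l ; (suc i) → ls i }) , p })
  (λ { (v , ls , p) → v zero , ls zero , v ∘ suc , ls ∘ suc ,
       resp (λ { zero → refl ; (suc i) → refl }) p })
  (searchℤ b (λ z → searchBox D b
    (λ e → resp (λ { zero → refl ; (suc i) → e i })) (λ v → P? (z ◂ v))))

Enumeration : ∀ {N} → (Fin N → Set) → ℕ → Set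
Enumeration {N} P n = Σ (Fin n → Fin N) λ f →
  (∀ i → P (f i)) × (∀ i j → f i ≡ f j → i ≡ j) × (∀ j → P j → ∃ λ i → j ≡ f i)

enumerate : ∀ {N} {P : Fin N → Set} → (∀ i → Dec (P i)) → ∃ (Enumeration P)
enumerate {zero}  P? = 0 , (λ ()) , (λ ()) , (λ ()) , (λ ())
enumerate {suc N} {P} P? with enumerate (P? ∘ suc) | P? zero
... | n , f , f∈ , inj , onto | no ¬p = n , suc ∘ f , f∈ ,
  (λ i j e → inj i j (Finₚ.suc-injective e)) ,
  λ { zero p → contradiction p ¬p
    ; (suc j) p → proj₁ (onto j p) , cong suc (proj₂ (onto j p)) }
... | n , f , f∈ , inj , onto | yes p = suc n , zero ◂ (suc ∘ f) ,
  (λ { zero → p ; (suc i) → f∈ i }) ,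
  (λ { zero zero e → refl ; zero (suc j) () ; (suc i) zero ()
     ; (suc i) (suc j) e → cong suc (inj i j (Finₚ.suc-injective e)) }) ,
  λ { zero p → zero , refl
    ; (suc j) p → suc (proj₁ (onto j p)) , cong suc (proj₂ (onto j p)) }

Net : ∀ {A : Set} (C : A → A → Set) {N} → (Fin N → A) → Set
Net {A} C {N} e = Σ ℕ λ n → Σ (Fin n → Fin N) λ s →
  (∀ i j → C (e (s i)) (e (s j)) → i ≡ j) × (∀ l → ∃ λ i → C (e l) (e (s i)))

net : ∀ {A : Set} {C : A → A → Set} → (∀ x y → Dec (C x y)) → (∀ x → C x x) →
      (∀ {x y} → C x y → C y x) → ∀ {N} (e : Fin N → A) → Net C e
net C? r s {zero}  e = 0 , (λ ()) , (λ ()) , λ ()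
net {C = C} C? r s {suc N} e with net C? r s (e ∘ suc)
... | n , f , sep , cov with Finₚ.any? (λ i → C? (e zero) (e (suc (f i))))
...   | yes (i , c) = n , suc ∘ f , sep , λ { zero → i , c ; (suc l) → cov l }
...   | no ¬c = suc n , zero ◂ (suc ∘ f) ,
  (λ { zero zero _ → refl
     ; zero (suc j) c → contradiction (j , c) ¬c
     ; (suc i) zero c → contradiction (i , s c) ¬c
     ; (suc i) (suc j) c → cong suc (sep i j c) }) ,
  λ { zero → zero , r (e zero)
    ; (suc l) → suc (proj₁ (cov l)) , proj₂ (cov l) }

module Finite (G : AbelianGroup 0ℓ 0ℓ) (fin : IsFinite G) where
  open AbelianGroup G renaming (refl to ≈refl; sym to ≈sym; trans to ≈trans)

  infix 4 _≈?_
  _≈?_ : ∀ x y → Dec (x ≈ y)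
  _≈?_ = proj₁ fin

  private
    N  = proj₁ (proj₂ fin)
    el = proj₁ (proj₂ (proj₂ fin))
    ix : ∀ x → ∃ λ i → x ≈ el i
    ix x = proj₂ (proj₂ (proj₂ (proj₂ (proj₂ fin)))) {x} tt

  search : ∀ {P : Carrier → Set} → Respects G P → (∀ x → Dec (P x)) → Dec (∃ P)
  search resp P? = map′ (λ { (i , p) → el i , p })
    (λ { (x , p) → proj₁ (ix x) , resp (proj₂ (ix x)) p }) (Finₚ.any? (λ i → P? (el i)))

  hasSize : ∀ {S : Carrier → Set} → Respects G S → (∀ x → Dec (S x)) → ∃ (HasSize G S)
  hasSize {S} resp S? with enumerate (λ i → S? (el i))
  ... | n , f , f∈ , inj , onto = n , el ∘ f , f∈ ,
    (λ i j e → inj i j (proj₁ (proj₂ (proj₂ (proj₂ (proj₂ fin)))) (f i) (f j) e)) ,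
    λ {x} s → let (j , p) = ix x ; (i , q) = onto j (resp p s)
              in i , ≈trans p (reflexive (cong el q))

  member? : ∀ {S : Carrier → Set} {n} → Respects G S → HasSize G S n → ∀ x → Dec (S x)
  member? resp (f , f∈ , _ , onto) x = map′ (λ { (i , p) → resp (≈sym p) (f∈ i) }) onto
    (Finₚ.any? (λ i → x ≈? f i))

  size-mono : ∀ {S T : Carrier → Set} {a b} → HasSize G S a → HasSize G T b →
              (∀ {x} → S x → T x) → a ≤ b
  size-mono (f , f∈ , inj , _) (g , _ , _ , onto) S⊆T =
    Finₚ.injective⇒≤ {f = λ i → proj₁ (onto (S⊆T (f∈ i)))} λ {i} {j} e → inj i j
      (≈trans (proj₂ (onto (S⊆T (f∈ i))))
        (≈trans (reflexive (cong g e)) (≈sym (proj₂ (onto (S⊆T (f∈ j)))))))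

  code : ∀ {S : Carrier → Set} {n} → HasSize G S n → ∀ {x} → S x → Fin n
  code (_ , _ , _ , onto) p = proj₁ (onto p)

  code-injective : ∀ {S : Carrier → Set} {n} (h : HasSize G S n) {x y} (p : S x) (q : S y) →
                   code h p ≡ code h q → x ≈ y
  code-injective (f , _ , _ , onto) p q e =
    ≈trans (proj₂ (onto p)) (≈trans (reflexive (cong f e)) (≈sym (proj₂ (onto q))))

-- Integer lattices and their reduced bases.

ℤ^ : ℕ → AbelianGroup 0ℓ 0ℓ
ℤ^ D = Pointwise.abelianGroup (Fin D) ℤₚ.+-0-abelianGroup

∑ : ∀ {n} → (Fin n → ℤ) → ℤ
∑ = sumFin ℤₚ.+-0-abelianGroup

intMul-ℤ^ : ∀ {D} a (p : Fin D → ℤ) i → intMul (ℤ^ D) a p i ≡ a ℤ.* p i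
intMul-ℤ^ {D} a p i = go a
  where
  goℕ : ∀ n → natMul (ℤ^ D) n p i ≡ + n ℤ.* p i
  goℕ zero    = refl
  goℕ (suc n) = trans (cong (λ z → p i ℤ.+ z) (goℕ n)) (sym (ℤₚ.suc-* (+ n) (p i)))
  go : ∀ a → intMul (ℤ^ D) a p i ≡ a ℤ.* p i
  go (+ n)    = goℕ n
  go -[1+ n ] = trans (cong ℤ.-_ (goℕ (suc n))) (ℤₚ.neg-distribˡ-* (+ suc n) (p i))

sum-ℤ^ : ∀ {D n} (V : Fin n → Fin D → ℤ) i → sumFin (ℤ^ D) V i ≡ ∑ (λ l → V l i)
sum-ℤ^ {n = zero}  V i = refl
sum-ℤ^ {n = suc n} V i = cong (λ z → V zero i ℤ.+ z) (sum-ℤ^ (V ∘ suc) i)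

∣∑∣≤ : ∀ {n} b (z : Fin n → ℤ) → Bounded b z → ∣ ∑ z ∣ ≤ n * b
∣∑∣≤ {zero}  b z p = z≤n
∣∑∣≤ {suc n} b z p = ℕₚ.≤-trans (ℤₚ.∣i+j∣≤∣i∣+∣j∣ (z zero) _)
  (ℕₚ.+-mono-≤ (p zero) (∣∑∣≤ b (z ∘ suc) (p ∘ suc)))

comb : ∀ {D n} → (Fin n → Fin D → ℤ) → (Fin n → ℤ) → Fin D → ℤ
comb {D} = Linear.lin (ℤ^ D)

∣comb∣≤ : ∀ {D n} b (p : Fin n → Fin D → ℤ) m →
          (∀ l i → ∣ m l ∣ * ∣ p l i ∣ ≤ b) → Bounded (n * b) (comb p m)
∣comb∣≤ {D} {n} b p m h i = subst (λ z → ∣ z ∣ ≤ n * b)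
  (sym (sum-ℤ^ (λ l → intMul (ℤ^ D) (m l) (p l)) i))
  (∣∑∣≤ b (λ l → intMul (ℤ^ D) (m l) (p l) i) λ l →
  subst (_≤ b) (sym (trans (cong ∣_∣ (intMul-ℤ^ (m l) (p l) i)) (ℤₚ.∣i*j∣≡∣i∣*∣j∣ (m l) (p l i))))
    (h l i))

least : ∀ {P : ℕ → Set} → (∀ a → Dec (P a)) → ∀ ρ →
        (∃ λ a → a ≤ ρ × P a × (∀ b → b < a → ¬ P b)) ⊎ (∀ b → b ≤ ρ → ¬ P b)
least P? zero with P? 0
... | yes p = inj₁ (0 , z≤n , p , λ _ ())
... | no ¬p = inj₂ λ { zero z≤n → ¬p }
least P? (suc ρ) with least P? ρ
... | inj₁ (a , l , p , m) = inj₁ (a , ℕₚ.m≤n⇒m≤1+n l , p , m)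
... | inj₂ none with P? (suc ρ)
...   | yes p = inj₁ (suc ρ , ℕₚ.≤-refl , p , λ b b< → none b (ℕₚ.≤-pred b<))
...   | no ¬p = inj₂ λ b b≤ q → case ℕₚ.m≤n⇒m<n∨m≡n b≤ of λ
  { (inj₁ b<) → none b (ℕₚ.≤-pred b<) q ; (inj₂ refl) → ¬p q }

nearestMultiple : ∀ a → 1 ≤ a → ∀ z → ∃ λ n → 2 * ∣ z ℤ.- n ℤ.* + a ∣ ≤ a
nearestMultiple a@(suc _) _ z with 2 * r ℕ.≤? a
  where
  r = z ZDM.%ℕ a
... | yes p = q , subst (λ y → 2 * ∣ y ∣ ≤ a) (sym eq) p
  where
  q = z ZDM./ℕ a
  eq : z ℤ.- q ℤ.* + a ≡ + (z ZDM.%ℕ a)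
  eq = trans (cong (λ y → y ℤ.- q ℤ.* + a) (ZDM.a≡a%ℕn+[a/ℕn]*n z a))
    (lemma (+ (z ZDM.%ℕ a)) (q ℤ.* + a))
    where
    lemma : ∀ x y → x ℤ.+ y ℤ.- y ≡ x
    lemma = ℤ-Solver.solve-∀
... | no ¬p = q ℤ.+ + 1 , subst (λ y → 2 * y ≤ a) (sym eq)
  (ℕₚ.+-cancelʳ-≤ (2 * r) _ _ (begin
    2 * (a ∸ r) + 2 * r   ≡⟨ ℕₚ.*-distribˡ-+ 2 (a ∸ r) r ⟨
    2 * (a ∸ r + r)       ≡⟨ cong (2 *_) (ℕₚ.m∸n+n≡m r≤a) ⟩
    2 * a                 ≡⟨ cong (λ y → a + y) (ℕₚ.+-identityʳ a) ⟩
    a + a                 ≤⟨ ℕₚ.+-monoʳ-≤ a (ℕₚ.<⇒≤ (ℕₚ.≰⇒> ¬p)) ⟩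
    a + 2 * r             ∎))
  where
  open ℕₚ.≤-Reasoning
  q = z ZDM./ℕ a
  r = z ZDM.%ℕ a
  r≤a : r ≤ a
  r≤a = ℕₚ.<⇒≤ (ZDM.n%ℕd<d z a)
  lemma : ∀ x q a → x ℤ.+ q ℤ.* a ℤ.- (q ℤ.+ + 1) ℤ.* a ≡ x ℤ.- a
  lemma = ℤ-Solver.solve-∀
  eq : ∣ z ℤ.- (q ℤ.+ + 1) ℤ.* + a ∣ ≡ a ∸ r
  eq = begin-equality
    ∣ z ℤ.- (q ℤ.+ + 1) ℤ.* + a ∣
      ≡⟨ cong (λ y → ∣ y ℤ.- (q ℤ.+ + 1) ℤ.* + a ∣) (ZDM.a≡a%ℕn+[a/ℕn]*n z a) ⟩
    ∣ + r ℤ.+ q ℤ.* + a ℤ.- (q ℤ.+ + 1) ℤ.* + a ∣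
      ≡⟨ cong ∣_∣ (lemma (+ r) q (+ a)) ⟩
    ∣ + r ℤ.- + a ∣    ≡⟨ cong ∣_∣ (ℤₚ.m-n≡m⊖n r a) ⟩
    ∣ r ⊖ a ∣          ≡⟨ ℤₚ.∣⊖∣-≤ r≤a ⟩
    a ∸ r              ∎

-- Serves to bound all entries at once, which makes the exhaustive searches below finite.
norm₁ : ∀ {n} → (Fin n → ℤ) → ℕ
norm₁ {zero}  q = 0
norm₁ {suc n} q = ∣ q zero ∣ + norm₁ (q ∘ suc)

entry≤norm₁ : ∀ {n} (q : Fin n → ℤ) l → ∣ q l ∣ ≤ norm₁ q
entry≤norm₁ q zero    = ℕₚ.m≤m+n _ _
entry≤norm₁ q (suc l) = ℕₚ.≤-trans (entry≤norm₁ (q ∘ suc) l) (ℕₚ.m≤n+m _ _)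

-- A basis adapted to a box: coefficients within `N` reach every lattice point of the box of radius
-- `ρ`, while the multiples of `p i` up to `N i` stay in the box of radius `B`. The ratio of `B` to
-- `ρ` measures the loss. The case `r < D` arises when too few lattice points are short.
record Reduced {D} (Λ : Subset (ℤ^ D)) (ρ B : ℕ) : Set where
  field
    r     : ℕ
    r≤D   : r ≤ D
    p     : Fin r → Fin D → ℤ
    N     : Fin r → ℕ
    p∈    : ∀ i → Λ (p i)
    N≥1   : ∀ i → 1 ≤ N i
    short : ∀ i l → N i * ∣ p i l ∣ ≤ B
    cover : ∀ x → Λ x → Bounded ρ x →
            ∃ λ m → (∀ i → ∣ m i ∣ ≤ N i) × x ≗ comb p m
    indep : ∀ m → (∀ l → comb p m l ≡ + 0) → ∀ i → m i ≡ + 0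

-- One step of the reduction: the lattice is projected along a shortest vector p₁.
module Projection {D} (Λ : Subset (ℤ^ (suc D))) (Λ-sub : IsSubgroup (ℤ^ (suc D)) Λ)
    (Λ? : ∀ x → Dec (Λ x)) (a : ℕ) (a≥1 : 1 ≤ a)
    (p₁ : Fin (suc D) → ℤ) (p₁∈ : Λ p₁) (p₁≤ : Bounded a p₁)
    (j : Fin (suc D)) (p₁j : p₁ j ≡ + a)
    (minimal : ∀ x → Λ x → (∀ i → ∣ x i ∣ < a) → ∀ i → x i ≡ + 0) where

  private
    respΛ = proj₁ Λ-sub
    εΛ    = proj₁ (proj₂ Λ-sub)
    +Λ    = proj₁ (proj₂ (proj₂ Λ-sub))
    -Λ    = proj₂ (proj₂ (proj₂ Λ-sub))
    open ℕₚ.≤-Reasoning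
    instance
      a≢0 : NonZero a
      a≢0 = ℕ.>-nonZero a≥1

  natMulΛ : ∀ n {x} → Λ x → Λ (natMul (ℤ^ (suc D)) n x)
  natMulΛ zero    h = εΛ
  natMulΛ (suc n) h = +Λ h (natMulΛ n h)

  intMulΛ : ∀ n {x} → Λ x → Λ (intMul (ℤ^ (suc D)) n x)
  intMulΛ (+ n)    h = natMulΛ n h
  intMulΛ -[1+ n ] h = -Λ (natMulΛ (suc n) h)

  combΛ : ∀ {n} (p : Fin n → Fin (suc D) → ℤ) m → (∀ i → Λ (p i)) → Λ (comb p m)
  combΛ {zero}  p m h = εΛ
  combΛ {suc n} p m h = +Λ (intMulΛ (m zero) (h zero)) (combΛ (p ∘ suc) (m ∘ suc) (h ∘ suc))

  -- The projection along `p₁` onto the hyperplane where coordinate `j` vanishes, multiplied by `a`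
  -- to remain integral. It kills `p₁` because `p₁ j` is `a`.
  π : (Fin (suc D) → ℤ) → Fin D → ℤ
  π x l = + a ℤ.* x (punchIn j l) ℤ.- x j ℤ.* p₁ (punchIn j l)

  π-cong : ∀ {x y} → x ≗ y → π x ≗ π y
  π-cong e l = cong₂ (λ u v → + a ℤ.* u ℤ.- v ℤ.* p₁ (punchIn j l)) (e (punchIn j l)) (e j)

  π-+ : ∀ x y → π (λ i → x i ℤ.+ y i) ≗ (λ l → π x l ℤ.+ π y l)
  π-+ x y l = lemma (+ a) (x (punchIn j l)) (y (punchIn j l)) (x j) (y j) (p₁ (punchIn j l))
    where
    lemma : ∀ a u v s t p → a ℤ.* (u ℤ.+ v) ℤ.- (s ℤ.+ t) ℤ.* p
                          ≡ (a ℤ.* u ℤ.- s ℤ.* p) ℤ.+ (a ℤ.* v ℤ.- t ℤ.* p)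
    lemma = ℤ-Solver.solve-∀

  open Hom (ℤ^ (suc D)) (ℤ^ D) π π-cong π-+ public

  subtract : (Fin (suc D) → ℤ) → ℤ → Fin (suc D) → ℤ
  subtract x n i = x i ℤ.- n ℤ.* p₁ i

  π-subtract : ∀ x n → π (subtract x n) ≗ π x
  π-subtract x n l rewrite p₁j = lemma (+ a) (x (punchIn j l)) (x j) n (p₁ (punchIn j l))
    where
    lemma : ∀ a u v n p → a ℤ.* (u ℤ.- n ℤ.* p) ℤ.- (v ℤ.- n ℤ.* a) ℤ.* p ≡ a ℤ.* u ℤ.- v ℤ.* p
    lemma = ℤ-Solver.solve-∀

  subtract∈ : ∀ x n → Λ x → Λ (subtract x n)
  subtract∈ x n h = respΛ
    (λ i → cong (λ z → x i ℤ.+ ℤ.- z) (intMul-ℤ^ n p₁ i)) (+Λ h (-Λ (intMulΛ n p₁∈)))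

  reduce : ∀ x → ∃ λ n → 2 * ∣ subtract x n j ∣ ≤ a
  reduce x = proj₁ nm , subst (λ z → 2 * ∣ x j ℤ.- proj₁ nm ℤ.* z ∣ ≤ a) (sym p₁j) (proj₂ nm)
    where nm = nearestMultiple a a≥1 (x j)

  -- `a x i` is the projected coordinate plus `x j * p₁ i`, and the entries of `p₁` are at most `a`.
  -- The factor `N` is carried along so that bounds on `N * ∣ π x l ∣` transfer without division.
  coordinate-bound : ∀ N β x → (∀ l → N * ∣ π x l ∣ ≤ β) → ∀ i →
                     N * (a * ∣ x i ∣) ≤ β + N * (∣ x j ∣ * a)
  coordinate-bound N β x h i with j Fin.≟ i
  ... | yes refl = ℕₚ.≤-trans (ℕₚ.≤-reflexive (cong (N *_) (ℕₚ.*-comm a _))) (ℕₚ.m≤n+m _ β)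
  ... | no j≢i = begin
    N * (a * ∣ x i ∣)                       ≡⟨ cong (λ z → N * (a * ∣ x z ∣)) (Finₚ.punchIn-punchOut j≢i) ⟨
    N * (a * ∣ x i′ ∣)                      ≡⟨ cong (N *_) (ℤₚ.∣i*j∣≡∣i∣*∣j∣ (+ a) (x i′)) ⟨
    N * ∣ + a ℤ.* x i′ ∣                    ≡⟨ cong (λ z → N * ∣ z ∣) (lemma (+ a ℤ.* x i′) (x j ℤ.* p₁ i′)) ⟩
    N * ∣ π x l ℤ.+ x j ℤ.* p₁ i′ ∣         ≤⟨ ℕₚ.*-monoʳ-≤ N (ℤₚ.∣i+j∣≤∣i∣+∣j∣ (π x l) _) ⟩
    N * (∣ π x l ∣ + ∣ x j ℤ.* p₁ i′ ∣)     ≡⟨ ℕₚ.*-distribˡ-+ N _ _ ⟩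
    N * ∣ π x l ∣ + N * ∣ x j ℤ.* p₁ i′ ∣   ≤⟨ ℕₚ.+-mono-≤ (h l) (ℕₚ.*-monoʳ-≤ N second) ⟩
    β + N * (∣ x j ∣ * a)                   ∎
    where
    l  = Fin.punchOut j≢i
    i′ = punchIn j l
    lemma : ∀ u v → u ≡ (u ℤ.- v) ℤ.+ v
    lemma = ℤ-Solver.solve-∀
    second : ∣ x j ℤ.* p₁ i′ ∣ ≤ ∣ x j ∣ * a
    second = begin
      ∣ x j ℤ.* p₁ i′ ∣   ≡⟨ ℤₚ.∣i*j∣≡∣i∣*∣j∣ (x j) (p₁ i′) ⟩
      ∣ x j ∣ * ∣ p₁ i′ ∣ ≤⟨ ℕₚ.*-monoʳ-≤ ∣ x j ∣ (p₁≤ i′) ⟩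
      ∣ x j ∣ * a         ∎

  -- Subtracting the nearest multiple of `p₁` leaves `2 ∣ y j ∣ ≤ a`. As `π y` is zero, every
  -- coordinate is at most `∣ y j ∣ < a`, so `y` vanishes by minimality.
  kernel : ∀ x → Λ x → (∀ l → π x l ≡ + 0) → ∃ λ n → ∀ i → x i ≡ n ℤ.* p₁ i
  kernel x x∈ πx≡0 = n , λ i → ℤₚ.i-j≡0⇒i≡j (x i) _ (minimal y (subtract∈ x n x∈) y< i)
    where
    n = proj₁ (reduce x)
    y = subtract x n
    yj<a : ∣ y j ∣ < a
    yj<a = ℕₚ.*-cancelˡ-< 2 _ _ (ℕₚ.≤-<-trans (proj₂ (reduce x))
      (ℕₚ.m<m*n a 2 (s≤s (s≤s z≤n)) ⟨≤⟩ ℕₚ.≤-reflexive (ℕₚ.*-comm a 2)))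
      where
      _⟨≤⟩_ : ∀ {a b c} → a < b → b ≤ c → a < c
      _⟨≤⟩_ = ℕₚ.<-≤-trans
    y≤ : ∀ i → a * ∣ y i ∣ ≤ a * ∣ y j ∣
    y≤ i = begin
      a * ∣ y i ∣            ≡⟨ ℕₚ.*-identityˡ _ ⟨
      1 * (a * ∣ y i ∣)      ≤⟨ coordinate-bound 1 0 y (λ l → ℕₚ.≤-reflexive
                                 (cong (λ z → 1 * ∣ z ∣) (trans (π-subtract x n l) (πx≡0 l)))) i ⟩
      1 * (∣ y j ∣ * a)      ≡⟨ ℕₚ.*-identityˡ _ ⟩
      ∣ y j ∣ * a            ≡⟨ ℕₚ.*-comm _ a ⟩
      a * ∣ y j ∣            ∎
    y< : ∀ i → ∣ y i ∣ < a
    y< i = ℕₚ.≤-<-trans (ℕₚ.*-cancelˡ-≤ a (y≤ i)) yj<a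

  -- Minimality of p₁ bounds a by the size of any nonzero reduced vector, which absorbs the term N |x j| a.
  reduced-bound : ∀ N β x → Λ x → 2 * ∣ x j ∣ ≤ a → (∀ l → N * ∣ π x l ∣ ≤ β) →
                  ∀ i → N * (a * ∣ x i ∣) ≤ 2 * β
  reduced-bound N β x x∈ red h i with Finₚ.all? (λ l → ∣ x l ∣ ℕ.<? a)
  ... | yes small = ℕₚ.≤-trans (ℕₚ.≤-reflexive (trans
    (cong (λ z → N * (a * ∣ z ∣)) (minimal x x∈ small i))
    (trans (cong (N *_) (ℕₚ.*-zeroʳ a)) (ℕₚ.*-zeroʳ N)))) z≤n
  ... | no ¬small with Finₚ.¬∀⟶∃¬ (suc D) _ (λ l → ∣ x l ∣ ℕ.<? a) ¬small
  ...   | l , big = ℕₚ.*-cancelˡ-≤ 2 (begin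
    2 * (N * (a * ∣ x i ∣))         ≤⟨ twice i ⟩
    2 * β + N * (a * a)             ≤⟨ ℕₚ.+-monoʳ-≤ (2 * β) Naa ⟩
    2 * β + 2 * β                   ≡⟨ cong (λ y → 2 * β + y) (ℕₚ.+-identityʳ (2 * β)) ⟨
    2 * (2 * β)                     ∎)
    where
    twice : ∀ i → 2 * (N * (a * ∣ x i ∣)) ≤ 2 * β + N * (a * a)
    twice i = begin
      2 * (N * (a * ∣ x i ∣))           ≤⟨ ℕₚ.*-monoʳ-≤ 2 (coordinate-bound N β x h i) ⟩
      2 * (β + N * (∣ x j ∣ * a))       ≡⟨ lemma β N ∣ x j ∣ a ⟩
      2 * β + N * ((2 * ∣ x j ∣) * a)   ≤⟨ ℕₚ.+-monoʳ-≤ (2 * β) (ℕₚ.*-monoʳ-≤ N (ℕₚ.*-monoˡ-≤ a red)) ⟩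
      2 * β + N * (a * a)               ∎
      where
      lemma : ∀ β N x a → 2 * (β + N * (x * a)) ≡ 2 * β + N * ((2 * x) * a)
      lemma = ℕ-Solver.solve-∀
    Naa : N * (a * a) ≤ 2 * β
    Naa = ℕₚ.+-cancelʳ-≤ (N * (a * a)) _ _ (begin
      N * (a * a) + N * (a * a)   ≡⟨ cong (λ y → N * (a * a) + y) (ℕₚ.+-identityʳ _) ⟨
      2 * (N * (a * a))           ≤⟨ ℕₚ.*-monoʳ-≤ 2 (ℕₚ.*-monoʳ-≤ N (ℕₚ.*-monoʳ-≤ a (ℕₚ.≮⇒≥ big))) ⟩
      2 * (N * (a * ∣ x l ∣))     ≤⟨ twice l ⟩
      2 * β + N * (a * a)         ∎)

  Λ′ : Subset (ℤ^ D)
  Λ′ q = ∃ λ x → Λ x × π x ≗ q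

  Λ′-sub : IsSubgroup (ℤ^ D) Λ′
  Λ′-sub = (λ e (x , x∈ , h) → x , x∈ , λ l → trans (h l) (e l))
    , (_ , εΛ , hom-ε)
    , (λ (x , x∈ , h) (y , y∈ , k) → _ , +Λ x∈ y∈ , λ l → trans (π-+ x y l) (cong₂ ℤ._+_ (h l) (k l)))
    , (λ (x , x∈ , h) → _ , -Λ x∈ , λ l → trans (hom-⁻¹ x l) (cong ℤ.-_ (h l)))

  -- Preimages range over an infinite set, but one reduced along `p₁` has entries at most
  -- `2 * norm₁ q`, so a finite search decides.
  Λ′? : ∀ q → Dec (Λ′ q)
  Λ′? q = map′ (λ (x , _ , x∈ , e) → x , x∈ , e) bounded
    (searchBox (suc D) b (λ e (x∈ , h) → respΛ e x∈ , λ l → trans (π-cong (λ i → sym (e i)) l) (h l))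
      (λ x → Λ? x ×-dec Finₚ.all? (λ l → π x l ℤ.≟ q l)))
    where
    s = norm₁ q
    b = 2 * s
    bounded : Λ′ q → ∃ λ x → Bounded b x × (Λ x × π x ≗ q)
    bounded (x , x∈ , e) = y , y≤ , y∈ , πy
      where
      y = subtract x (proj₁ (reduce x))
      y∈ = subtract∈ x (proj₁ (reduce x)) x∈
      πy : π y ≗ q
      πy l = trans (π-subtract x (proj₁ (reduce x)) l) (e l)
      y≤ : Bounded b y
      y≤ i = begin
        ∣ y i ∣             ≤⟨ ℕₚ.m≤n*m ∣ y i ∣ a ⟩
        a * ∣ y i ∣         ≡⟨ ℕₚ.*-identityˡ _ ⟨
        1 * (a * ∣ y i ∣)   ≤⟨ reduced-bound 1 s y y∈ (proj₂ (reduce x)) (λ l →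
          ℕₚ.≤-trans (ℕₚ.≤-reflexive (trans (ℕₚ.*-identityˡ _) (cong ∣_∣ (πy l)))) (entry≤norm₁ q l)) i ⟩
        2 * s               ∎

  module Lift (n C ρ : ℕ) (D<n : suc D ≤ n) (C≥1 : 1 ≤ C) (a≤ρ : a ≤ ρ)
              (R : Reduced Λ′ (2 * a * ρ) (C * (2 * a * ρ))) where
    open Reduced R renaming (p to q; p∈ to q∈; N to M; N≥1 to M≥1; short to q-short;
                             cover to q-cover; indep to q-indep; r≤D to r≤)

    p′ : Fin r → Fin (suc D) → ℤ
    p′ i = subtract (proj₁ (q∈ i)) (proj₁ (reduce (proj₁ (q∈ i))))

    πp′ : ∀ i → π (p′ i) ≗ q i
    πp′ i l = trans (π-subtract (proj₁ (q∈ i)) (proj₁ (reduce (proj₁ (q∈ i)))) l) (proj₂ (proj₂ (q∈ i)) l)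

    p′∈ : ∀ i → Λ (p′ i)
    p′∈ i = subtract∈ (proj₁ (q∈ i)) (proj₁ (reduce (proj₁ (q∈ i)))) (proj₁ (proj₂ (q∈ i)))

    -- The projected lattice is reduced at radius `2 a ρ`, where `a` is the scale factor of `π`.
    -- That factor cancels here, so the loss does not depend on the length of `p₁`.
    p′-short : ∀ i l → M i * ∣ p′ i l ∣ ≤ 4 * (C * ρ)
    p′-short i l = ℕₚ.*-cancelˡ-≤ a (begin
      a * (M i * ∣ p′ i l ∣)        ≡⟨ lemma a (M i) ∣ p′ i l ∣ ⟩
      M i * (a * ∣ p′ i l ∣)        ≤⟨ reduced-bound (M i) _ (p′ i) (p′∈ i) (proj₂ (reduce (proj₁ (q∈ i))))
        (λ l → subst (λ z → M i * ∣ z ∣ ≤ C * (2 * a * ρ)) (sym (πp′ i l)) (q-short i l)) l ⟩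
      2 * (C * (2 * a * ρ))         ≡⟨ lemma′ C a ρ ⟩
      a * (4 * (C * ρ))             ∎)
      where
      lemma : ∀ a m x → a * (m * x) ≡ m * (a * x)
      lemma = ℕ-Solver.solve-∀
      lemma′ : ∀ c a r → 2 * (c * (2 * a * r)) ≡ a * (4 * (c * r))
      lemma′ = ℕ-Solver.solve-∀

    -- The loss per dimension is `8 n`. What remains of `x` after the lifted vectors is a multiple
    -- of `p₁`; its coordinate `j` is at most `ρ` plus `r ≤ n` terms of size `4 C ρ`, which is at
    -- most twice `4 n C ρ`.
    B = 8 * n * C * ρ

    ρ≤Cρ : ρ ≤ C * ρ
    ρ≤Cρ = ℕₚ.m≤n*m ρ C {{ℕ.>-nonZero C≥1}}

    n≥1 : 1 ≤ n
    n≥1 = ℕₚ.≤-trans (s≤s z≤n) D<n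

    4Cρ≤ : ∀ m → m ≤ n → m * (4 * (C * ρ)) ≤ n * (4 * (C * ρ))
    4Cρ≤ m m≤n = ℕₚ.*-monoˡ-≤ (4 * (C * ρ)) m≤n

    B-eq : n * (4 * (C * ρ)) + n * (4 * (C * ρ)) ≡ B
    B-eq = lemma n C ρ
      where
      lemma : ∀ n c r → n * (4 * (c * r)) + n * (4 * (c * r)) ≡ 8 * n * c * r
      lemma = ℕ-Solver.solve-∀

    Cρ≤ : C * ρ ≤ n * (4 * (C * ρ))
    Cρ≤ = ℕₚ.≤-trans (ℕₚ.m≤n*m (C * ρ) 4) (ℕₚ.m≤n*m _ n {{ℕ.>-nonZero n≥1}})

    N₁ = B / a

    N₁a≤B : N₁ * a ≤ B
    N₁a≤B = DM.m/n*n≤m B a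

    ρ≤B : ρ ≤ B
    ρ≤B = ℕₚ.≤-trans ρ≤Cρ (ℕₚ.≤-trans Cρ≤ (ℕₚ.≤-trans (ℕₚ.m≤m+n _ _) (ℕₚ.≤-reflexive B-eq)))

    bound₁ : ∀ m → m * a ≤ B → m ≤ N₁
    bound₁ m h = subst (_≤ N₁) (DM.m*n/n≡m m a) (DM./-monoˡ-≤ a h)

    reduced : Reduced Λ ρ B
    reduced = record
      { r = suc r ; r≤D = s≤s r≤ ; p = p₁ ◂ p′ ; N = N₁ ◂ M
      ; p∈ = λ { zero → p₁∈ ; (suc i) → p′∈ i }
      ; N≥1 = λ { zero → bound₁ 1 (ℕₚ.≤-trans (ℕₚ.≤-reflexive (ℕₚ.*-identityˡ a)) (ℕₚ.≤-trans a≤ρ ρ≤B))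
                ; (suc i) → M≥1 i }
      ; short = λ { zero l → ℕₚ.≤-trans (ℕₚ.*-monoʳ-≤ N₁ (p₁≤ l)) N₁a≤B
                  ; (suc i) l → ℕₚ.≤-trans (p′-short i l) (ℕₚ.≤-trans (ℕₚ.m≤n*m _ n {{ℕ.>-nonZero n≥1}})
                      (ℕₚ.≤-trans (ℕₚ.m≤m+n _ _) (ℕₚ.≤-reflexive B-eq))) }
      ; cover = cov
      ; indep = ind }
      where
      cov : ∀ x → Λ x → Bounded ρ x →
            ∃ λ m → (∀ i → ∣ m i ∣ ≤ (N₁ ◂ M) i) × x ≗ comb (p₁ ◂ p′) m
      cov x x∈ x≤ = n₁ ◂ m , (λ { zero → bound₁ ∣ n₁ ∣ n₁a≤B ; (suc i) → m≤ i }) , x≗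
        where
        πx≤ : Bounded (2 * a * ρ) (π x)
        πx≤ l = begin
          ∣ π x l ∣
            ≤⟨ ℤₚ.∣i-j∣≤∣i∣+∣j∣ (+ a ℤ.* x (punchIn j l)) _ ⟩
          ∣ + a ℤ.* x (punchIn j l) ∣ + ∣ x j ℤ.* p₁ (punchIn j l) ∣
            ≡⟨ cong₂ _+_ (ℤₚ.∣i*j∣≡∣i∣*∣j∣ (+ a) (x (punchIn j l))) (ℤₚ.∣i*j∣≡∣i∣*∣j∣ (x j) _) ⟩
          a * ∣ x (punchIn j l) ∣ + ∣ x j ∣ * ∣ p₁ (punchIn j l) ∣
            ≤⟨ ℕₚ.+-mono-≤ (ℕₚ.*-monoʳ-≤ a (x≤ _)) (ℕₚ.*-mono-≤ (x≤ j) (p₁≤ _)) ⟩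
          a * ρ + ρ * a
            ≡⟨ lemma a ρ ⟩
          2 * a * ρ ∎
          where
          lemma : ∀ a r → a * r + r * a ≡ 2 * a * r
          lemma = ℕ-Solver.solve-∀
        cv = q-cover (π x) (x , x∈ , λ _ → refl) πx≤
        m  = proj₁ cv
        m≤ = proj₁ (proj₂ cv)
        y  = comb p′ m
        z : Fin (suc D) → ℤ
        z i = x i ℤ.- y i
        πz : ∀ l → π z l ≡ + 0
        πz l = trans (π-+ x (λ i → ℤ.- y i) l) (trans
          (cong₂ ℤ._+_ (proj₂ (proj₂ cv) l)
            (trans (hom-⁻¹ y l) (cong ℤ.-_ (trans (hom-lin p′ m l)
              (Linear.lin-congᵍ (ℤ^ D) {g = λ i → π (p′ i)} {h = q} m πp′ l)))))
          (ℤₚ.+-inverseʳ (comb q m l)))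
        ker = kernel z (+Λ x∈ (-Λ (combΛ p′ m p′∈))) πz
        n₁ = proj₁ ker
        x≗ : x ≗ comb (p₁ ◂ p′) (n₁ ◂ m)
        x≗ i = trans (lemma (x i) (y i)) (cong (λ w → w ℤ.+ y i)
          (trans (proj₂ ker i) (sym (intMul-ℤ^ n₁ p₁ i))))
          where
          lemma : ∀ u v → u ≡ (u ℤ.- v) ℤ.+ v
          lemma = ℤ-Solver.solve-∀
        n₁a≤B : ∣ n₁ ∣ * a ≤ B
        n₁a≤B = begin
          ∣ n₁ ∣ * a              ≡⟨ cong (λ w → ∣ n₁ ∣ * ∣ w ∣) (sym p₁j) ⟩
          ∣ n₁ ∣ * ∣ p₁ j ∣       ≡⟨ ℤₚ.∣i*j∣≡∣i∣*∣j∣ n₁ (p₁ j) ⟨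
          ∣ n₁ ℤ.* p₁ j ∣         ≡⟨ cong ∣_∣ (sym (proj₂ ker j)) ⟩
          ∣ x j ℤ.- y j ∣         ≤⟨ ℤₚ.∣i-j∣≤∣i∣+∣j∣ (x j) (y j) ⟩
          ∣ x j ∣ + ∣ y j ∣       ≤⟨ ℕₚ.+-mono-≤ (ℕₚ.≤-trans (x≤ j) (ℕₚ.≤-trans ρ≤Cρ Cρ≤))
                                      (∣comb∣≤ (4 * (C * ρ)) p′ m (λ l i →
                                        ℕₚ.≤-trans (ℕₚ.*-monoˡ-≤ ∣ p′ l i ∣ (m≤ l)) (p′-short l i)) j) ⟩
          n * (4 * (C * ρ)) + r * (4 * (C * ρ))
            ≤⟨ ℕₚ.+-monoʳ-≤ _ (4Cρ≤ r (ℕₚ.≤-trans r≤ (ℕₚ.≤-trans (ℕₚ.n≤1+n D) D<n))) ⟩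
          n * (4 * (C * ρ)) + n * (4 * (C * ρ))   ≡⟨ B-eq ⟩
          B                       ∎
      -- Applying `π` removes the `p₁` term, so independence of `q` kills the other coefficients;
      -- coordinate `j` then says that `a` times the first coefficient is zero.
      ind : ∀ m → (∀ l → comb (p₁ ◂ p′) m l ≡ + 0) → ∀ i → m i ≡ + 0
      ind m h = λ { zero → m₀ ; (suc i) → ms i }
        where
        πp₁ : ∀ l → π p₁ l ≡ + 0
        πp₁ l rewrite p₁j = ℤₚ.+-inverseʳ (+ a ℤ.* p₁ (punchIn j l))
        ms : ∀ i → m (suc i) ≡ + 0
        ms = q-indep (m ∘ suc) λ l →
          trans (sym (Linear.lin-congᵍ (ℤ^ D) {g = λ i → π (p′ i)} {h = q} (m ∘ suc) πp′ l))
          (trans (sym (ℤₚ.+-identityˡ _))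
          (trans (cong (λ w → w ℤ.+ comb (λ i → π (p′ i)) (m ∘ suc) l)
            (sym (trans (intMul-ℤ^ (m zero) (π p₁) l)
              (trans (cong (m zero ℤ.*_) (πp₁ l)) (ℤₚ.*-zeroʳ (m zero))))))
          (trans (sym (hom-lin (p₁ ◂ p′) m l))
          (trans (π-cong h l) (hom-ε l)))))
        m₀p₁ : m zero ℤ.* p₁ j ≡ + 0
        m₀p₁ =
          trans (sym (intMul-ℤ^ (m zero) p₁ j))
          (trans (sym (ℤₚ.+-identityʳ _))
          (trans (cong (λ w → intMul (ℤ^ (suc D)) (m zero) p₁ j ℤ.+ w)
            (sym (trans (Linear.lin-cong (ℤ^ (suc D)) p′ ms j) (Linear.lin-0 (ℤ^ (suc D)) p′ j))))
          (h j)))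
        m₀ : m zero ≡ + 0
        m₀ = [ id , (λ e → contradiction (ℤₚ.+-injective (trans (sym p₁j) e)) (ℕₚ.>⇒≢ a≥1)) ]′
          (ℤₚ.i*j≡0⇒i≡0∨j≡0 (m zero) m₀p₁)

-- Each step splits off a shortest nonzero vector in the maximum norm. `n` stays fixed while `D`
-- decreases, so that every step loses the same factor `8 n`.
reduceLattice : ∀ n D → D ≤ n → (Λ : Subset (ℤ^ D)) → IsSubgroup (ℤ^ D) Λ → (∀ x → Dec (Λ x)) →
                ∀ ρ → Reduced Λ ρ ((8 * n) ^ D * ρ)
reduceLattice n zero D≤n Λ Λ-sub Λ? ρ = record
  { r = 0 ; r≤D = z≤n ; p = λ () ; N = λ () ; p∈ = λ () ; N≥1 = λ () ; short = λ ()
  ; cover = λ x _ _ → (λ ()) , (λ ()) , λ () ; indep = λ m _ () }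
reduceLattice n (suc D) D<n Λ Λ-sub Λ? ρ with least nonzero? ρ
  where
  nonzero? : ∀ a → Dec (∃ λ x → Bounded a x × (Λ x × ∃ λ i → ¬ x i ≡ + 0))
  nonzero? a = searchBox (suc D) a
    (λ e (x∈ , i , x≢0) → proj₁ Λ-sub e x∈ , i , λ z → x≢0 (trans (e i) z))
    (λ x → Λ? x ×-dec Finₚ.any? (λ i → ¬? (x i ℤ.≟ + 0)))
-- Without nonzero lattice points in the box, the empty basis covers it.
... | inj₂ none = record
  { r = 0 ; r≤D = z≤n ; p = λ () ; N = λ () ; p∈ = λ () ; N≥1 = λ () ; short = λ ()
  ; cover = λ x x∈ x≤ → (λ ()) , (λ ()) , λ i → decidable-stable (x i ℤ.≟ + 0)
      (λ x≢0 → none ρ ℕₚ.≤-refl (x , x≤ , x∈ , i , x≢0))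
  ; indep = λ m _ () }
... | inj₁ (zero , a≤ρ , (p , p≤ , p∈ , i , p≢0) , min) =
  contradiction (ℤₚ.∣i∣≡0⇒i≡0 (ℕₚ.n≤0⇒n≡0 (p≤ i))) p≢0
... | inj₁ (a@(suc a-1) , a≤ρ , (p , p≤ , p∈ , i₀ , p≢0) , min) = finish
  where
  minimal : ∀ x → Λ x → (∀ i → ∣ x i ∣ < a) → ∀ i → x i ≡ + 0
  minimal x x∈ x< i = decidable-stable (x i ℤ.≟ + 0)
    (λ x≢0 → min a-1 ℕₚ.≤-refl (x , (λ l → ℕₚ.≤-pred (x< l)) , x∈ , i , x≢0))
  large : ∃ λ j → ¬ ∣ p j ∣ < a
  large = Finₚ.¬∀⟶∃¬ (suc D) _ (λ l → ∣ p l ∣ ℕ.<? a) (λ p< → p≢0 (minimal p p∈ p< i₀))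
  j = proj₁ large
  ∣pj∣≡a : ∣ p j ∣ ≡ a
  ∣pj∣≡a = ℕₚ.≤-antisym (p≤ j) (ℕₚ.≮⇒≥ (proj₂ large))
  C≥1 : 1 ≤ (8 * n) ^ D
  C≥1 = ℕₚ.m^n>0 (8 * n) {{ℕ.>-nonZero (ℕₚ.≤-trans (s≤s z≤n) (ℕₚ.*-mono-≤ {1} {8} (s≤s z≤n) D<n))}} D
  with-p₁ : (p₁ : Fin (suc D) → ℤ) → Λ p₁ → Bounded a p₁ → p₁ j ≡ + a →
            Reduced Λ ρ ((8 * n) ^ suc D * ρ)
  with-p₁ p₁ p₁∈ p₁≤ p₁j = P.Lift.reduced n ((8 * n) ^ D) ρ D<n C≥1 a≤ρ
    (reduceLattice n D (ℕₚ.≤-trans (ℕₚ.n≤1+n D) D<n) P.Λ′ P.Λ′-sub P.Λ′? (2 * a * ρ))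
    where module P = Projection Λ Λ-sub Λ? a (s≤s z≤n) p₁ p₁∈ p₁≤ j p₁j minimal
  finish : Reduced Λ ρ ((8 * n) ^ suc D * ρ)
  -- The sign of the vector is chosen so that its maximal entry is `+ a`.
  finish with p j in e
  ... | + m      = with-p₁ p p∈ p≤ (trans e (cong +_ (trans (cong ∣_∣ (sym e)) ∣pj∣≡a)))
  ... | -[1+ m ] = with-p₁ (λ i → ℤ.- p i) (proj₂ (proj₂ (proj₂ Λ-sub)) p∈)
    (λ i → subst (_≤ a) (sym (ℤₚ.∣-i∣≡∣i∣ (p i))) (p≤ i))
    (trans (cong ℤ.-_ e) (cong +_ (trans (cong ∣_∣ (sym e)) ∣pj∣≡a)))

-- Families of balls, coverings and the elimination of generators.

record Balls (G : AbelianGroup 0ℓ 0ℓ) : Set₁ where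
  open AbelianGroup G using (Carrier; _≈_; _∙_; _⁻¹; ε)
  field
    B       : ℕ → Carrier → Set
    B-resp  : ∀ j → Respects G (B j)
    B?      : ∀ j x → Dec (B j x)
    B-ε     : B 0 ε
    B-⁻¹    : ∀ {j x} → B j x → B j (x ⁻¹)
    B-∙     : ∀ {i j x y} → B i x → B j y → B (i + j) (x ∙ y)
    B-mono  : ∀ {i j x} → i ≤ j → B i x → B j x
    B-split : ∀ i j {x} → B (i + j) x → ∃ λ y → ∃ λ z → B i y × B j z × x ≈ y ∙ z

module BallProperties {G : AbelianGroup 0ℓ 0ℓ} (balls : Balls G) where
  open AbelianGroup G renaming (refl to ≈refl; sym to ≈sym; trans to ≈trans)
  open Balls balls public
  open Linear G public

  B-natMul : ∀ {j x} n → B j x → B (n * j) (natMul G n x)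
  B-natMul zero    h = B-ε
  B-natMul (suc n) h = B-∙ h (B-natMul n h)

  B-intMul : ∀ {j x} a → B j x → B (∣ a ∣ * j) (intMul G a x)
  B-intMul (+ n)    h = B-natMul n h
  B-intMul -[1+ n ] h = B-⁻¹ (B-natMul (suc n) h)

  B-sum : ∀ {n j} {v : Fin n → Carrier} → (∀ i → B j (v i)) → B (n * j) (sumFin G v)
  B-sum {zero}  h = B-ε
  B-sum {suc n} h = B-∙ (h zero) (B-sum (h ∘ suc))

  B-lin : ∀ {n j b} {f : Fin n → Carrier} {v : Fin n → ℤ} →
          (∀ i → B j (f i)) → Bounded b v → B (n * (b * j)) (lin f v)
  B-lin {j = j} {v = v} h k =
    B-sum (λ i → B-mono (ℕₚ.*-monoˡ-≤ j (k i)) (B-intMul (v i) (h i)))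

  Covers : ∀ {D} → (Fin D → Carrier) → ℕ → ℕ → Set
  Covers f c u = ∀ x → B (2 * c) x →
    ∃ λ y → ∃ λ v → B c y × Bounded u v × x ≈ y ∙ lin f v

  -- `B-split` peels off one ball of radius `c` at a time. By induction the rest is a point of `B c`
  -- plus a combination, and the sum of two points of `B c` is covered again at the cost of one more
  -- `u`.
  covers-multiple : ∀ {D} {f : Fin D → Carrier} {c u} → Covers f c u → ∀ j x → B (suc j * c) x →
    ∃ λ y → ∃ λ v → B c y × Bounded (j * u) v × x ≈ y ∙ lin f v
  covers-multiple {f = f} {c} {u} cov zero x h =
    x , (λ _ → + 0) , subst (λ z → B z x) (ℕₚ.*-identityˡ c) h , (λ _ → z≤n) ,
    ≈trans (≈sym (identityʳ x)) (∙-congˡ (≈sym (lin-0 f)))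
  covers-multiple {f = f} {c} {u} cov (suc j) x h with B-split c (suc j * c) h
  ... | x₁ , x₂ , h₁ , h₂ , e with covers-multiple {f = f} cov j x₂ h₂
  ...   | y , v , y∈ , v≤ , e₂ with cov (x₁ ∙ y)
          (subst (λ z → B (c + z) (x₁ ∙ y)) (sym (ℕₚ.+-identityʳ c)) (B-∙ h₁ y∈))
  ...     | y′ , v′ , y′∈ , v′≤ , e₃ =
    y′ , (λ i → v′ i ℤ.+ v i) , y′∈ ,
    (λ i → ℕₚ.≤-trans (ℤₚ.∣i+j∣≤∣i∣+∣j∣ (v′ i) (v i)) (ℕₚ.+-mono-≤ (v′≤ i) (v≤ i))) ,
    (begin
      x                              ≈⟨ e ⟩
      x₁ ∙ x₂                        ≈⟨ ∙-congˡ e₂ ⟩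
      x₁ ∙ (y ∙ lin f v)             ≈⟨ assoc _ _ _ ⟨
      (x₁ ∙ y) ∙ lin f v             ≈⟨ ∙-congʳ e₃ ⟩
      (y′ ∙ lin f v′) ∙ lin f v      ≈⟨ assoc _ _ _ ⟩
      y′ ∙ (lin f v′ ∙ lin f v)      ≈⟨ ∙-congˡ (lin-+ f v′ v) ⟨
      y′ ∙ lin f (λ i → v′ i ℤ.+ v i) ∎)
    where open SetoidReasoning setoid

  -- `J` is the least value for which the radii close up. The new centre lies within
  -- `1 + ρ + 2 ∣ q ∣` times `c`, where `ρ ≤ t`; dividing a coefficient of size at most `2 J u` by
  -- `∣ v i ∣ > 8 u` gives `∣ q ∣ ≤ 1 + J / 4`. What is required is thus `3 + t + J / 2 ≤ J`.
  module Eliminate {D} (f : Fin (suc D) → Carrier) (c u t : ℕ) (u≥1 : 1 ≤ u)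
      (f∈ : ∀ i → B c (f i)) (cov : Covers f c u)
      (v : Fin (suc D) → ℤ) (v≤ : Bounded t v) (lin∈ : B (2 * c) (lin f v))
      (i : Fin (suc D)) (vi> : 8 * u < ∣ v i ∣)
      (J : ℕ) (J≡ : J ≡ 2 * (3 + t)) where

    f′ : Fin D → Carrier
    f′ l = f (punchIn i l)

    private
      α = v i
      instance
        α≢0 : ℤ.NonZero α
        α≢0 = ℤ.≢-nonZero {α} λ e → ℕₚ.n≮0 (subst (8 * u <_) (cong ∣_∣ e) vi>)
        u≢0 : NonZero u
        u≢0 = ℕ.>-nonZero u≥1
        J≢0 : NonZero J
        J≢0 = ℕ.>-nonZero (ℕₚ.≤-trans (s≤s z≤n) (ℕₚ.≤-reflexive (sym J≡)))

    quotient-bound : ∀ b → ∣ b ∣ ≤ 2 * J * u → 2 * ∣ b ZDM./ α ∣ ≤ 5 + t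
    quotient-bound b b≤ with ∣ b ZDM./ α ∣ in e
    ... | zero = z≤n
    ... | suc q = begin
      2 * suc q       ≡⟨ lemma₂ q ⟩
      2 + 2 * q       ≤⟨ ℕₚ.+-monoʳ-≤ 2 (ℕₚ.*-cancelˡ-≤ (4 * u) {{ℕₚ.m*n≢0 4 u}} (begin
        4 * u * (2 * q)       ≡⟨ lemma₃ u q ⟩
        q * (8 * u)           ≤⟨ ℕₚ.*-monoʳ-≤ q (ℕₚ.<⇒≤ vi>) ⟩
        q * ∣ α ∣             ≤⟨ ℕₚ.<⇒≤ (ℕₚ.+-cancelˡ-< ∣ α ∣ _ _ qα<) ⟩
        2 * J * u             ≡⟨ trans (cong (λ J → 2 * J * u) J≡) (lemma₄ u t) ⟩
        4 * u * (3 + t)       ∎)) ⟩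
      5 + t           ∎
      where
      open ℕₚ.≤-Reasoning
      lemma₂ : ∀ q → 2 * suc q ≡ 2 + 2 * q
      lemma₂ = ℕ-Solver.solve-∀
      lemma₃ : ∀ u q → 4 * u * (2 * q) ≡ q * (8 * u)
      lemma₃ = ℕ-Solver.solve-∀
      lemma₄ : ∀ u t → 2 * (2 * (3 + t)) * u ≡ 4 * u * (3 + t)
      lemma₄ = ℕ-Solver.solve-∀
      lemma₅ : ∀ r s → s ≡ (r ℤ.+ s) ℤ.- r
      lemma₅ = ℤ-Solver.solve-∀
      qα< : suc q * ∣ α ∣ < ∣ α ∣ + 2 * J * u
      qα< = begin-strict
        suc q * ∣ α ∣                          ≡⟨ cong (_* ∣ α ∣) e ⟨
        ∣ b ZDM./ α ∣ * ∣ α ∣                  ≡⟨ ℤₚ.∣i*j∣≡∣i∣*∣j∣ (b ZDM./ α) α ⟨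
        ∣ b ZDM./ α ℤ.* α ∣                    ≡⟨ cong ∣_∣ (lemma₅ (+ (b ZDM.% α)) (b ZDM./ α ℤ.* α)) ⟩
        ∣ (+ (b ZDM.% α) ℤ.+ b ZDM./ α ℤ.* α) ℤ.- + (b ZDM.% α) ∣
          ≡⟨ cong (λ z → ∣ z ℤ.- + (b ZDM.% α) ∣) (ZDM.a≡a%n+[a/n]*n b α) ⟨
        ∣ b ℤ.- + (b ZDM.% α) ∣                ≤⟨ ℤₚ.∣i-j∣≤∣i∣+∣j∣ b (+ (b ZDM.% α)) ⟩
        ∣ b ∣ + b ZDM.% α                      <⟨ ℕₚ.+-mono-≤-< b≤ (ZDM.n%d<d b α) ⟩
        2 * J * u + ∣ α ∣                      ≡⟨ ℕₚ.+-comm _ ∣ α ∣ ⟩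
        ∣ α ∣ + 2 * J * u                      ∎

    f′∈ : ∀ l → B (J * c) (f′ l)
    f′∈ l = B-mono (ℕₚ.m≤n*m c J) (f∈ (punchIn i l))

    -- With b i = q v i + ρ and v i f i = lin f v - lin f′ v′, the generator f i only survives through ρ.
    covers′ : Covers f′ (J * c) (J * J * u)
    covers′ x x∈ with covers-multiple {f = f} cov (2 * J) x (B-mono radius x∈)
      where
      radius : 2 * (J * c) ≤ suc (2 * J) * c
      radius = ℕₚ.≤-trans (ℕₚ.≤-reflexive (sym (ℕₚ.*-assoc 2 J c))) (ℕₚ.m≤n+m _ c)
    ... | y , b , y∈ , b≤ , e =
      z , w , B-mono z-radius z∈ , w≤ , x≈
      where
      q = b i ZDM./ α
      ρ = b i ZDM.% α
      z = (y ∙ intMul G (+ ρ) (f i)) ∙ intMul G q (lin f v)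
      w : Fin D → ℤ
      w l = b (punchIn i l) ℤ.- q ℤ.* v (punchIn i l)
      ρ≤t : ρ ≤ t
      ρ≤t = ℕₚ.≤-trans (ℕₚ.<⇒≤ (ZDM.n%d<d (b i) α)) (v≤ i)
      q≤ : 2 * ∣ q ∣ ≤ 5 + t
      q≤ = quotient-bound (b i) (b≤ i)
      z∈ : B ((c + ρ * c) + ∣ q ∣ * (2 * c)) z
      z∈ = B-∙ (B-∙ y∈ (B-intMul (+ ρ) (f∈ i))) (B-intMul q lin∈)
      module _ where
        open ℕₚ.≤-Reasoning
        z-radius : (c + ρ * c) + ∣ q ∣ * (2 * c) ≤ J * c
        z-radius = begin
          (c + ρ * c) + ∣ q ∣ * (2 * c)   ≡⟨ lemma c ρ ∣ q ∣ ⟩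
          (suc ρ + 2 * ∣ q ∣) * c         ≤⟨ ℕₚ.*-monoˡ-≤ c (ℕₚ.+-mono-≤ (s≤s ρ≤t) q≤) ⟩
          (suc t + (5 + t)) * c           ≡⟨ cong (_* c) (trans (lemma′ t) (sym J≡)) ⟩
          J * c                           ∎
          where
          lemma : ∀ c r q → (c + r * c) + q * (2 * c) ≡ ((1 + r) + 2 * q) * c
          lemma = ℕ-Solver.solve-∀
          lemma′ : ∀ t → (1 + t) + (5 + t) ≡ 2 * (3 + t)
          lemma′ = ℕ-Solver.solve-∀
        w≤ : Bounded (J * J * u) w
        w≤ l = begin
          ∣ w l ∣                             ≤⟨ ℤₚ.∣i-j∣≤∣i∣+∣j∣ (b (punchIn i l)) _ ⟩
          ∣ b (punchIn i l) ∣ + ∣ q ℤ.* v (punchIn i l) ∣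
            ≡⟨ cong (λ s → ∣ b (punchIn i l) ∣ + s) (ℤₚ.∣i*j∣≡∣i∣*∣j∣ q _) ⟩
          ∣ b (punchIn i l) ∣ + ∣ q ∣ * ∣ v (punchIn i l) ∣
            ≤⟨ ℕₚ.+-mono-≤ (b≤ _) (ℕₚ.*-mono-≤ q≤J (v≤ _)) ⟩
          2 * J * u + J * t                   ≤⟨ ℕₚ.+-monoʳ-≤ (2 * J * u) (ℕₚ.m≤m*n (J * t) u) ⟩
          2 * J * u + J * t * u               ≡⟨ lemma J u t ⟩
          J * (2 + t) * u                     ≤⟨ ℕₚ.*-monoˡ-≤ u (ℕₚ.*-monoʳ-≤ J 2+t≤J) ⟩
          J * J * u                           ∎
          where
          lemma : ∀ j u t → 2 * j * u + j * t * u ≡ j * (2 + t) * u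
          lemma = ℕ-Solver.solve-∀
          2+t≤J : 2 + t ≤ J
          2+t≤J = ℕₚ.≤-trans (ℕₚ.n≤1+n (2 + t)) (ℕₚ.≤-trans (ℕₚ.m≤n*m (3 + t) 2) (ℕₚ.≤-reflexive (sym J≡)))
          q≤J : ∣ q ∣ ≤ J
          q≤J = ℕₚ.≤-trans (ℕₚ.m≤n*m ∣ q ∣ 2) (ℕₚ.≤-trans q≤
            (ℕₚ.≤-trans (ℕₚ.+-monoʳ-≤ 5 (ℕₚ.m≤n*m t 2)) (ℕₚ.≤-trans (ℕₚ.n≤1+n _)
              (ℕₚ.≤-reflexive (trans (lemma″ t) (sym J≡))))))
            where
            lemma″ : ∀ t → 6 + 2 * t ≡ 2 * (3 + t)
            lemma″ = ℕ-Solver.solve-∀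
      open SetoidReasoning setoid
      b′ v′ : Fin D → ℤ
      b′ l = b (punchIn i l)
      v′ l = v (punchIn i l)
      lin-w : lin f′ w ≈ lin f′ b′ ∙ intMul G q (lin f′ v′) ⁻¹
      lin-w = ≈trans (lin-sub f′ b′ (λ l → q ℤ.* v′ l)) (∙-congˡ (⁻¹-cong (lin-* f′ q v′)))
      αf : intMul G α (f i) ∙ lin f′ v′ ≈ lin f v
      αf = ≈sym (sum-remove i (λ l → intMul G (v l) (f l)))
      bf : lin f b ≈ (intMul G (+ ρ) (f i) ∙ intMul G q (intMul G α (f i))) ∙ lin f′ b′
      bf = begin
        lin f b                                     ≈⟨ sum-remove i (λ l → intMul G (b l) (f l)) ⟩
        intMul G (b i) (f i) ∙ lin f′ b′            ≡⟨ cong (λ s → intMul G s (f i) ∙ lin f′ b′) (ZDM.a≡a%n+[a/n]*n (b i) α) ⟩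
        intMul G (+ ρ ℤ.+ q ℤ.* α) (f i) ∙ lin f′ b′
          ≈⟨ ∙-congʳ (≈trans (intMul-+ (+ ρ) (q ℤ.* α) (f i)) (∙-congˡ (intMul-* q α (f i)))) ⟩
        (intMul G (+ ρ) (f i) ∙ intMul G q (intMul G α (f i))) ∙ lin f′ b′ ∎
      x≈ : x ≈ z ∙ lin f′ w
      x≈ = begin
        x                                ≈⟨ e ⟩
        y ∙ lin f b                      ≈⟨ ∙-congˡ bf ⟩
        y ∙ ((g₁ ∙ g₂) ∙ g₃)                ≈⟨ ab-solve (y ∷ g₁ ∷ g₂ ∷ g₃ ∷ g₄ ∷ [])
          (v0 :+ ((v1 :+ v2) :+ v3)) (((v0 :+ v1) :+ (v2 :+ v4)) :+ (v3 :- v4)) ⟩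
        ((y ∙ g₁) ∙ (g₂ ∙ g₄)) ∙ (g₃ ∙ g₄ ⁻¹) ≈⟨ ∙-congʳ (∙-congˡ (intMul-∙ q (intMul G α (f i)) (lin f′ v′))) ⟨
        ((y ∙ g₁) ∙ intMul G q (intMul G α (f i) ∙ lin f′ v′)) ∙ (g₃ ∙ g₄ ⁻¹)
                                         ≈⟨ ∙-cong (∙-congˡ (intMul-cong q αf)) (≈sym lin-w) ⟩
        z ∙ lin f′ w                     ∎
        where
        g₁ = intMul G (+ ρ) (f i)
        g₂ = intMul G q (intMul G α (f i))
        g₃ = lin f′ b′
        g₄ = intMul G q (lin f′ v′)

  -- `indep` is a gap: a combination in the ball cannot have size above `8 u` and up to `K u²`. Only
  -- a bounded range can be asked for, since in a finite group large multiples of a generator return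
  -- to the ball. `j` records the enlargement of the radius beyond `c₀`.
  record Independent (K c₀ : ℕ) : Set where
    field
      D      : ℕ
      f      : Fin D → Carrier
      j u    : ℕ
      u≥1    : 1 ≤ u
    c = j * c₀
    field
      covers : Covers f c u
      indep  : ∀ v → Bounded (K * (u * u)) v → B (2 * c) (lin f v) → Bounded (8 * u) v

  module _ (K Y : ℕ) (Y≥ : 6 + 2 * K ≤ Y) where
    open Independent

    private
      Y≥1 : 1 ≤ Y
      Y≥1 = ℕₚ.≤-trans (s≤s z≤n) Y≥
      instance
        Y≢0 : NonZero Y
        Y≢0 = ℕ.>-nonZero Y≥1

    J-bound : ∀ u α → 1 ≤ u → u ≤ Y ^ α → 2 * (3 + K * (u * u)) ≤ Y ^ (1 + 2 * α)
    J-bound u α u≥1 u≤ = begin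
      2 * (3 + K * (u * u))       ≤⟨ ℕₚ.*-monoʳ-≤ 2 (ℕₚ.+-monoˡ-≤ (K * (u * u))
                                      (ℕₚ.m≤m*n 3 (u * u) {{ℕ.>-nonZero (ℕₚ.*-mono-≤ u≥1 u≥1)}})) ⟩
      2 * (3 * (u * u) + K * (u * u))   ≡⟨ lemma K (u * u) ⟩
      (6 + 2 * K) * (u * u)       ≤⟨ ℕₚ.*-mono-≤ Y≥ (ℕₚ.*-mono-≤ u≤ u≤) ⟩
      Y * (Y ^ α * Y ^ α)         ≡⟨ cong (λ z → Y * (Y ^ α * z)) (ℕₚ.*-identityʳ (Y ^ α)) ⟨
      Y * (Y ^ α) ^ 2             ≡⟨ cong (Y *_) (ℕₚ.^-*-assoc Y α 2) ⟩
      Y * Y ^ (α * 2)             ≡⟨ cong (λ z → Y * Y ^ z) (ℕₚ.*-comm α 2) ⟩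
      Y ^ (1 + 2 * α)             ∎
      where
      open ℕₚ.≤-Reasoning
      lemma : ∀ k s → 2 * (3 * s + k * s) ≡ (6 + 2 * k) * s
      lemma = ℕ-Solver.solve-∀

    -- `α` tracks the constants as exponents of `Y`. One elimination replaces `u` by `J² u` with
    -- `J ≤ Y ^ (1 + 2 α)`, which gives exponent `2 + 5 α ≤ 7 α`. A generator disappears each time,
    -- whence the final exponent `α * 7 ^ D`.
    eliminate : ∀ D (f : Fin D → Carrier) c u → (∀ i → B c (f i)) → Covers f c u → 1 ≤ u →
      ∀ α j → 1 ≤ α → u ≤ Y ^ α → 1 ≤ j → j ≤ Y ^ α →
      ∃ λ (I : Independent K c) → Independent.D I ≤ D × 1 ≤ Independent.j I
        × Independent.j I * j ≤ Y ^ (α * 7 ^ D) × Independent.u I ≤ Y ^ (α * 7 ^ D)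
    eliminate D f c u f∈ cov u≥1 α j α≥1 u≤ j≥1 j≤
      with searchBox D (K * (u * u))
             {P = λ v → B (2 * c) (lin f v) × ∃ λ i → 8 * u < ∣ v i ∣}
             (λ e (h , i , k) → B-resp (2 * c) (lin-cong f e) h , i , subst (λ z → 8 * u < ∣ z ∣) (e i) k)
             (λ v → B? (2 * c) (lin f v) ×-dec Finₚ.any? (λ i → 8 * u ℕ.<? ∣ v i ∣))
    ... | no ¬dep =
      record { D = D ; f = f ; j = 1 ; u = u ; u≥1 = u≥1
             ; covers = subst (λ z → Covers f z u) (sym (ℕₚ.*-identityˡ c)) cov
             ; indep = λ v v≤ h i → ℕₚ.≮⇒≥ (λ k → ¬dep (v , v≤ ,
                 subst (λ z → B (2 * z) (lin f v)) (ℕₚ.*-identityˡ c) h , i , k)) } ,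
      ℕₚ.≤-refl , ℕₚ.≤-refl , ℕₚ.≤-trans (ℕₚ.≤-reflexive (ℕₚ.*-identityˡ j)) (ℕₚ.≤-trans j≤ grow) ,
      ℕₚ.≤-trans u≤ grow
      where
      grow : Y ^ α ≤ Y ^ (α * 7 ^ D)
      grow = ℕₚ.^-monoʳ-≤ Y (ℕₚ.m≤m*n α (7 ^ D) {{ℕₚ.m^n≢0 7 D}})
    eliminate zero f c u f∈ cov u≥1 α j α≥1 u≤ j≥1 j≤ | yes (v , v≤ , h , () , k)
    eliminate (suc D) f c u f∈ cov u≥1 α j α≥1 u≤ j≥1 j≤ | yes (v , v≤ , h , i , k) =
      go (2 * (3 + K * (u * u))) refl
      where
      go : ∀ J → J ≡ 2 * (3 + K * (u * u)) →
           ∃ λ (I : Independent K c) → Independent.D I ≤ suc D × 1 ≤ Independent.j I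
             × Independent.j I * j ≤ Y ^ (α * 7 ^ suc D) × Independent.u I ≤ Y ^ (α * 7 ^ suc D)
      go J J≡ = finish (eliminate D E.f′ (J * c) (J * J * u) E.f′∈ E.covers′
             (ℕₚ.*-mono-≤ {1} {J * J} {1} {u} (ℕₚ.*-mono-≤ {1} {J} {1} {J} J≥1 J≥1) u≥1)
             (7 * α) (J * j) (ℕₚ.≤-trans α≥1 (ℕₚ.m≤n*m α 7)) u′≤
             (ℕₚ.*-mono-≤ {1} {J} {1} {j} J≥1 j≥1) j′≤)
        where
        J≥1 : 1 ≤ J
        J≥1 = ℕₚ.≤-trans (s≤s z≤n) (ℕₚ.≤-reflexive (sym J≡))
        module E = Eliminate f c u (K * (u * u)) u≥1 f∈ cov v v≤ h i k J J≡
        open ℕₚ.≤-Reasoning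
        J≤ : J ≤ Y ^ (1 + 2 * α)
        J≤ = ℕₚ.≤-trans (ℕₚ.≤-reflexive J≡) (J-bound u α u≥1 u≤)
        u′≤ : J * J * u ≤ Y ^ (7 * α)
        u′≤ = begin
          J * J * u                                 ≤⟨ ℕₚ.*-mono-≤ (ℕₚ.*-mono-≤ J≤ J≤) u≤ ⟩
          Y ^ (1 + 2 * α) * Y ^ (1 + 2 * α) * Y ^ α ≡⟨ cong (_* Y ^ α) (ℕₚ.^-distribˡ-+-* Y (1 + 2 * α) (1 + 2 * α)) ⟨
          Y ^ (1 + 2 * α + (1 + 2 * α)) * Y ^ α     ≡⟨ ℕₚ.^-distribˡ-+-* Y (1 + 2 * α + (1 + 2 * α)) α ⟨
          Y ^ (1 + 2 * α + (1 + 2 * α) + α)         ≤⟨ ℕₚ.^-monoʳ-≤ Y expo ⟩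
          Y ^ (7 * α)                               ∎
          where
          lemma : ∀ a → 1 + 2 * a + (1 + 2 * a) + a ≡ 2 * 1 + 5 * a
          lemma = ℕ-Solver.solve-∀
          lemma′ : ∀ a → 2 * a + 5 * a ≡ 7 * a
          lemma′ = ℕ-Solver.solve-∀
          expo : 1 + 2 * α + (1 + 2 * α) + α ≤ 7 * α
          expo = begin
            1 + 2 * α + (1 + 2 * α) + α   ≡⟨ lemma α ⟩
            2 * 1 + 5 * α                 ≤⟨ ℕₚ.+-monoˡ-≤ (5 * α) (ℕₚ.*-monoʳ-≤ 2 α≥1) ⟩
            2 * α + 5 * α                 ≡⟨ lemma′ α ⟩
            7 * α                         ∎
        j′≤ : J * j ≤ Y ^ (7 * α)
        j′≤ = begin
          J * j                      ≤⟨ ℕₚ.*-mono-≤ J≤ j≤ ⟩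
          Y ^ (1 + 2 * α) * Y ^ α    ≡⟨ ℕₚ.^-distribˡ-+-* Y (1 + 2 * α) α ⟨
          Y ^ (1 + 2 * α + α)        ≤⟨ ℕₚ.^-monoʳ-≤ Y expo ⟩
          Y ^ (7 * α)                ∎
          where
          lemma : ∀ a → a + 2 * a + a + 3 * a ≡ 7 * a
          lemma = ℕ-Solver.solve-∀
          expo : 1 + 2 * α + α ≤ 7 * α
          expo = begin
            1 + 2 * α + α           ≤⟨ ℕₚ.+-monoˡ-≤ α (ℕₚ.+-monoˡ-≤ (2 * α) α≥1) ⟩
            α + 2 * α + α           ≤⟨ ℕₚ.m≤m+n _ (3 * α) ⟩
            α + 2 * α + α + 3 * α   ≡⟨ lemma α ⟩
            7 * α                   ∎
        c-eq : ∀ I → Independent.j I * (J * c) ≡ Independent.j I * J * c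
        c-eq I = sym (ℕₚ.*-assoc (Independent.j I) J c)
        exp-eq : 7 * α * 7 ^ D ≡ α * 7 ^ suc D
        exp-eq = trans (cong (_* 7 ^ D) (ℕₚ.*-comm 7 α)) (ℕₚ.*-assoc α 7 (7 ^ D))
        finish : (∃ λ (I : Independent K (J * c)) → Independent.D I ≤ D × 1 ≤ Independent.j I
                    × Independent.j I * (J * j) ≤ Y ^ (7 * α * 7 ^ D) × Independent.u I ≤ Y ^ (7 * α * 7 ^ D)) →
                 ∃ λ (I : Independent K c) → Independent.D I ≤ suc D × 1 ≤ Independent.j I
                    × Independent.j I * j ≤ Y ^ (α * 7 ^ suc D) × Independent.u I ≤ Y ^ (α * 7 ^ suc D)
        finish (I , D≤ , j≥ , jJ≤ , uI≤) =
          record { D = Independent.D I ; f = Independent.f I ; j = Independent.j I * J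
                 ; u = Independent.u I ; u≥1 = Independent.u≥1 I
                 ; covers = subst (λ z → Covers (Independent.f I) z (Independent.u I)) (c-eq I) (Independent.covers I)
                 ; indep = λ w w≤ → Independent.indep I w w≤ ∘ subst (λ z → B (2 * z) (lin (Independent.f I) w)) (sym (c-eq I)) } ,
          ℕₚ.m≤n⇒m≤1+n D≤ , ℕₚ.*-mono-≤ j≥ (ℕₚ.≤-trans (s≤s z≤n) (ℕₚ.≤-reflexive (sym J≡))) ,
          subst₂ (λ x y → x ≤ Y ^ y) (sym (ℕₚ.*-assoc (Independent.j I) J j)) exp-eq jJ≤ ,
          subst (λ y → Independent.u I ≤ Y ^ y) exp-eq uI≤

-- The ball B c is, up to small combinations of f, a finite set R; addition on R is a group law up to a
-- cocycle κ, and averaging κ makes it a coboundary.  This yields exact coordinates ψ + ν v, scaled by ν = |R|.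
module LocalCover {G : AbelianGroup 0ℓ 0ℓ} (fin : IsFinite G) (balls : Balls G) (E K c₀ : ℕ)
    (E≥51 : 51 ≤ E) (K≥ : 2 * (E + 9) ≤ K) (I : BallProperties.Independent balls K c₀) where
  open AbelianGroup G renaming (refl to ≈refl; sym to ≈sym; trans to ≈trans)
  open BallProperties balls
  open Independent I using (D; f; u; u≥1; c; covers; indep) public
  open Finite G fin

  private
    module Z = Linear (ℤ^ D)
    instance
      u≢0 : NonZero u
      u≢0 = ℕ.>-nonZero u≥1
    -- `w` is the radius of closeness, `t` the upper end of the gap, and `y` the range in which
    -- representations are unique: `E u` for the coordinates themselves and `9 u` for the correction
    -- `ψ / ν`.
    w = 8 * u
    t = K * (u * u)
    y = (E + 9) * u

    y≥ : ∀ {a} → a ≤ E + 9 → a * u ≤ y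
    y≥ = ℕₚ.*-monoˡ-≤ u

    18≤E+9 : 18 ≤ E + 9
    18≤E+9 = ℕₚ.+-monoˡ-≤ 9 (ℕₚ.≤-trans (ℕₚ.m≤m+n 9 42) E≥51)

    2y≤t : y + y ≤ t
    2y≤t = begin
      y + y                       ≡⟨ lemma (E + 9) u ⟩
      2 * (E + 9) * (1 * u)       ≤⟨ ℕₚ.*-mono-≤ K≥ (ℕₚ.*-monoˡ-≤ u u≥1) ⟩
      K * (u * u)                 ∎
      where
      open ℕₚ.≤-Reasoning
      lemma : ∀ e u → e * u + e * u ≡ 2 * e * (1 * u)
      lemma = ℕ-Solver.solve-∀

    w²≤t : suc w * w ≤ t
    w²≤t = begin
      (1 + 8 * u) * (8 * u)       ≤⟨ ℕₚ.*-monoˡ-≤ (8 * u) (ℕₚ.+-monoˡ-≤ (8 * u) u≥1) ⟩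
      (u + 8 * u) * (8 * u)       ≡⟨ lemma u ⟩
      72 * (u * u)                ≤⟨ ℕₚ.*-monoˡ-≤ (u * u) (ℕₚ.≤-trans
                                      (ℕₚ.≤-trans (ℕₚ.m≤m+n 72 48) (ℕₚ.*-monoʳ-≤ 2 (ℕₚ.+-monoˡ-≤ 9 E≥51))) K≥) ⟩
      K * (u * u)                 ∎
      where
      open ℕₚ.≤-Reasoning
      lemma : ∀ u → (u + 8 * u) * (8 * u) ≡ 72 * (u * u)
      lemma = ℕ-Solver.solve-∀

    Bounded-+ : ∀ {a b} (v v′ : Fin D → ℤ) → Bounded a v → Bounded b v′ →
                Bounded (a + b) (λ i → v i ℤ.+ v′ i)
    Bounded-+ v v′ p q i = ℕₚ.≤-trans (ℤₚ.∣i+j∣≤∣i∣+∣j∣ (v i) (v′ i)) (ℕₚ.+-mono-≤ (p i) (q i))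

    Bounded-neg : ∀ {b} (v : Fin D → ℤ) → Bounded b v → Bounded b (λ i → ℤ.- v i)
    Bounded-neg {b} v p i = subst (_≤ b) (sym (ℤₚ.∣-i∣≡∣i∣ (v i))) (p i)

    Bounded-≤ : ∀ {a b} (v : Fin D → ℤ) → a ≤ b → Bounded a v → Bounded b v
    Bounded-≤ v a≤b p i = ℕₚ.≤-trans (p i) a≤b

    B-double : ∀ {x} → B (c + c) x → B (2 * c) x
    B-double {x} = subst (λ z → B z x) (cong (λ s → c + s) (sym (ℕₚ.+-identityʳ c)))

    Close : Carrier → Carrier → Set
    Close x x′ = ∃ λ v → Bounded w v × x ⊟ x′ ≈ lin f v

    Close? : ∀ x x′ → Dec (Close x x′)
    Close? x x′ = searchBox D w (λ e p → ≈trans p (lin-cong f e)) (λ v → (x ⊟ x′) ≈? lin f v)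

    Close-refl : ∀ x → Close x x
    Close-refl x = (λ _ → + 0) , (λ _ → z≤n) , ≈trans (inverseʳ x) (≈sym (lin-0 f))

    Close-sym : ∀ {x x′} → Close x x′ → Close x′ x
    Close-sym {x} {x′} (v , v≤ , e) = (λ i → ℤ.- v i) , Bounded-neg v v≤ ,
      ≈trans (ab-solve (x ∷ x′ ∷ []) (v1 :- v0) (:- (v0 :- v1)))
        (≈trans (⁻¹-cong e) (≈sym (lin-neg f v)))

    abstract
      B-size : ∃ (HasSize G (B c))
      B-size = hasSize (B-resp c) (B? c)
    element : Fin (proj₁ B-size) → Carrier
    element = proj₁ (proj₂ B-size)
    abstract
      B-net : Net Close element
      B-net = net Close? Close-refl Close-sym element

  ν : ℕ
  ν = proj₁ B-net

  R : Fin ν → Carrier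
  R i = element (proj₁ (proj₂ B-net) i)

  R∈ : ∀ i → B c (R i)
  R∈ i = proj₁ (proj₂ (proj₂ B-size)) (proj₁ (proj₂ B-net) i)

  R-separated : ∀ i j → Close (R i) (R j) → i ≡ j
  R-separated = proj₁ (proj₂ (proj₂ B-net))

  represent : ∀ x → B c x → ∃ λ i → ∃ λ v → Bounded w v × x ≈ R i ∙ lin f v
  represent x x∈ =
    let (l , x≈) = proj₂ (proj₂ (proj₂ (proj₂ B-size))) x∈
        (i , v , v≤ , e) = proj₂ (proj₂ (proj₂ B-net)) l
    in i , v , v≤ , ≈trans x≈ (≈trans (ab-solve (element l ∷ R i ∷ []) v0 (v1 :+ (v0 :- v1))) (∙-congˡ e))

  represent₂ : ∀ x → B (2 * c) x → ∃ λ i → ∃ λ v → Bounded (9 * u) v × x ≈ R i ∙ lin f v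
  represent₂ x x∈ =
    let (x′ , v , x′∈ , v≤ , e) = covers x x∈
        (i , v′ , v′≤ , e′) = represent x′ x′∈
    in i , (λ l → v l ℤ.+ v′ l) , Bounded-+ v v′ v≤ v′≤ ,
       ≈trans e (≈trans (∙-congʳ e′) (≈trans
         (ab-solve (R i ∷ lin f v′ ∷ lin f v ∷ []) ((v0 :+ v1) :+ v2) (v0 :+ (v2 :+ v1)))
         (∙-congˡ (≈sym (lin-+ f v v′)))))

  -- If z ≠ 0 were a relation, its multiple (w + 1) z would contradict the gap between w and t.
  no-relation : ∀ z → Bounded w z → lin f z ≈ ε → ∀ i → z i ≡ + 0
  no-relation z z≤ e i = ℤₚ.∣i∣≡0⇒i≡0 (ℕₚ.n<1⇒n≡0 (ℕₚ.*-cancelˡ-< (suc w) _ _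
    (s≤s (ℕₚ.≤-trans (ℕₚ.≤-reflexive (sym (ℤₚ.∣i*j∣≡∣i∣*∣j∣ (+ suc w) (z i))))
      (ℕₚ.≤-trans (indep (λ l → + suc w ℤ.* z l) bound in-ball i)
        (ℕₚ.≤-reflexive (sym (ℕₚ.*-identityʳ w))))))))
    where
    bound : Bounded t (λ l → + suc w ℤ.* z l)
    bound l = ℕₚ.≤-trans (ℕₚ.≤-reflexive (ℤₚ.∣i*j∣≡∣i∣*∣j∣ (+ suc w) (z l)))
      (ℕₚ.≤-trans (ℕₚ.*-monoʳ-≤ (suc w) (z≤ l)) w²≤t)
    in-ball : B (2 * c) (lin f (λ l → + suc w ℤ.* z l))
    in-ball = B-resp (2 * c) (≈sym (≈trans (lin-* f (+ suc w) z)
      (≈trans (intMul-cong (+ suc w) e) (intMul-ε (+ suc w))))) (B-mono z≤n B-ε)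

  abstract
    -- The two points of `R` differ by an element of `B (2 * c)` that is a combination of size at
    -- most `2 y ≤ t`. The gap shrinks it to size `w`, separation gives `i ≡ j`, and what is left is
    -- a relation among the generators, excluded by `no-relation`.
    unique : ∀ i j v v′ → Bounded y v → Bounded y v′ →
             R i ∙ lin f v ≈ R j ∙ lin f v′ → i ≡ j × v ≗ v′
    unique i j v v′ v≤ v′≤ e = i≡j , λ l →
      sym (ℤₚ.i-j≡0⇒i≡j (v′ l) (v l) (no-relation z (close (vanish i≡j)) (vanish i≡j) l))
      where
      z : Fin D → ℤ
      z l = v′ l ℤ.- v l
      difference : R i ⊟ R j ≈ lin f z
      difference = ≈trans (ab-solve (R i ∷ R j ∷ lin f v ∷ [])
          (v0 :- v1) ((v0 :+ v2) :- (v1 :+ v2)))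
        (≈trans (∙-congʳ e) (≈trans (ab-solve (R j ∷ lin f v ∷ lin f v′ ∷ [])
          ((v0 :+ v2) :- (v0 :+ v1)) (v2 :- v1)) (≈sym (lin-sub f v′ v))))
      z≤ : Bounded t z
      z≤ = Bounded-≤ z 2y≤t (Bounded-+ v′ (λ l → ℤ.- v l) v′≤ (Bounded-neg v v≤))
      i≡j : i ≡ j
      i≡j = R-separated i j (z , indep z z≤
        (B-resp (2 * c) difference (B-double (B-∙ (R∈ i) (B-⁻¹ (R∈ j))))) , difference)
      vanish : i ≡ j → lin f z ≈ ε
      vanish i≡j = ≈trans (≈sym difference)
        (≈trans (∙-congˡ (⁻¹-cong (reflexive (cong R (sym i≡j))))) (inverseʳ _))
      close : lin f z ≈ ε → Bounded w z
      close e = indep z z≤ (B-resp (2 * c) (≈sym e) (B-mono z≤n B-ε))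

  abstract
    product : ∀ i j → ∃ λ l → ∃ λ v → Bounded (9 * u) v × R i ∙ R j ≈ R l ∙ lin f v
    product i j = represent₂ (R i ∙ R j) (B-double (B-∙ (R∈ i) (R∈ j)))

  infixl 7 _⋆_
  _⋆_ : Fin ν → Fin ν → Fin ν
  i ⋆ j = proj₁ (product i j)

  κ : Fin ν → Fin ν → Fin D → ℤ
  κ i j = proj₁ (proj₂ (product i j))

  κ≤ : ∀ i j → Bounded (9 * u) (κ i j)
  κ≤ i j = proj₁ (proj₂ (proj₂ (product i j)))

  ⋆-eq : ∀ i j → R i ∙ R j ≈ R (i ⋆ j) ∙ lin f (κ i j)
  ⋆-eq i j = proj₂ (proj₂ (proj₂ (product i j)))

  private
    9u≤y : 9 * u ≤ y
    9u≤y = y≥ (ℕₚ.m≤n+m 9 E)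

    18u≤y : 9 * u + 9 * u ≤ y
    18u≤y = ℕₚ.≤-trans (ℕₚ.≤-reflexive (lemma u)) (y≥ 18≤E+9)
      where
      lemma : ∀ u → 9 * u + 9 * u ≡ 18 * u
      lemma = ℕ-Solver.solve-∀

  -- Cancelling `R i` leaves `R j` and `R l` with exchanged corrections, which uniqueness compares.
  -- Translations are thus permutations of the index set, as the averaging requires.
  ⋆-injective : ∀ i j l → i ⋆ j ≡ i ⋆ l → j ≡ l
  ⋆-injective i j l e = proj₁ (unique j l (κ i l) (κ i j)
    (Bounded-≤ (κ i l) 9u≤y (κ≤ i l)) (Bounded-≤ (κ i j) 9u≤y (κ≤ i j)) (begin
    R j ∙ lin f (κ i l)
      ≈⟨ ab-solve (R i ∷ R j ∷ lin f (κ i l) ∷ []) (v1 :+ v2) (((v0 :+ v1) :+ v2) :- v0) ⟩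
    ((R i ∙ R j) ∙ lin f (κ i l)) ⊟ R i
      ≈⟨ ∙-congʳ (∙-congʳ (⋆-eq i j)) ⟩
    ((R (i ⋆ j) ∙ lin f (κ i j)) ∙ lin f (κ i l)) ⊟ R i
      ≡⟨ cong (λ s → ((R s ∙ lin f (κ i j)) ∙ lin f (κ i l)) ⊟ R i) e ⟩
    ((R (i ⋆ l) ∙ lin f (κ i j)) ∙ lin f (κ i l)) ⊟ R i
      ≈⟨ ab-solve (R (i ⋆ l) ∷ lin f (κ i j) ∷ lin f (κ i l) ∷ R i ∷ [])
           (((v0 :+ v1) :+ v2) :- v3) (((v0 :+ v2) :+ v1) :- v3) ⟩
    ((R (i ⋆ l) ∙ lin f (κ i l)) ∙ lin f (κ i j)) ⊟ R i
      ≈⟨ ∙-congʳ (∙-congʳ (⋆-eq i l)) ⟨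
    ((R i ∙ R l) ∙ lin f (κ i j)) ⊟ R i
      ≈⟨ ab-solve (R i ∷ R l ∷ lin f (κ i j) ∷ []) (((v0 :+ v1) :+ v2) :- v0) (v1 :+ v2) ⟩
    R l ∙ lin f (κ i j) ∎))
    where open SetoidReasoning setoid

  -- Both bracketings of a triple product carry corrections of size at most `18 u`, inside the range
  -- of uniqueness.
  cocycle : ∀ i j l m → κ i j m ℤ.+ κ (i ⋆ j) l m ≡ κ j l m ℤ.+ κ i (j ⋆ l) m
  cocycle i j l m = proj₂ (unique ((i ⋆ j) ⋆ l) (i ⋆ (j ⋆ l))
    (λ m → κ i j m ℤ.+ κ (i ⋆ j) l m) (λ m → κ j l m ℤ.+ κ i (j ⋆ l) m)
    (Bounded-≤ (λ m → κ i j m ℤ.+ κ (i ⋆ j) l m) 18u≤y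
      (Bounded-+ (κ i j) (κ (i ⋆ j) l) (κ≤ i j) (κ≤ (i ⋆ j) l)))
    (Bounded-≤ (λ m → κ j l m ℤ.+ κ i (j ⋆ l) m) 18u≤y
      (Bounded-+ (κ j l) (κ i (j ⋆ l)) (κ≤ j l) (κ≤ i (j ⋆ l)))) (begin
    R (i ⋆ j ⋆ l) ∙ lin f (λ m → κ i j m ℤ.+ κ (i ⋆ j) l m)
      ≈⟨ ∙-congˡ (lin-+ f (κ i j) (κ (i ⋆ j) l)) ⟩
    R (i ⋆ j ⋆ l) ∙ (lin f (κ i j) ∙ lin f (κ (i ⋆ j) l))
      ≈⟨ ab-solve (R (i ⋆ j ⋆ l) ∷ lin f (κ i j) ∷ lin f (κ (i ⋆ j) l) ∷ [])
           (v0 :+ (v1 :+ v2)) ((v0 :+ v2) :+ v1) ⟩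
    (R (i ⋆ j ⋆ l) ∙ lin f (κ (i ⋆ j) l)) ∙ lin f (κ i j)
      ≈⟨ ∙-congʳ (⋆-eq (i ⋆ j) l) ⟨
    (R (i ⋆ j) ∙ R l) ∙ lin f (κ i j)
      ≈⟨ ab-solve (R (i ⋆ j) ∷ R l ∷ lin f (κ i j) ∷ []) ((v0 :+ v1) :+ v2) ((v0 :+ v2) :+ v1) ⟩
    (R (i ⋆ j) ∙ lin f (κ i j)) ∙ R l
      ≈⟨ ∙-congʳ (⋆-eq i j) ⟨
    (R i ∙ R j) ∙ R l
      ≈⟨ assoc _ _ _ ⟩
    R i ∙ (R j ∙ R l)
      ≈⟨ ∙-congˡ (⋆-eq j l) ⟩
    R i ∙ (R (j ⋆ l) ∙ lin f (κ j l))
      ≈⟨ assoc _ _ _ ⟨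
    (R i ∙ R (j ⋆ l)) ∙ lin f (κ j l)
      ≈⟨ ∙-congʳ (⋆-eq i (j ⋆ l)) ⟩
    (R (i ⋆ (j ⋆ l)) ∙ lin f (κ i (j ⋆ l))) ∙ lin f (κ j l)
      ≈⟨ ab-solve (R (i ⋆ (j ⋆ l)) ∷ lin f (κ i (j ⋆ l)) ∷ lin f (κ j l) ∷ [])
           ((v0 :+ v1) :+ v2) (v0 :+ (v2 :+ v1)) ⟩
    R (i ⋆ (j ⋆ l)) ∙ (lin f (κ j l) ∙ lin f (κ i (j ⋆ l)))
      ≈⟨ ∙-congˡ (lin-+ f (κ j l) (κ i (j ⋆ l))) ⟨
    R (i ⋆ (j ⋆ l)) ∙ lin f (λ m → κ j l m ℤ.+ κ i (j ⋆ l) m) ∎)) m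
    where open SetoidReasoning setoid

  -- A sum rather than a mean, in order to stay integral; this is why all coordinates are scaled by
  -- `ν`.
  ψ : Fin ν → Fin D → ℤ
  ψ i = sumFin (ℤ^ D) (κ i)

  ψ≤ : ∀ i → Bounded (ν * (9 * u)) (ψ i)
  ψ≤ i m = subst (λ z → ∣ z ∣ ≤ ν * (9 * u)) (sym (sum-ℤ^ (κ i) m))
    (∣∑∣≤ (9 * u) (λ l → κ i l m) (λ l → κ≤ i l m))

  -- Sum the cocycle identity over `l`: translation by `j` permutes the index in the last term, so
  -- `ν κ` is the coboundary of `ψ`. This is the argument by which the order of a finite group
  -- annihilates its second cohomology.
  ψ-⋆ : ∀ i j m → + ν ℤ.* κ i j m ℤ.+ ψ (i ⋆ j) m ≡ ψ i m ℤ.+ ψ j m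
  ψ-⋆ i j m = begin
    + ν ℤ.* κ i j m ℤ.+ ψ (i ⋆ j) m
      ≡⟨ cong (ℤ._+ ψ (i ⋆ j) m) (sym (trans (Z.sum-const ν (κ i j) m) (intMul-ℤ^ (+ ν) (κ i j) m))) ⟩
    sumFin (ℤ^ D) {ν} (λ l → κ i j) m ℤ.+ ψ (i ⋆ j) m
      ≡⟨ Z.sum-∙ (λ l → κ i j) (κ (i ⋆ j)) m ⟨
    sumFin (ℤ^ D) (λ l m → κ i j m ℤ.+ κ (i ⋆ j) l m) m
      ≡⟨ Z.sum-cong {v = λ l m → κ i j m ℤ.+ κ (i ⋆ j) l m} {w = λ l m → κ j l m ℤ.+ κ i (j ⋆ l) m}
           (λ l → cocycle i j l) m ⟩
    sumFin (ℤ^ D) (λ l m → κ j l m ℤ.+ κ i (j ⋆ l) m) m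
      ≡⟨ Z.sum-∙ (κ j) (λ l → κ i (j ⋆ l)) m ⟩
    ψ j m ℤ.+ sumFin (ℤ^ D) (λ l → κ i (j ⋆ l)) m
      ≡⟨ cong (λ s → ψ j m ℤ.+ s) (Z.sum-reindex (j ⋆_) (⋆-injective j) (κ i) m) ⟩
    ψ j m ℤ.+ ψ i m
      ≡⟨ ℤₚ.+-comm (ψ j m) (ψ i m) ⟩
    ψ i m ℤ.+ ψ j m ∎
    where open ≡-Reasoning

  -- A relation rather than a function: `v` is unrestricted, which makes `L` closed under addition
  -- but lets an element have many coordinates. Two coordinates of one element differ by a
  -- coordinate of `ε`, and `trivial` says that the only small one is zero.
  L : Carrier → (Fin D → ℤ) → Set
  L g p = ∃ λ i → ∃ λ v → g ≈ R i ∙ lin f v × (∀ m → p m ≡ ψ i m ℤ.+ + ν ℤ.* v m)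

  L-resp : ∀ {g g′ p p′} → g ≈ g′ → p ≗ p′ → L g p → L g′ p′
  L-resp e e′ (i , v , a , b) = i , v , ≈trans (≈sym e) a , λ m → trans (sym (e′ m)) (b m)

  L-∙ : ∀ {g g′ p p′} → L g p → L g′ p′ → L (g ∙ g′) (λ m → p m ℤ.+ p′ m)
  L-∙ {g} {g′} {p} {p′} (i , v , a , b) (i′ , v′ , a′ , b′) =
    i ⋆ i′ , (λ m → (v m ℤ.+ v′ m) ℤ.+ κ i i′ m) , gg , pp
    where
    gg : g ∙ g′ ≈ R (i ⋆ i′) ∙ lin f (λ m → (v m ℤ.+ v′ m) ℤ.+ κ i i′ m)
    gg = begin
      g ∙ g′                                             ≈⟨ ∙-cong a a′ ⟩
      (R i ∙ lin f v) ∙ (R i′ ∙ lin f v′)                ≈⟨ interchange _ _ _ _ ⟩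
      (R i ∙ R i′) ∙ (lin f v ∙ lin f v′)                ≈⟨ ∙-cong (⋆-eq i i′) (≈sym (lin-+ f v v′)) ⟩
      (R (i ⋆ i′) ∙ lin f (κ i i′)) ∙ lin f (λ m → v m ℤ.+ v′ m)
        ≈⟨ ab-solve (R (i ⋆ i′) ∷ lin f (κ i i′) ∷ lin f (λ m → v m ℤ.+ v′ m) ∷ [])
             ((v0 :+ v1) :+ v2) (v0 :+ (v2 :+ v1)) ⟩
      R (i ⋆ i′) ∙ (lin f (λ m → v m ℤ.+ v′ m) ∙ lin f (κ i i′))
        ≈⟨ ∙-congˡ (lin-+ f (λ m → v m ℤ.+ v′ m) (κ i i′)) ⟨
      R (i ⋆ i′) ∙ lin f (λ m → (v m ℤ.+ v′ m) ℤ.+ κ i i′ m) ∎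
      where open SetoidReasoning setoid
    pp : ∀ m → p m ℤ.+ p′ m ≡ ψ (i ⋆ i′) m ℤ.+ + ν ℤ.* ((v m ℤ.+ v′ m) ℤ.+ κ i i′ m)
    pp m = begin
      p m ℤ.+ p′ m
        ≡⟨ cong₂ ℤ._+_ (b m) (b′ m) ⟩
      (ψ i m ℤ.+ + ν ℤ.* v m) ℤ.+ (ψ i′ m ℤ.+ + ν ℤ.* v′ m)
        ≡⟨ lemma (ψ i m) (ψ i′ m) (+ ν) (v m) (v′ m) ⟩
      (ψ i m ℤ.+ ψ i′ m) ℤ.+ + ν ℤ.* (v m ℤ.+ v′ m)
        ≡⟨ cong (ℤ._+ + ν ℤ.* (v m ℤ.+ v′ m)) (sym (ψ-⋆ i i′ m)) ⟩
      (+ ν ℤ.* κ i i′ m ℤ.+ ψ (i ⋆ i′) m) ℤ.+ + ν ℤ.* (v m ℤ.+ v′ m)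
        ≡⟨ lemma′ (ψ (i ⋆ i′) m) (+ ν) (κ i i′ m) (v m ℤ.+ v′ m) ⟩
      ψ (i ⋆ i′) m ℤ.+ + ν ℤ.* ((v m ℤ.+ v′ m) ℤ.+ κ i i′ m) ∎
      where
      open ≡-Reasoning
      lemma : ∀ a b n v w → (a ℤ.+ n ℤ.* v) ℤ.+ (b ℤ.+ n ℤ.* w) ≡ (a ℤ.+ b) ℤ.+ n ℤ.* (v ℤ.+ w)
      lemma = ℤ-Solver.solve-∀
      lemma′ : ∀ s n k w → (n ℤ.* k ℤ.+ s) ℤ.+ n ℤ.* w ≡ s ℤ.+ n ℤ.* (w ℤ.+ k)
      lemma′ = ℤ-Solver.solve-∀

  private
    abstract
      origin : ∃ λ i → ∃ λ v → Bounded w v × ε ≈ R i ∙ lin f v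
      origin = represent ε (B-mono z≤n B-ε)
    o  = proj₁ origin
    ov = proj₁ (proj₂ origin)
    ov≤ : Bounded y ov
    ov≤ = Bounded-≤ ov (y≥ (ℕₚ.≤-trans (ℕₚ.m≤m+n 8 10) 18≤E+9)) (proj₁ (proj₂ (proj₂ origin)))
    o-eq : ε ≈ R o ∙ lin f ov
    o-eq = proj₂ (proj₂ (proj₂ origin))

    -- As `R o` equals `- lin f ov`, the product of `R o` with itself is `R o` corrected by `- ov`.
    -- Hence `o ⋆ o` is `o`, and `ψ-⋆` at this pair determines `ψ o`.
    ψ-o : ∀ m → ψ o m ℤ.+ + ν ℤ.* ov m ≡ + 0
    ψ-o m = begin
      ψ o m ℤ.+ + ν ℤ.* ov m                     ≡⟨ lemma (ψ o m) (+ ν) (ov m) ⟩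
      (ψ o m ℤ.+ ψ o m) ℤ.- (+ ν ℤ.* ℤ.- ov m ℤ.+ ψ o m)
        ≡⟨ cong (λ z → (ψ o m ℤ.+ ψ o m) ℤ.- (+ ν ℤ.* z ℤ.+ ψ o m)) (sym (proj₂ oo m)) ⟩
      (ψ o m ℤ.+ ψ o m) ℤ.- (+ ν ℤ.* κ o o m ℤ.+ ψ o m)
        ≡⟨ cong (λ z → (ψ o m ℤ.+ ψ o m) ℤ.- (+ ν ℤ.* κ o o m ℤ.+ ψ z m)) (sym (proj₁ oo)) ⟩
      (ψ o m ℤ.+ ψ o m) ℤ.- (+ ν ℤ.* κ o o m ℤ.+ ψ (o ⋆ o) m)
        ≡⟨ cong (λ s → (ψ o m ℤ.+ ψ o m) ℤ.- s) (ψ-⋆ o o m) ⟩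
      (ψ o m ℤ.+ ψ o m) ℤ.- (ψ o m ℤ.+ ψ o m)    ≡⟨ ℤₚ.+-inverseʳ (ψ o m ℤ.+ ψ o m) ⟩
      + 0 ∎
      where
      open ≡-Reasoning
      lemma : ∀ s n v → s ℤ.+ n ℤ.* v ≡ (s ℤ.+ s) ℤ.- (n ℤ.* ℤ.- v ℤ.+ s)
      lemma = ℤ-Solver.solve-∀
      oo : o ⋆ o ≡ o × κ o o ≗ (λ m → ℤ.- ov m)
      oo = unique (o ⋆ o) o (κ o o) (λ m → ℤ.- ov m) (Bounded-≤ (κ o o) 9u≤y (κ≤ o o)) (Bounded-neg ov ov≤)
        (≈trans (≈sym (⋆-eq o o)) (≈trans
          (ab-solve (R o ∷ lin f ov ∷ []) (v0 :+ v0) ((v0 :+ v1) :+ (v0 :- v1)))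
          (≈trans (∙-congʳ (≈sym o-eq)) (≈trans (identityˡ _) (∙-congˡ (≈sym (lin-neg f ov)))))))

  L-ε : L ε (λ _ → + 0)
  L-ε = o , ov , o-eq , λ m → sym (ψ-o m)

  private
    -- `R i ∙ R j` equals `- lin f v`, that is, `R o` corrected by `ov - v`. Uniqueness identifies
    -- `i ⋆ j` and `κ i j` accordingly, and `ψ-⋆` yields `ψ j`.
    opposite-ψ : ∀ i j v → Bounded w v → R i ⁻¹ ≈ R j ∙ lin f v →
                 ∀ m → ψ j m ≡ ℤ.- ψ i m ℤ.- + ν ℤ.* v m
    opposite-ψ i j v v≤ e m = begin
      ψ j m                                     ≡⟨ lemma (ψ i m) (ψ j m) ⟩
      (ψ i m ℤ.+ ψ j m) ℤ.- ψ i m               ≡⟨ cong (ℤ._- ψ i m) (sym (ψ-⋆ i j m)) ⟩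
      (+ ν ℤ.* κ i j m ℤ.+ ψ (i ⋆ j) m) ℤ.- ψ i m
        ≡⟨ cong₂ (λ a b → (+ ν ℤ.* a ℤ.+ ψ b m) ℤ.- ψ i m) (proj₂ ij m) (proj₁ ij) ⟩
      (+ ν ℤ.* (ov m ℤ.- v m) ℤ.+ ψ o m) ℤ.- ψ i m
        ≡⟨ lemma′ (+ ν) (ov m) (v m) (ψ o m) (ψ i m) ⟩
      (ψ o m ℤ.+ + ν ℤ.* ov m) ℤ.+ (ℤ.- ψ i m ℤ.- + ν ℤ.* v m)
        ≡⟨ cong (ℤ._+ (ℤ.- ψ i m ℤ.- + ν ℤ.* v m)) (ψ-o m) ⟩
      + 0 ℤ.+ (ℤ.- ψ i m ℤ.- + ν ℤ.* v m)       ≡⟨ ℤₚ.+-identityˡ _ ⟩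
      ℤ.- ψ i m ℤ.- + ν ℤ.* v m                 ∎
      where
      open ≡-Reasoning
      lemma : ∀ a b → b ≡ (a ℤ.+ b) ℤ.- a
      lemma = ℤ-Solver.solve-∀
      lemma′ : ∀ n w v s t → (n ℤ.* (w ℤ.- v) ℤ.+ s) ℤ.- t ≡ (s ℤ.+ n ℤ.* w) ℤ.+ (ℤ.- t ℤ.- n ℤ.* v)
      lemma′ = ℤ-Solver.solve-∀
      16u≤y : 8 * u + 8 * u ≤ y
      16u≤y = ℕₚ.≤-trans (ℕₚ.≤-reflexive (lemma″ u)) (y≥ (ℕₚ.≤-trans (ℕₚ.m≤m+n 16 2) 18≤E+9))
        where
        lemma″ : ∀ u → 8 * u + 8 * u ≡ 16 * u
        lemma″ = ℕ-Solver.solve-∀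
      ij : i ⋆ j ≡ o × κ i j ≗ (λ m → ov m ℤ.- v m)
      ij = unique (i ⋆ j) o (κ i j) (λ m → ov m ℤ.- v m) (Bounded-≤ (κ i j) 9u≤y (κ≤ i j))
        (Bounded-≤ (λ m → ov m ℤ.- v m) 16u≤y
          (Bounded-+ ov (λ m → ℤ.- v m) (proj₁ (proj₂ (proj₂ origin))) (Bounded-neg v v≤)))
        (≈trans (≈sym (⋆-eq i j)) (≈trans
          (ab-solve (R i ∷ R j ∷ lin f v ∷ []) (v0 :+ v1) ((v0 :+ (v1 :+ v2)) :- v2))
          (≈trans (∙-congʳ (≈trans (∙-congˡ (≈sym e)) (≈trans (inverseʳ _) o-eq)))
            (≈trans (assoc _ _ _) (∙-congˡ (≈sym (lin-sub f ov v)))))))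

    opposite : ∀ i → ∃ λ j → ∃ λ v → R i ⁻¹ ≈ R j ∙ lin f v ×
               (∀ m → ψ j m ≡ ℤ.- ψ i m ℤ.- + ν ℤ.* v m)
    opposite i = let (j , v , v≤ , e) = represent (R i ⁻¹) (B-⁻¹ (R∈ i))
                 in j , v , e , opposite-ψ i j v v≤ e

  L-⁻¹ : ∀ {g p} → L g p → L (g ⁻¹) (λ m → ℤ.- p m)
  L-⁻¹ {g} {p} (i , v , a , b) = let (j , v′ , e , ψj) = opposite i in
    j , (λ m → v′ m ℤ.- v m) ,
    ≈trans (⁻¹-cong a) (≈trans (ab-solve (R i ∷ lin f v ∷ []) (:- (v0 :+ v1)) ((:- v0) :- v1))
      (≈trans (∙-congʳ e) (≈trans (assoc _ _ _) (∙-congˡ (≈sym (lin-sub f v′ v)))))) ,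
    λ m → trans (cong ℤ.-_ (b m)) (trans (lemma (ψ i m) (+ ν) (v m) (v′ m))
      (cong (ℤ._+ + ν ℤ.* (v′ m ℤ.- v m)) (sym (ψj m))))
    where
    lemma : ∀ s n v w → ℤ.- (s ℤ.+ n ℤ.* v) ≡ (ℤ.- s ℤ.- n ℤ.* w) ℤ.+ n ℤ.* (w ℤ.- v)
    lemma = ℤ-Solver.solve-∀

  L-natMul : ∀ n {g p} → L g p → L (natMul G n g) (natMul (ℤ^ D) n p)
  L-natMul zero    h = L-ε
  L-natMul (suc n) h = L-∙ h (L-natMul n h)

  L-intMul : ∀ a {g p} → L g p → L (intMul G a g) (intMul (ℤ^ D) a p)
  L-intMul (+ n)    h = L-natMul n h
  L-intMul -[1+ n ] h = L-⁻¹ (L-natMul (suc n) h)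

  L-lin : ∀ {r} (g : Fin r → Carrier) (p : Fin r → Fin D → ℤ) m → (∀ i → L (g i) (p i)) →
          L (lin g m) (comb p m)
  L-lin {zero}  g p m h = L-ε
  L-lin {suc r} g p m h = L-∙ (L-intMul (m zero) (h zero)) (L-lin (g ∘ suc) (p ∘ suc) (m ∘ suc) (h ∘ suc))

  ν≥1 : 1 ≤ ν
  ν≥1 = ℕₚ.≤-trans (s≤s z≤n) (Finₚ.toℕ<n o)

  private
    instance
      ν≢0 : NonZero ν
      ν≢0 = ℕ.>-nonZero ν≥1

    numerator : ∀ i (v p : Fin D → ℤ) → (∀ m → p m ≡ ψ i m ℤ.+ + ν ℤ.* v m) → ∀ m → ν * ∣ v m ∣ ≤ ∣ p m ∣ + ν * (9 * u)
    numerator i v p b m = begin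
      ν * ∣ v m ∣                       ≡⟨ ℤₚ.∣i*j∣≡∣i∣*∣j∣ (+ ν) (v m) ⟨
      ∣ + ν ℤ.* v m ∣                   ≡⟨ cong ∣_∣ (lemma (ψ i m) (+ ν ℤ.* v m)) ⟩
      ∣ (ψ i m ℤ.+ + ν ℤ.* v m) ℤ.- ψ i m ∣   ≡⟨ cong (λ z → ∣ z ℤ.- ψ i m ∣) (b m) ⟨
      ∣ p m ℤ.- ψ i m ∣                 ≤⟨ ℤₚ.∣i-j∣≤∣i∣+∣j∣ (p m) (ψ i m) ⟩
      ∣ p m ∣ + ∣ ψ i m ∣               ≤⟨ ℕₚ.+-monoʳ-≤ ∣ p m ∣ (ψ≤ i m) ⟩
      ∣ p m ∣ + ν * (9 * u)             ∎
      where
      open ℕₚ.≤-Reasoning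
      lemma : ∀ s t → t ≡ (s ℤ.+ t) ℤ.- s
      lemma = ℤ-Solver.solve-∀

  L? : ∀ g p → Dec (L g p)
  L? g p = map′ (λ (i , v , _ , a , b) → i , v , a , b)
    (λ (i , v , a , b) → i , v , (λ m → ℕₚ.≤-trans (ℕₚ.m≤n*m ∣ v m ∣ ν)
      (ℕₚ.≤-trans (numerator i v p b m) (ℕₚ.+-monoˡ-≤ (ν * (9 * u)) (entry≤norm₁ p m)))) , a , b)
    (Finₚ.any? (λ i → searchBox D (norm₁ p + ν * (9 * u))
      (λ e (a , b) → ≈trans a (∙-congˡ (lin-cong f e)) , λ m → trans (b m) (cong (λ z → ψ i m ℤ.+ + ν ℤ.* z) (e m)))
      (λ v → (g ≈? R i ∙ lin f v) ×-dec Finₚ.all? (λ m → p m ℤ.≟ ψ i m ℤ.+ + ν ℤ.* v m))))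

  small : ∀ {g p} → Bounded (ν * (E * u)) p → (h : L g p) → Bounded ((E + 9) * u) (proj₁ (proj₂ h))
  small {g} {p} p≤ (i , v , a , b) m = ℕₚ.*-cancelˡ-≤ ν (begin
    ν * ∣ v m ∣                   ≤⟨ numerator i v p b m ⟩
    ∣ p m ∣ + ν * (9 * u)         ≤⟨ ℕₚ.+-monoˡ-≤ (ν * (9 * u)) (p≤ m) ⟩
    ν * (E * u) + ν * (9 * u)     ≡⟨ lemma ν E u ⟩
    ν * ((E + 9) * u)             ∎)
    where
    open ℕₚ.≤-Reasoning
    lemma : ∀ n e u → n * (e * u) + n * (9 * u) ≡ n * ((e + 9) * u)
    lemma = ℕ-Solver.solve-∀

  -- The given representation of `ε` and the one at `o` both lie in the range of uniqueness, and the
  -- latter has coordinate zero by `ψ-o`.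
  trivial : ∀ p → L ε p → Bounded (ν * (E * u)) p → ∀ m → p m ≡ + 0
  trivial p h@(i , v , a , b) p≤ m =
    let (i≡o , v≗) = unique i o v ov (small p≤ h) ov≤ (≈trans (≈sym a) o-eq)
    in trans (b m) (trans (cong₂ (λ l z → ψ l m ℤ.+ + ν ℤ.* z) i≡o (v≗ m)) (ψ-o m))

  agree : ∀ {g p p′} → L g p → L g p′ → Bounded (ν * (E * u)) (λ m → p m ℤ.- p′ m) → p ≗ p′
  agree {g} {p} {p′} h h′ b m = ℤₚ.i-j≡0⇒i≡j (p m) (p′ m)
    (trivial (λ m → p m ℤ.- p′ m) (L-resp (inverseʳ g) (λ _ → refl) (L-∙ h (L-⁻¹ h′))) b m)

  -- The constant is `17 = 9 + 8`, from the bound on `ψ / ν` and the radius of closeness.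
  lift : ∀ x → B c x → ∃ λ p → L x p × Bounded (ν * (17 * u)) p
  lift x x∈ = let (i , v , v≤ , e) = represent x x∈ in
    (λ m → ψ i m ℤ.+ + ν ℤ.* v m) , (i , v , e , λ _ → refl) , bound i v v≤
    where
    open ℕₚ.≤-Reasoning
    lemma : ∀ n u → n * (9 * u) + n * (8 * u) ≡ n * (17 * u)
    lemma = ℕ-Solver.solve-∀
    bound : ∀ i v → Bounded w v → Bounded (ν * (17 * u)) (λ m → ψ i m ℤ.+ + ν ℤ.* v m)
    bound i v v≤ m = begin
      ∣ ψ i m ℤ.+ + ν ℤ.* v m ∣           ≤⟨ ℤₚ.∣i+j∣≤∣i∣+∣j∣ (ψ i m) _ ⟩
      ∣ ψ i m ∣ + ∣ + ν ℤ.* v m ∣         ≡⟨ cong (λ z → ∣ ψ i m ∣ + z) (ℤₚ.∣i*j∣≡∣i∣*∣j∣ (+ ν) (v m)) ⟩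
      ∣ ψ i m ∣ + ν * ∣ v m ∣             ≤⟨ ℕₚ.+-mono-≤ (ψ≤ i m) (ℕₚ.*-monoʳ-≤ ν (v≤ m)) ⟩
      ν * (9 * u) + ν * (8 * u)           ≡⟨ lemma ν u ⟩
      ν * (17 * u)                        ∎

  -- All multiples n x with n ≤ c stay in the ball B c, so the coordinates of x are of order 1 / c.
  lift-unit : 1 ≤ c → ∀ x → B 1 x → ∃ λ p → L x p × Bounded (ν * (17 * u)) (λ m → + c ℤ.* p m)
  lift-unit c≥1 x x∈ = p , h , multiples c ℕₚ.≤-refl
    where
    first = lift x (B-mono c≥1 x∈)
    p = proj₁ first
    h = proj₁ (proj₂ first)
    multiples : ∀ n → n ≤ c → Bounded (ν * (17 * u)) (λ m → + n ℤ.* p m)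
    multiples zero    n≤ m = z≤n
    multiples (suc n) n≤ = bound (lift (natMul G (suc n) x)
        (B-mono (ℕₚ.≤-trans (ℕₚ.≤-reflexive (ℕₚ.*-identityʳ (suc n))) n≤) (B-natMul (suc n) x∈)))
      where
      open ℕₚ.≤-Reasoning
      h″ : L (natMul G (suc n) x) (λ m → + suc n ℤ.* p m)
      h″ = L-resp ≈refl (intMul-ℤ^ (+ suc n) p) (L-natMul (suc n) h)
      lemma : ∀ n u → n * (17 * u) + n * (17 * u) + n * (17 * u) ≡ n * (51 * u)
      lemma = ℕ-Solver.solve-∀
      bound : (∃ λ q → L (natMul G (suc n) x) q × Bounded (ν * (17 * u)) q) →
              Bounded (ν * (17 * u)) (λ m → + suc n ℤ.* p m)
      bound (q , h′ , q≤) m = subst (λ z → ∣ z ∣ ≤ ν * (17 * u)) (sym (same m)) (q≤ m)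
        where
        -- The bound does not accumulate: the multiple and the small coordinate `q` differ by at
        -- most three times `17 u` in units of `ν`, so `E ≥ 51` makes them coincide, and the bound
        -- for `q` applies afresh.
        same : (λ m → + suc n ℤ.* p m) ≗ q
        same = agree h″ h′ λ m → begin
          ∣ + suc n ℤ.* p m ℤ.- q m ∣               ≤⟨ ℤₚ.∣i-j∣≤∣i∣+∣j∣ (+ suc n ℤ.* p m) (q m) ⟩
          ∣ + suc n ℤ.* p m ∣ + ∣ q m ∣             ≡⟨ cong (λ z → ∣ z ∣ + ∣ q m ∣) (ℤₚ.suc-* (+ n) (p m)) ⟩
          ∣ p m ℤ.+ + n ℤ.* p m ∣ + ∣ q m ∣         ≤⟨ ℕₚ.+-monoˡ-≤ ∣ q m ∣ (ℤₚ.∣i+j∣≤∣i∣+∣j∣ (p m) _) ⟩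
          ∣ p m ∣ + ∣ + n ℤ.* p m ∣ + ∣ q m ∣
            ≤⟨ ℕₚ.+-mono-≤ (ℕₚ.+-mono-≤ (proj₂ (proj₂ first) m) (multiples n (ℕₚ.<⇒≤ n≤) m)) (q≤ m) ⟩
          ν * (17 * u) + ν * (17 * u) + ν * (17 * u)   ≡⟨ lemma ν u ⟩
          ν * (51 * u)                              ≤⟨ ℕₚ.*-monoʳ-≤ ν (ℕₚ.*-monoˡ-≤ u E≥51) ⟩
          ν * (E * u)                               ∎

-- Sumsets, their difference balls, and counting by disjoint translates.

module Sumsets (G : AbelianGroup 0ℓ 0ℓ) (fin : IsFinite G) (X : Subset G) (X-resp : Respects G X)
    (0∈X : X (AbelianGroup.ε G)) (X? : ∀ x → Dec (X x)) where
  open AbelianGroup G renaming (refl to ≈refl; sym to ≈sym; trans to ≈trans)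
  open Linear G
  open Finite G fin
  open AGP G using (∙-cancelˡ)

  -- The iterated sumset in a form that exposes one summand at a time, so that search decides
  -- membership.
  T : ℕ → Carrier → Set
  T zero    x = x ≈ ε
  T (suc j) x = ∃ λ y → X y × T j (x ⊟ y)

  T-resp : ∀ j → Respects G (T j)
  T-resp zero    e p           = ≈trans (≈sym e) p
  T-resp (suc j) e (y , p , q) = y , p , T-resp j (∙-congʳ e) q

  T? : ∀ j x → Dec (T j x)
  T? zero    x = x ≈? ε
  T? (suc j) x = search (λ e (p , q) → X-resp e p , T-resp j (∙-congˡ (⁻¹-cong e)) q)
    (λ y → X? y ×-dec T? j (x ⊟ y))

  T-∙ : ∀ i j {x y} → T i x → T j y → T (i + j) (x ∙ y)
  T-∙ zero    j {x} {y} e q = T-resp j (≈sym (≈trans (∙-congʳ e) (identityˡ y))) q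
  T-∙ (suc i) j {x} {y} (z , p , q) r = z , p , T-resp (i + j)
    (ab-solve (x ∷ y ∷ z ∷ []) ((v0 :- v2) :+ v1) ((v0 :+ v1) :- v2)) (T-∙ i j q r)

  T-split : ∀ i j {x} → T (i + j) x → ∃ λ y → ∃ λ z → T i y × T j z × x ≈ y ∙ z
  T-split zero    j {x} p = ε , x , ≈refl , p , ≈sym (identityˡ x)
  T-split (suc i) j {x} (w , p , q) =
    let (y , z , y∈ , z∈ , e) = T-split i j q
    in w ∙ y , z , (w , p , T-resp i (ab-solve (w ∷ y ∷ []) v1 ((v0 :+ v1) :- v0)) y∈) , z∈ ,
       ≈trans (ab-solve (x ∷ w ∷ []) v0 (v1 :+ (v0 :- v1))) (≈trans (∙-congˡ e) (≈sym (assoc _ _ _)))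

  T-ε : ∀ j → T j ε
  T-ε zero    = ≈refl
  T-ε (suc j) = ε , 0∈X , T-resp j (≈sym (inverseʳ ε)) (T-ε j)

  T-mono : ∀ {i j x} → i ≤ j → T i x → T j x
  T-mono {i} {j} {x} i≤j p = subst (λ n → T n x) (ℕₚ.m+[n∸m]≡n i≤j)
    (T-resp (i + (j ∸ i)) (identityʳ x) (T-∙ i (j ∸ i) p (T-ε (j ∸ i))))

  T-natMul : ∀ n j {x} → T j x → T (n * j) (natMul G n x)
  T-natMul zero    j p = ≈refl
  T-natMul (suc n) j p = T-∙ j (n * j) p (T-natMul n j p)

  T-sum : ∀ {n} j (v : Fin n → Carrier) → (∀ i → T j (v i)) → T (n * j) (sumFin G v)
  T-sum {zero}  j v p = ≈refl
  T-sum {suc n} j v p = T-∙ j (n * j) (p zero) (T-sum j (v ∘ suc) (p ∘ suc))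

  T⇒sumset : ∀ k {x} → T k x → sumset G k X x
  T⇒sumset zero    e = (λ ()) , (λ ()) , ≈sym e
  T⇒sumset (suc k) {x} (y , p , q) =
    let (v , v∈ , e) = T⇒sumset k q
    in y ◂ v , (λ { zero → p ; (suc i) → v∈ i }) ,
       ≈trans (∙-congˡ e) (ab-solve (x ∷ y ∷ []) (v1 :+ (v0 :- v1)) v0)

  T1⇒X : ∀ {x} → T 1 x → X x
  T1⇒X {x} (y , p , e) = X-resp (≈trans (≈trans (≈sym (identityˡ y)) (∙-congʳ (≈sym e)))
    (ab-solve (x ∷ y ∷ []) ((v0 :- v1) :+ v1) v0)) p

  X⇒T1 : ∀ {x} → X x → T 1 x
  X⇒T1 {x} p = x , p , inverseʳ x

  abstract
    T-size : ∀ j → ∃ (HasSize G (T j))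
    T-size j = hasSize (T-resp j) (T? j)

  W : ℕ → ℕ
  W j = proj₁ (T-size j)

  W-size : ∀ j → HasSize G (T j) (W j)
  W-size j = proj₂ (T-size j)

  W-mono : ∀ {i j} → i ≤ j → W i ≤ W j
  W-mono {i} {j} i≤j = size-mono (W-size i) (W-size j) (T-mono {i} {j} i≤j)

  W≥1 : ∀ j → 1 ≤ W j
  W≥1 j = ℕₚ.≤-trans (s≤s z≤n) (Finₚ.toℕ<n (proj₁ (proj₂ (proj₂ (proj₂ (W-size j))) (T-ε j))))

  -- Membership in `jX - jX`. The subtracted element is `a ⊟ x`, so a search runs over `a` only.
  Ball : ℕ → Carrier → Set
  Ball j x = ∃ λ a → T j a × T j (a ⊟ x)

  Ball-resp : ∀ j → Respects G (Ball j)
  Ball-resp j e (a , p , q) = a , p , T-resp j (∙-congˡ (⁻¹-cong e)) q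

  ball : ∀ j {x} a b → T j a → T j b → x ≈ a ⊟ b → Ball j x
  ball j {x} a b p q e = a , p , T-resp j
    (≈trans (ab-solve (a ∷ b ∷ []) v1 (v0 :- (v0 :- v1))) (∙-congˡ (⁻¹-cong (≈sym e)))) q

  balls : Balls G
  balls = record
    { B = Ball
    ; B-resp = Ball-resp
    ; B? = λ j x → search (λ e (p , q) → T-resp j e p , T-resp j (∙-congʳ e) q)
        (λ a → T? j a ×-dec T? j (a ⊟ x))
    ; B-ε = ε , ≈refl , inverseʳ ε
    ; B-⁻¹ = λ {j} {x} (a , p , q) → ball j (a ⊟ x) a q p
        (ab-solve (x ∷ a ∷ []) (:- v0) ((v1 :- v0) :- v1))
    ; B-∙ = λ {i} {j} {x} {y} (a , p , q) (b , r , s) → ball (i + j) (a ∙ b) ((a ⊟ x) ∙ (b ⊟ y))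
        (T-∙ i j p r) (T-∙ i j q s)
        (ab-solve (a ∷ b ∷ x ∷ y ∷ []) (v2 :+ v3) ((v0 :+ v1) :- ((v0 :- v2) :+ (v1 :- v3))))
    ; B-mono = λ {i} {j} i≤j (a , p , q) → a , T-mono {i} {j} i≤j p , T-mono {i} {j} i≤j q
    ; B-split = λ i j {x} (a , p , q) →
        let (a₁ , a₂ , p₁ , p₂ , e) = T-split i j p
            (b₁ , b₂ , q₁ , q₂ , e′) = T-split i j q
        in a₁ ⊟ b₁ , a₂ ⊟ b₂ , ball i a₁ b₁ p₁ q₁ ≈refl , ball j a₂ b₂ p₂ q₂ ≈refl ,
           ≈trans (ab-solve (a ∷ x ∷ []) v1 (v0 :- (v0 :- v1)))
             (≈trans (∙-cong e (⁻¹-cong e′))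
               (ab-solve (a₁ ∷ a₂ ∷ b₁ ∷ b₂ ∷ []) ((v0 :+ v1) :- (v2 :+ v3)) ((v0 :- v2) :+ (v1 :- v3)))) }

  T⇒Ball : ∀ j {x} → T j x → Ball j x
  T⇒Ball j {x} p = ball j x ε p (T-ε j) (ab-solve (x ∷ []) v0 (v0 :- :0))

  pair-count : ∀ n α β (h₁ h₂ : Fin n → Carrier) → (∀ i → T α (h₁ i)) → (∀ i → T β (h₂ i)) →
    (∀ i j → h₁ i ≈ h₁ j → h₂ i ≈ h₂ j → i ≡ j) → n ≤ W α * W β
  pair-count n α β h₁ h₂ p q inj =
    Finₚ.injective⇒≤ {f = λ i → combine (code (W-size α) (p i)) (code (W-size β) (q i))}
      λ {i} {j} e → let (e₁ , e₂) = Finₚ.combine-injective _ _ _ _ e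
        in inj i j (code-injective (W-size α) (p i) (p j) e₁) (code-injective (W-size β) (q i) (q j) e₂)

  -- Distinctness modulo Ball m makes the translates P i + T m disjoint, so that (a i + x + y , b i + y)
  -- determines i, x and y.
  separated-count : ∀ n α β m (P a b : Fin n → Carrier) → (∀ i → T α (a i)) → (∀ i → T β (b i)) →
    (∀ i → P i ≈ a i ⊟ b i) → (∀ i j → Ball m (P i ⊟ P j) → i ≡ j) →
    n * (W m * W m) ≤ W (α + m + m) * W (β + m)
  separated-count n α β m P a b a∈ b∈ P≈ sep = pair-count (n * (W m * W m)) (α + m + m) (β + m) h₁ h₂
    (λ i → T-∙ (α + m) m (T-∙ α m (a∈ (l i)) (τ∈ (x i))) (τ∈ (y i)))
    (λ i → T-∙ β m (b∈ (l i)) (τ∈ (y i)))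
    inj
    where
    τ : Fin (W m) → Carrier
    τ = proj₁ (W-size m)
    τ∈ = proj₁ (proj₂ (W-size m))
    τ-inj = proj₁ (proj₂ (proj₂ (W-size m)))
    l : Fin (n * (W m * W m)) → Fin n
    l i = proj₁ (remQuot {n} (W m * W m) i)
    xy : Fin (n * (W m * W m)) → Fin (W m * W m)
    xy i = proj₂ (remQuot {n} (W m * W m) i)
    x y : Fin (n * (W m * W m)) → Fin (W m)
    x i = proj₁ (remQuot {W m} (W m) (xy i))
    y i = proj₂ (remQuot {W m} (W m) (xy i))
    h₁ h₂ : Fin (n * (W m * W m)) → Carrier
    h₁ i = (a (l i) ∙ τ (x i)) ∙ τ (y i)
    h₂ i = b (l i) ∙ τ (y i)
    difference : ∀ i → P (l i) ∙ τ (x i) ≈ h₁ i ⊟ h₂ i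
    difference i = ≈trans (∙-congʳ (P≈ (l i))) (ab-solve (a (l i) ∷ b (l i) ∷ τ (x i) ∷ τ (y i) ∷ [])
      ((v0 :- v1) :+ v2) (((v0 :+ v2) :+ v3) :- (v1 :+ v3)))
    inj : ∀ i j → h₁ i ≈ h₁ j → h₂ i ≈ h₂ j → i ≡ j
    inj i j e₁ e₂ = remQuot-injective {n} (W m * W m) i j l≡ (remQuot-injective {W m} (W m) (xy i) (xy j) x≡ y≡)
      where
      same : P (l i) ∙ τ (x i) ≈ P (l j) ∙ τ (x j)
      same = ≈trans (difference i) (≈trans (∙-cong e₁ (⁻¹-cong e₂)) (≈sym (difference j)))
      l≡ : l i ≡ l j
      l≡ = sep (l i) (l j) (ball m (τ (x j)) (τ (x i)) (τ∈ (x j)) (τ∈ (x i))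
        (≈trans (ab-solve (P (l i) ∷ P (l j) ∷ τ (x i) ∷ []) (v0 :- v1) (((v0 :+ v2) :- v1) :- v2))
          (≈trans (∙-congʳ (∙-congʳ same))
            (ab-solve (P (l j) ∷ τ (x j) ∷ τ (x i) ∷ []) (((v0 :+ v1) :- v0) :- v2) (v1 :- v2)))))
      x≡ : x i ≡ x j
      x≡ = τ-inj (x i) (x j) (∙-cancelˡ (P (l i)) _ _ (≈trans same (∙-congʳ (reflexive (cong P (sym l≡))))))
      y≡ : y i ≡ y j
      y≡ = τ-inj (y i) (y j) (∙-cancelˡ (b (l i)) _ _ (≈trans e₂ (∙-congʳ (reflexive (cong b (sym l≡))))))

-- Coverings at the scale of small doubling, and their rescaling.

module Rescale {G : AbelianGroup 0ℓ 0ℓ} (balls : Balls G)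
    {n : ℕ} (F : Fin n → AbelianGroup.Carrier G) (m : ℕ) (F∈ : ∀ i → Balls.B balls (2 * m) (F i))
    (cov : BallProperties.Covers balls F m 1) (θ : ℕ) (θ≥1 : 1 ≤ θ) where
  open BallProperties balls
  open AbelianGroup G renaming (refl to ≈refl; sym to ≈sym; trans to ≈trans)
  open ℕₚ.≤-Reasoning

  private
    instance
      θ≢0 : NonZero θ
      θ≢0 = ℕ.>-nonZero θ≥1

  f : Fin n → Carrier
  f i = intMul G (+ θ) (F i)

  -- The factor `2 n + 1` makes room for a centre of radius `m` and for `n` remainder terms of
  -- radius `θ * (2 * m)`.
  c : ℕ
  c = θ * ((2 * n + 1) * m)

  f∈ : ∀ i → B c (f i)
  f∈ i = B-mono (ℕₚ.*-monoʳ-≤ θ (ℕₚ.*-monoˡ-≤ m (ℕₚ.≤-trans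
    (ℕₚ.*-monoʳ-≤ 2 (ℕₚ.≤-trans (s≤s z≤n) (Finₚ.toℕ<n i))) (ℕₚ.m≤m+n (2 * n) 1)))) (B-intMul (+ θ) (F∈ i))

  quotient-bound : ∀ z → ∣ z ∣ ≤ θ * (4 * n + 2) → ∣ z ZDM./ℕ θ ∣ ≤ 4 * n + 2
  quotient-bound z z≤ = ℕₚ.≤-pred (ℕₚ.*-cancelʳ-< θ _ _ (begin-strict
    ∣ z ZDM./ℕ θ ∣ * θ                 ≡⟨ ℤₚ.∣i*j∣≡∣i∣*∣j∣ (z ZDM./ℕ θ) (+ θ) ⟨
    ∣ z ZDM./ℕ θ ℤ.* + θ ∣             ≡⟨ cong ∣_∣ (lemma (+ (z ZDM.%ℕ θ)) (z ZDM./ℕ θ ℤ.* + θ)) ⟩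
    ∣ (+ (z ZDM.%ℕ θ) ℤ.+ z ZDM./ℕ θ ℤ.* + θ) ℤ.- + (z ZDM.%ℕ θ) ∣
      ≡⟨ cong (λ s → ∣ s ℤ.- + (z ZDM.%ℕ θ) ∣) (ZDM.a≡a%ℕn+[a/ℕn]*n z θ) ⟨
    ∣ z ℤ.- + (z ZDM.%ℕ θ) ∣           ≤⟨ ℤₚ.∣i-j∣≤∣i∣+∣j∣ z (+ (z ZDM.%ℕ θ)) ⟩
    ∣ z ∣ + z ZDM.%ℕ θ                 <⟨ ℕₚ.+-mono-≤-< z≤ (ZDM.n%ℕd<d z θ) ⟩
    θ * (4 * n + 2) + θ                ≡⟨ lemma′ θ (4 * n + 2) ⟩
    (1 + (4 * n + 2)) * θ              ∎))
    where
    lemma : ∀ r s → s ≡ (r ℤ.+ s) ℤ.- r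
    lemma = ℤ-Solver.solve-∀
    lemma′ : ∀ t a → t * a + t ≡ (1 + a) * t
    lemma′ = ℕ-Solver.solve-∀

  -- Each coefficient over `F` is divided by `θ`. The remainders form a combination that the ball
  -- absorbs; the quotients become coefficients over `f`, bounded independently of `θ`.
  covers-f : Covers f c (4 * n + 2)
  covers-f x x∈ = y ∙ lin F ρ , q ,
    B-mono radius (B-∙ y∈ (B-lin {b = θ} {f = F} {v = ρ} F∈ (λ i → ℕₚ.<⇒≤ (ZDM.n%ℕd<d (v i) θ)))) ,
    (λ i → quotient-bound (v i) (ℕₚ.≤-trans (v≤ i) (ℕₚ.≤-reflexive (ℕₚ.*-identityʳ _)))) ,
    ≈trans e (≈trans (∙-congˡ split) (≈sym (assoc _ _ _)))
    where
    multiple : ∀ x → B (2 * c) x →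
      ∃ λ y → ∃ λ v → B m y × Bounded (θ * (4 * n + 2) * 1) v × x ≈ y ∙ lin F v
    multiple x x∈ = covers-multiple {f = F} cov (θ * (4 * n + 2)) x
      (B-mono (ℕₚ.≤-trans (ℕₚ.≤-reflexive (lemma θ n m)) (ℕₚ.m≤n+m _ m)) x∈)
      where
      lemma : ∀ t n m → 2 * (t * ((2 * n + 1) * m)) ≡ t * (4 * n + 2) * m
      lemma = ℕ-Solver.solve-∀
    y = proj₁ (multiple x x∈)
    v = proj₁ (proj₂ (multiple x x∈))
    y∈ = proj₁ (proj₂ (proj₂ (multiple x x∈)))
    v≤ = proj₁ (proj₂ (proj₂ (proj₂ (multiple x x∈))))
    e = proj₂ (proj₂ (proj₂ (proj₂ (multiple x x∈))))
    ρ q : Fin n → ℤ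
    ρ i = + (v i ZDM.%ℕ θ)
    q i = v i ZDM./ℕ θ
    radius : m + n * (θ * (2 * m)) ≤ c
    radius = begin
      m + n * (θ * (2 * m))        ≤⟨ ℕₚ.+-monoˡ-≤ _ (ℕₚ.m≤n*m m θ) ⟩
      θ * m + n * (θ * (2 * m))    ≡⟨ lemma θ n m ⟩
      θ * ((2 * n + 1) * m)        ∎
      where
      lemma : ∀ t n m → t * m + n * (t * (2 * m)) ≡ t * ((2 * n + 1) * m)
      lemma = ℕ-Solver.solve-∀
    split : lin F v ≈ lin F ρ ∙ lin f q
    split = ≈trans (lin-cong F (λ i → trans (ZDM.a≡a%ℕn+[a/ℕn]*n (v i) θ)
        (cong (λ s → ρ i ℤ.+ s) (ℤₚ.*-comm (q i) (+ θ)))))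
      (≈trans (lin-+ F ρ (λ i → + θ ℤ.* q i)) (∙-congˡ (≈sym (lin-scaleᵍ (+ θ) F q))))

shifted : ∀ j z → ∣ z ∣ ≤ j → ∃ λ a → + j ℤ.+ z ≡ + a × a ≤ 2 * j
shifted j (+ n)    p = j + n , refl , ℕₚ.≤-trans (ℕₚ.+-monoʳ-≤ j p)
  (ℕₚ.≤-reflexive (cong (λ s → j + s) (sym (ℕₚ.+-identityʳ j))))
shifted j -[1+ n ] p = j ∸ suc n , ℤₚ.⊖-≥ p , ℕₚ.≤-trans (ℕₚ.m∸n≤m j (suc n)) (ℕₚ.m≤m+n j _)

module Covering (G : AbelianGroup 0ℓ 0ℓ) (fin : IsFinite G) (X : Subset G) (X-resp : Respects G X)
    (0∈X : X (AbelianGroup.ε G)) (X? : ∀ x → Dec (X x)) (m : ℕ) where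
  open AbelianGroup G renaming (refl to ≈refl; sym to ≈sym; trans to ≈trans)
  open Linear G
  open Finite G fin
  open AGP G using (∙-cancelˡ)
  open Sumsets G fin X X-resp 0∈X X?
  open Balls balls using (B; B-resp; B?; B-ε; B-⁻¹; B-mono)

  private
    Close : Carrier → Carrier → Set
    Close x y = B m (x ⊟ y)

  abstract
    ball-size : ∃ (HasSize G (B (2 * m)))
    ball-size = hasSize (B-resp (2 * m)) (B? (2 * m))

    ball-net : Net Close (proj₁ (proj₂ ball-size))
    ball-net = net (λ x y → B? m (x ⊟ y))
      (λ x → B-resp m (≈sym (inverseʳ x)) (B-mono {0} {m} z≤n B-ε))
      (λ {x} {y} h → B-resp m (ab-solve (x ∷ y ∷ []) (:- (v0 :- v1)) (v1 :- v0)) (B-⁻¹ {m} {x ⊟ y} h))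
      (proj₁ (proj₂ ball-size))

  n : ℕ
  n = proj₁ ball-net

  F : Fin n → Carrier
  F i = proj₁ (proj₂ ball-size) (proj₁ (proj₂ ball-net) i)

  F∈ : ∀ i → B (2 * m) (F i)
  F∈ i = proj₁ (proj₂ (proj₂ ball-size)) (proj₁ (proj₂ ball-net) i)

  F-covers : BallProperties.Covers balls F m 1
  F-covers x x∈ = x ⊟ F i , δ i , B-resp m (∙-congʳ (≈sym x≈)) (proj₂ cl) , δ≤ i ,
    ≈trans (ab-solve (x ∷ F i ∷ []) v0 ((v0 :- v1) :+ v1)) (∙-congˡ (≈sym (lin-δ F i)))
    where
    at = proj₂ (proj₂ (proj₂ (proj₂ ball-size))) x∈
    x≈ = proj₂ at
    cl = proj₂ (proj₂ (proj₂ ball-net)) (proj₁ at)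
    i  = proj₁ cl
    δ≤ : ∀ {n} (i : Fin n) → Bounded 1 (δ i)
    δ≤ zero    zero    = ℕₚ.≤-refl
    δ≤ zero    (suc j) = z≤n
    δ≤ (suc i) zero    = z≤n
    δ≤ (suc i) (suc j) = δ≤ i j

  a b : Fin n → Carrier
  a i = proj₁ (F∈ i)
  b i = a i ⊟ F i

  a∈ : ∀ i → T (2 * m) (a i)
  a∈ i = proj₁ (proj₂ (F∈ i))

  b∈ : ∀ i → T (2 * m) (b i)
  b∈ i = proj₂ (proj₂ (F∈ i))

  F≈ : ∀ i → F i ≈ a i ⊟ b i
  F≈ i = ab-solve (F i ∷ a i ∷ []) v0 (v1 :- (v1 :- v0))

  -- The squares come from keeping track of both ends of a difference. They turn the doubling
  -- constant `4 ^ d` into the bound `16 ^ d` for the number of generators.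
  F-count : n * (W m * W m) ≤ W (4 * m) * W (4 * m)
  F-count = ℕₚ.≤-trans
    (separated-count n (2 * m) (2 * m) m F a b a∈ b∈ F≈ (proj₁ (proj₂ (proj₂ ball-net))))
    (ℕₚ.*-mono-≤ (W-mono (ℕₚ.≤-reflexive (lemma m)))
      (W-mono (ℕₚ.≤-trans (ℕₚ.m≤m+n (2 * m + m) m) (ℕₚ.≤-reflexive (lemma m)))))
    where
    lemma : ∀ m → 2 * m + m + m ≡ 4 * m
    lemma = ℕ-Solver.solve-∀

  -- Σ v i F i = Σ (j + v i) a i + Σ (j - v i) b i - Σ j (a i + b i): up to a fixed translate, combinations
  -- of F are sums of elements of X, so no bound on |X - X| is needed.
  R-count : ∀ j ν (R : Fin ν → Carrier) → (∀ i → B (suc j * m) (R i)) →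
    (∀ i l → R i ≈ R l → i ≡ l) →
    ν * W m ≤ W (m + n * (2 * j * (2 * m) + 2 * j * (2 * m)) + m) * W (m + m)
  R-count j ν R R∈ R-inj = pair-count (ν * W m) (α + m) (m + m) h₁ h₂
    (λ i → T-∙ α m (s∈ (l i)) (τ∈ (x i))) (λ i → T-∙ m m (p′∈ (l i)) (τ∈ (x i))) inj
    where
    -- A term contains at most `2 j` copies each of `a q` and `b q`, all of them in `T (2 * m)`.
    N = 2 * j * (2 * m) + 2 * j * (2 * m)
    α = m + n * N
    C = BallProperties.covers-multiple balls {f = F} {c = m} F-covers j
    p p′ s : Fin ν → Carrier
    v : Fin ν → Fin n → ℤ
    yB : ∀ i → B m (proj₁ (C (R i) (R∈ i)))
    yB i = proj₁ (proj₂ (proj₂ (C (R i) (R∈ i))))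
    v i = proj₁ (proj₂ (C (R i) (R∈ i)))
    p i = proj₁ (yB i)
    p′ i = p i ⊟ proj₁ (C (R i) (R∈ i))
    v≤ : ∀ i → Bounded j (v i)
    v≤ i q = ℕₚ.≤-trans (proj₁ (proj₂ (proj₂ (proj₂ (C (R i) (R∈ i))))) q) (ℕₚ.≤-reflexive (ℕₚ.*-identityʳ j))
    R≈ : ∀ i → R i ≈ (p i ⊟ p′ i) ∙ lin F (v i)
    R≈ i = ≈trans (proj₂ (proj₂ (proj₂ (proj₂ (C (R i) (R∈ i)))))) (∙-congʳ
      (ab-solve (p i ∷ proj₁ (C (R i) (R∈ i)) ∷ []) v1 (v0 :- (v0 :- v1))))
    p′∈ : ∀ i → T m (p′ i)
    p′∈ i = proj₂ (proj₂ (yB i))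
    term : Fin ν → Fin n → Carrier
    term i q = intMul G (+ j ℤ.+ v i q) (a q) ∙ intMul G (+ j ℤ.+ ℤ.- v i q) (b q)
    base : Fin n → Carrier
    base q = intMul G (+ j) (a q) ∙ intMul G (+ j) (b q)
    positive : ∀ z g → ∣ z ∣ ≤ j → T (2 * m) g → T (2 * j * (2 * m)) (intMul G (+ j ℤ.+ z) g)
    positive z g z≤ g∈ =
      let (e , eq , e≤) = shifted j z z≤
      in T-resp (2 * j * (2 * m)) (reflexive (cong (λ t → intMul G t g) (sym eq)))
        (T-mono {e * (2 * m)} {2 * j * (2 * m)} (ℕₚ.*-monoˡ-≤ (2 * m) e≤) (T-natMul e (2 * m) g∈))
    term∈ : ∀ i q → T N (term i q)
    term∈ i q = T-∙ (2 * j * (2 * m)) (2 * j * (2 * m)) (positive (v i q) (a q) (v≤ i q) (a∈ q))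
      (positive (ℤ.- v i q) (b q) (ℕₚ.≤-trans (ℕₚ.≤-reflexive (ℤₚ.∣-i∣≡∣i∣ (v i q))) (v≤ i q)) (b∈ q))
    s i = p i ∙ sumFin G (term i)
    s∈ : ∀ i → T α (s i)
    s∈ i = T-∙ m (n * N) (proj₁ (proj₂ (yB i))) (T-sum N (term i) (term∈ i))
    term≈ : ∀ i → sumFin G (term i) ≈ lin F (v i) ∙ sumFin G base
    term≈ i = ≈trans (sum-cong each) (sum-∙ (λ q → intMul G (v i q) (F q)) base)
      where
      each : ∀ q → term i q ≈ intMul G (v i q) (F q) ∙ base q
      each q = ≈trans (∙-cong (intMul-+ (+ j) (v i q) (a q))
          (≈trans (intMul-+ (+ j) (ℤ.- v i q) (b q)) (∙-congˡ (intMul-neg (v i q) (b q)))))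
        (≈trans (ab-solve (intMul G (+ j) (a q) ∷ intMul G (v i q) (a q) ∷ intMul G (+ j) (b q)
                           ∷ intMul G (v i q) (b q) ∷ [])
          ((v0 :+ v1) :+ (v2 :- v3)) ((v1 :- v3) :+ (v0 :+ v2)))
        (∙-congʳ (≈sym (≈trans (intMul-cong (v i q) (F≈ q)) (≈trans (intMul-∙ (v i q) (a q) (b q ⁻¹))
          (∙-congˡ (intMul-⁻¹ (v i q) (b q))))))))
    τ : Fin (W m) → Carrier
    τ = proj₁ (W-size m)
    τ∈ = proj₁ (proj₂ (W-size m))
    τ-inj = proj₁ (proj₂ (proj₂ (W-size m)))
    l : Fin (ν * W m) → Fin ν
    l i = proj₁ (remQuot {ν} (W m) i)
    x : Fin (ν * W m) → Fin (W m)
    x i = proj₂ (remQuot {ν} (W m) i)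
    -- The common translate by `τ` cancels in the difference. It supplies the factor `W m` on the
    -- left, against which doubling measures `W (m + m)`.
    h₁ h₂ : Fin (ν * W m) → Carrier
    h₁ i = s (l i) ∙ τ (x i)
    h₂ i = p′ (l i) ∙ τ (x i)
    difference : ∀ i → R (l i) ∙ sumFin G base ≈ h₁ i ⊟ h₂ i
    difference i = ≈trans (∙-congʳ (R≈ (l i))) (≈trans
      (ab-solve (p (l i) ∷ p′ (l i) ∷ lin F (v (l i)) ∷ sumFin G base ∷ τ (x i) ∷ [])
        (((v0 :- v1) :+ v2) :+ v3) (((v0 :+ (v2 :+ v3)) :+ v4) :- (v1 :+ v4)))
      (∙-congʳ (∙-congʳ (∙-congˡ (≈sym (term≈ (l i)))))))
    inj : ∀ i j → h₁ i ≈ h₁ j → h₂ i ≈ h₂ j → i ≡ j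
    inj i j e₁ e₂ = remQuot-injective {ν} (W m) i j l≡
      (τ-inj (x i) (x j) (∙-cancelˡ (p′ (l i)) _ _ (≈trans e₂ (∙-congʳ (reflexive (cong p′ (sym l≡)))))))
      where
      base′ = sumFin G base
      l≡ : l i ≡ l j
      l≡ = R-inj (l i) (l j) (∙-cancelˡ base′ _ _ (≈trans (comm base′ (R (l i)))
        (≈trans (difference i) (≈trans (∙-cong e₁ (⁻¹-cong e₂))
          (≈trans (≈sym (difference j)) (comm (R (l j)) base′))))))

-- The coset-progression: properness, size and containment.

module Progression {G : AbelianGroup 0ℓ 0ℓ} (fin : IsFinite G) (balls : Balls G) (n E K c₀ : ℕ)
    (n≥1 : 1 ≤ n) (E≥ : 68 * (n * (8 * n) ^ n) ≤ E) (E≥51 : 51 ≤ E) (K≥ : 2 * (E + 9) ≤ K)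
    (I : BallProperties.Independent balls K c₀) (D≤n : BallProperties.Independent.D I ≤ n)
    (c≥1 : 1 ≤ BallProperties.Independent.c I) where
  open AbelianGroup G renaming (refl to ≈refl; sym to ≈sym; trans to ≈trans)
  open Finite G fin
  open BallProperties balls
  open LocalCover fin balls E K c₀ E≥51 K≥ I

  private
    instance
      c≢0 : NonZero c
      c≢0 = ℕ.>-nonZero c≥1
      8n≢0 : NonZero (8 * n)
      8n≢0 = ℕ.>-nonZero (ℕₚ.≤-trans (s≤s z≤n) (ℕₚ.*-monoʳ-≤ 8 n≥1))

    Λ : (Fin D → ℤ) → Set
    Λ p = ∃ λ g → L g p

    Λ-sub : IsSubgroup (ℤ^ D) Λ
    Λ-sub = (λ e (g , h) → g , L-resp ≈refl e h) , (ε , L-ε) ,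
      (λ (g , h) (g′ , h′) → g ∙ g′ , L-∙ h h′) , λ (g , h) → g ⁻¹ , L-⁻¹ h

    -- The bound that `lift-unit` gives for the coordinates of points of `B 1`.
    ρ = (ν * (17 * u)) / c

    abstract
      reduced : Reduced Λ ρ ((8 * n) ^ D * ρ)
      reduced = reduceLattice n D D≤n Λ Λ-sub
        (λ p → search (λ e → L-resp e (λ _ → refl)) (λ g → L? g p)) ρ

  open Reduced reduced public using (r; N; N≥1)
  open Reduced reduced using (p; p∈; r≤D; short; cover) renaming (indep to p-indep)

  r≤n : r ≤ n
  r≤n = ℕₚ.≤-trans r≤D D≤n

  g : Fin r → Carrier
  g i = proj₁ (p∈ i)

  -- The range is about `c` times that of the progression: wide enough for counting a dilate of `Q`
  -- with its gaps filled, yet narrow enough for coordinates to remain unique.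
  Admissible : (Fin r → ℤ) → Set
  Admissible z = ∀ i → ∣ z i ∣ ≤ 2 * (c * N i)

  private
    S = n * (2 * ((8 * n) ^ n * (ν * (17 * u))))

    cρ≤ : c * ρ ≤ ν * (17 * u)
    cρ≤ = ℕₚ.≤-trans (ℕₚ.≤-reflexive (ℕₚ.*-comm c ρ)) (DM.m/n*n≤m (ν * (17 * u)) c)

    module _ where
      open ℕₚ.≤-Reasoning

      comb≤ : ∀ z → Admissible z → Bounded S (comb p z)
      comb≤ z z≤ m = begin
        ∣ comb p z m ∣                  ≤⟨ ∣comb∣≤ (2 * ((8 * n) ^ n * (ν * (17 * u)))) p z each m ⟩
        r * (2 * ((8 * n) ^ n * (ν * (17 * u))))   ≤⟨ ℕₚ.*-monoˡ-≤ _ r≤n ⟩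
        S                               ∎
        where
        lemma : ∀ c N P → 2 * (c * N) * P ≡ 2 * (c * (N * P))
        lemma = ℕ-Solver.solve-∀
        lemma′ : ∀ c C ρ → 2 * (c * (C * ρ)) ≡ 2 * (C * (c * ρ))
        lemma′ = ℕ-Solver.solve-∀
        each : ∀ l i → ∣ z l ∣ * ∣ p l i ∣ ≤ 2 * ((8 * n) ^ n * (ν * (17 * u)))
        each l i = begin
          ∣ z l ∣ * ∣ p l i ∣              ≤⟨ ℕₚ.*-monoˡ-≤ ∣ p l i ∣ (z≤ l) ⟩
          2 * (c * N l) * ∣ p l i ∣        ≡⟨ lemma c (N l) ∣ p l i ∣ ⟩
          2 * (c * (N l * ∣ p l i ∣))      ≤⟨ ℕₚ.*-monoʳ-≤ 2 (ℕₚ.*-monoʳ-≤ c (short l i)) ⟩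
          2 * (c * ((8 * n) ^ D * ρ))      ≡⟨ lemma′ c ((8 * n) ^ D) ρ ⟩
          2 * ((8 * n) ^ D * (c * ρ))      ≤⟨ ℕₚ.*-monoʳ-≤ 2 (ℕₚ.*-mono-≤ (ℕₚ.^-monoʳ-≤ (8 * n) D≤n) cρ≤) ⟩
          2 * ((8 * n) ^ n * (ν * (17 * u)))   ∎

      -- Origin of the constant in the bound on `E`: `68 = 2 * 2 * 17`, for the two points compared,
      -- the factor in `Admissible`, and the bound behind `ρ`.
      S+S≤ : S + S ≤ ν * (E * u)
      S+S≤ = begin
        S + S                                      ≡⟨ lemma n ((8 * n) ^ n) ν u ⟩
        ν * (68 * (n * (8 * n) ^ n) * u)           ≤⟨ ℕₚ.*-monoʳ-≤ ν (ℕₚ.*-monoˡ-≤ u E≥) ⟩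
        ν * (E * u)                                ∎
        where
        lemma : ∀ n C ν u → n * (2 * (C * (ν * (17 * u)))) + n * (2 * (C * (ν * (17 * u)))) ≡ ν * (68 * (n * C) * u)
        lemma = ℕ-Solver.solve-∀

    L-point : ∀ {h} z → L h (λ _ → + 0) → L (h ∙ lin g z) (comb p z)
    L-point z h∈ = L-resp ≈refl (λ m → ℤₚ.+-identityˡ (comb p z m)) (L-∙ h∈ (L-lin g p z (λ i → proj₂ (p∈ i))))

  -- Since `h` and `h′` have coordinate zero, `comb p z` and `comb p z′` are coordinates of the same
  -- element. They differ by at most `2 S`, hence agree, and independence of `p` recovers `z`.
  -- Properness and the count both rest on this.
  unique-point : ∀ {h h′} z z′ → Admissible z → Admissible z′ → L h (λ _ → + 0) → L h′ (λ _ → + 0) →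
                 h ∙ lin g z ≈ h′ ∙ lin g z′ → h ≈ h′ × z ≗ z′
  unique-point {h} {h′} z z′ z≤ z′≤ h∈ h′∈ e = h≈ , z≗
    where
    module Z = Linear (ℤ^ D)
    combs : comb p z ≗ comb p z′
    combs = agree (L-point z h∈) (L-resp (≈sym e) (λ _ → refl) (L-point z′ h′∈))
      λ m → ℕₚ.≤-trans (ℤₚ.∣i-j∣≤∣i∣+∣j∣ (comb p z m) (comb p z′ m))
        (ℕₚ.≤-trans (ℕₚ.+-mono-≤ (comb≤ z z≤ m) (comb≤ z′ z′≤ m)) S+S≤)
    z≗ : z ≗ z′
    z≗ i = ℤₚ.i-j≡0⇒i≡j (z i) (z′ i) (p-indep (λ i → z i ℤ.- z′ i)
      (λ l → trans (Z.lin-sub p z z′ l) (ℤₚ.i≡j⇒i-j≡0 (combs l))) i)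
    h≈ : h ≈ h′
    h≈ = ≈trans (ab-solve (h ∷ lin g z ∷ []) v0 ((v0 :+ v1) :- v1))
      (≈trans (∙-cong e (⁻¹-cong (lin-cong g z≗))) (ab-solve (h′ ∷ lin g z′ ∷ []) ((v0 :+ v1) :- v1) v0))

  progression : CosetProgression G
  progression = record
    { H = λ h → L h (λ _ → + 0)
    ; H-sub = (λ e → L-resp e (λ _ → refl)) , L-ε , (λ a b → L-∙ a b) , λ a → L-⁻¹ a
    ; rank = r ; gens = g ; bounds = N }

  N-admissible : ∀ z → (∀ i → ∣ z i ∣ ≤ N i) → Admissible z
  N-admissible z z≤ i = ℕₚ.≤-trans (z≤ i) (ℕₚ.≤-trans (ℕₚ.m≤n*m (N i) c) (ℕₚ.m≤n*m (c * N i) 2))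

  abstract
    H-size : ∃ (HasSize G (H progression))
    H-size = hasSize (λ e → L-resp e (λ _ → refl)) (λ x → L? x (λ _ → + 0))

    Q-size : ∃ (HasSize G (Q progression))
    Q-size = hasSize (λ e (m , m≤ , e′) → m , m≤ , ≈trans e′ e) λ x → map′
      (λ (m , _ , m≤ , e) → m , m≤ , e)
      (λ (m , m≤ , e) → m , (λ i → ℕₚ.≤-trans (m≤ i) (entry≤norm₁ (λ i → + N i) i)) , m≤ , e)
      (searchBox r (norm₁ (λ i → + N i))
        (λ e (m≤ , e′) → (λ i → subst (λ z → ∣ z ∣ ≤ N i) (e i) (m≤ i)) , ≈trans (≈sym (lin-cong g e)) e′)
        (λ m → Finₚ.all? (λ i → ∣ m i ∣ ℕ.≤? N i) ×-dec (lin g m ≈? x)))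

  h q : ℕ
  h = proj₁ H-size
  q = proj₁ Q-size

  private
    Hel : Fin h → Carrier
    Hel = proj₁ (proj₂ H-size)
    Hel∈ = proj₁ (proj₂ (proj₂ H-size))
    Hel-inj = proj₁ (proj₂ (proj₂ (proj₂ H-size)))
    Qel : Fin q → Carrier
    Qel = proj₁ (proj₂ Q-size)
    Qel∈ = proj₁ (proj₂ (proj₂ Q-size))
    Qel-inj = proj₁ (proj₂ (proj₂ (proj₂ Q-size)))
    coord : Fin q → Fin r → ℤ
    coord i = proj₁ (Qel∈ i)
    coord≤ : ∀ i l → ∣ coord i l ∣ ≤ N l
    coord≤ i = proj₁ (proj₂ (Qel∈ i))
    coord-eq : ∀ i → lin g (coord i) ≈ Qel i
    coord-eq i = proj₂ (proj₂ (Qel∈ i))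

    coord-inj : ∀ i j → coord i ≗ coord j → i ≡ j
    coord-inj i j e = Qel-inj i j (≈trans (≈sym (coord-eq i)) (≈trans (lin-cong g e) (coord-eq j)))

  set-size : HasSize G (set progression) (h * q)
  set-size = el , (λ i → Hel (a i) , Qel (b i) , Hel∈ (a i) , Qel∈ (b i) , ≈refl) , inj ,
    λ (x , y , x∈ , y∈ , e) →
      let (i , x≈) = proj₂ (proj₂ (proj₂ (proj₂ H-size))) x∈
          (j , y≈) = proj₂ (proj₂ (proj₂ (proj₂ Q-size))) y∈
      in combine i j , ≈trans (≈sym e) (≈trans (∙-cong x≈ y≈) (reflexive
           (cong (λ t → Hel (proj₁ t) ∙ Qel (proj₂ t)) (sym (Finₚ.remQuot-combine i j)))))
    where
    a : Fin (h * q) → Fin h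
    a i = proj₁ (remQuot {h} q i)
    b : Fin (h * q) → Fin q
    b i = proj₂ (remQuot {h} q i)
    el : Fin (h * q) → Carrier
    el i = Hel (a i) ∙ Qel (b i)
    inj : ∀ i j → el i ≈ el j → i ≡ j
    inj i j e =
      let (h≈ , z≗) = unique-point (coord (b i)) (coord (b j)) (N-admissible (coord (b i)) (coord≤ (b i)))
            (N-admissible (coord (b j)) (coord≤ (b j))) (Hel∈ (a i)) (Hel∈ (a j))
            (≈trans (∙-congˡ (coord-eq (b i))) (≈trans e (∙-congˡ (≈sym (coord-eq (b j))))))
      in remQuot-injective {h} q i j (Hel-inj (a i) (a j) h≈) (coord-inj (b i) (b j) z≗)

  proper : IsProper G progression
  proper = (λ m m′ m≤ m′≤ e → proj₂ (unique-point m m′ (N-admissible m m≤) (N-admissible m′ m′≤) L-ε L-ε (∙-congˡ e)))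
    , h , q , proj₂ H-size , proj₂ Q-size , set-size

  -- The points x + Σ (c n i + e i) g i with x ∈ H, Σ n i g i ∈ Q and 0 ≤ e i < c are distinct and have
  -- coordinates of order ν, so they inject into pairs of an element of R and a bounded vector.
  count : h * (q * c ^ r) ≤ ν * suc ((E + 9) * u + (E + 9) * u) ^ D
  count = Finₚ.injective⇒≤ {f = to} λ {i} {j} → inj i j
    where
    a : Fin (h * (q * c ^ r)) → Fin h
    a i = proj₁ (remQuot {h} (q * c ^ r) i)
    rest : Fin (h * (q * c ^ r)) → Fin (q * c ^ r)
    rest i = proj₂ (remQuot {h} (q * c ^ r) i)
    b : Fin (h * (q * c ^ r)) → Fin q
    b i = proj₁ (remQuot {q} (c ^ r) (rest i))
    e : Fin (h * (q * c ^ r)) → Fin r → Fin c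
    code-e : Fin (h * (q * c ^ r)) → Fin (c ^ r)
    code-e i = proj₂ (remQuot {q} (c ^ r) (rest i))
    e i = finToFun {c} {r} (code-e i)
    z : Fin (h * (q * c ^ r)) → Fin r → ℤ
    z i l = + c ℤ.* coord (b i) l ℤ.+ + toℕ (e i l)
    -- A digit is less than `c`, hence at most `c * N l` because `N l ≥ 1`.
    z≤ : ∀ i → Admissible (z i)
    z≤ i l = begin
      ∣ z i l ∣                                  ≤⟨ ℤₚ.∣i+j∣≤∣i∣+∣j∣ (+ c ℤ.* coord (b i) l) _ ⟩
      ∣ + c ℤ.* coord (b i) l ∣ + toℕ (e i l)    ≡⟨ cong (_+ toℕ (e i l)) (ℤₚ.∣i*j∣≡∣i∣*∣j∣ (+ c) (coord (b i) l)) ⟩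
      c * ∣ coord (b i) l ∣ + toℕ (e i l)        ≤⟨ ℕₚ.+-mono-≤ (ℕₚ.*-monoʳ-≤ c (coord≤ (b i) l))
        (ℕₚ.≤-trans (ℕₚ.<⇒≤ (Finₚ.toℕ<n (e i l))) (ℕₚ.m≤m*n c (N l) {{ℕ.>-nonZero (N≥1 l)}})) ⟩
      c * N l + c * N l                          ≡⟨ cong (λ s → c * N l + s) (ℕₚ.+-identityʳ (c * N l)) ⟨
      2 * (c * N l)                              ∎
      where open ℕₚ.≤-Reasoning
    point : Fin (h * (q * c ^ r)) → Carrier
    point i = Hel (a i) ∙ lin g (z i)
    point∈ : ∀ i → L (point i) (comb p (z i))
    point∈ i = L-point (z i) (Hel∈ (a i))
    v : Fin (h * (q * c ^ r)) → Fin D → ℤ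
    v i = proj₁ (proj₂ (point∈ i))
    bound : ∀ i → Bounded ((E + 9) * u) (v i)
    bound i = small (λ m → ℕₚ.≤-trans (comb≤ (z i) (z≤ i) m) (ℕₚ.≤-trans (ℕₚ.m≤m+n S S) S+S≤)) (point∈ i)
    to : Fin (h * (q * c ^ r)) → Fin (ν * suc ((E + 9) * u + (E + 9) * u) ^ D)
    to i = combine (proj₁ (point∈ i)) (boxCode ((E + 9) * u) (v i) (bound i))
    digits : ∀ i j → z i ≗ z j → coord (b i) ≗ coord (b j) × (∀ l → e i l ≡ e j l)
    digits i j eq = (λ l → proj₁ (euclid l)) , λ l → Finₚ.toℕ-injective (proj₂ (euclid l))
      where
      euclid : ∀ l → coord (b i) l ≡ coord (b j) l × toℕ (e i l) ≡ toℕ (e j l)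
      euclid l = divMod-unique c (coord (b i) l) (coord (b j) l) (toℕ (e i l)) (toℕ (e j l))
        (Finₚ.toℕ<n (e i l)) (Finₚ.toℕ<n (e j l)) (eq l)
        where
        divMod-unique : ∀ c x y s t → s < c → t < c → + c ℤ.* x ℤ.+ + s ≡ + c ℤ.* y ℤ.+ + t → x ≡ y × s ≡ t
        divMod-unique c x y s t s< t< eq = x≡y , s≡t
          where
          lemma : ∀ c x y s t → c ℤ.* (x ℤ.- y) ≡ (c ℤ.* x ℤ.+ s) ℤ.- (c ℤ.* y ℤ.+ t) ℤ.+ (t ℤ.- s)
          lemma = ℤ-Solver.solve-∀
          diff : + c ℤ.* (x ℤ.- y) ≡ + t ℤ.- + s
          diff = trans (lemma (+ c) x y (+ s) (+ t))
            (trans (cong (λ w → w ℤ.+ (+ t ℤ.- + s)) (ℤₚ.i≡j⇒i-j≡0 eq)) (ℤₚ.+-identityˡ _))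
          ∣t-s∣< : ∣ + t ℤ.- + s ∣ < c
          ∣t-s∣< = subst (_< c) (cong ∣_∣ (sym (ℤₚ.m-n≡m⊖n t s)))
            (ℕₚ.≤-<-trans (ℤₚ.∣m⊝n∣≤m⊔n t s) (ℕₚ.⊔-lub t< s<))
          x≡y : x ≡ y
          x≡y = ℤₚ.i-j≡0⇒i≡j x y (ℤₚ.∣i∣≡0⇒i≡0 (ℕₚ.n<1⇒n≡0 (ℕₚ.*-cancelˡ-< c _ _ (ℕₚ.≤-<-trans
            (ℕₚ.≤-reflexive (trans (sym (ℤₚ.∣i*j∣≡∣i∣*∣j∣ (+ c) (x ℤ.- y))) (cong ∣_∣ diff)))
            (ℕₚ.<-≤-trans ∣t-s∣< (ℕₚ.≤-reflexive (sym (ℕₚ.*-identityʳ c))))))))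
          s≡t : s ≡ t
          s≡t = ℤₚ.+-injective (sym (ℤₚ.i-j≡0⇒i≡j (+ t) (+ s) (trans (sym diff)
            (trans (cong (λ w → + c ℤ.* w) (ℤₚ.i≡j⇒i-j≡0 x≡y)) (ℤₚ.*-zeroʳ (+ c))))))
    inj : ∀ i j → to i ≡ to j → i ≡ j
    inj i j eq =
      let (l≡ , k≡) = Finₚ.combine-injective (proj₁ (point∈ i)) _ (proj₁ (point∈ j)) _ eq
          v≗ = boxCode-injective ((E + 9) * u) (v i) (v j) (bound i) (bound j) k≡
          same = ≈trans (proj₁ (proj₂ (proj₂ (point∈ i)))) (≈trans
            (∙-cong (reflexive (cong R l≡)) (lin-cong f v≗)) (≈sym (proj₁ (proj₂ (proj₂ (point∈ j))))))
          (h≈ , z≗) = unique-point (z i) (z j) (z≤ i) (z≤ j) (Hel∈ (a i)) (Hel∈ (a j)) same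
          (n≗ , e≗) = digits i j z≗
      in remQuot-injective {h} (q * c ^ r) i j (Hel-inj (a i) (a j) h≈)
           (remQuot-injective {q} (c ^ r) (rest i) (rest j) (coord-inj (b i) (b j) n≗)
             (finToFun-injective {r} {c} (code-e i) (code-e j) e≗))

  -- The coordinate `t` of `x` is a lattice point in the box of radius `ρ`, so it is `comb p m` with
  -- `m` within the bounds `N`. Subtracting `lin g m` from `x` leaves coordinate zero, an element of
  -- `H`.
  contains : ∀ {x} → B 1 x → set progression x
  contains {x} x∈ = from-lift (lift-unit c≥1 x x∈)
    where
    from-lift : (∃ λ t → L x t × Bounded (ν * (17 * u)) (λ m → + c ℤ.* t m)) → set progression x
    from-lift (t , t∈ , t≤) = from-cover (cover t (x , t∈) t≤ρ)
      where
      t≤ρ : Bounded ρ t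
      t≤ρ m = subst (_≤ ρ) (DM.m*n/n≡m ∣ t m ∣ c) (DM./-monoˡ-≤ c (ℕₚ.≤-trans
        (ℕₚ.≤-reflexive (trans (ℕₚ.*-comm ∣ t m ∣ c) (sym (ℤₚ.∣i*j∣≡∣i∣*∣j∣ (+ c) (t m))))) (t≤ m)))
      from-cover : (∃ λ m → (∀ i → ∣ m i ∣ ≤ N i) × t ≗ comb p m) → set progression x
      from-cover (m , m≤ , t≗) = x ⊟ lin g m , lin g m ,
        L-resp ≈refl (λ l → ℤₚ.i≡j⇒i-j≡0 (t≗ l)) (L-∙ t∈ (L-⁻¹ (L-lin g p m (λ i → proj₂ (p∈ i))))) ,
        (m , m≤ , ≈refl) , ab-solve (x ∷ lin g m ∷ []) ((v0 :- v1) :+ v1) v0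

-- The choice of scale and the final estimates.

^-distribʳ-* : ∀ k a b → (a * b) ^ k ≡ a ^ k * b ^ k
^-distribʳ-* zero    a b = refl
^-distribʳ-* (suc k) a b = trans (cong (a * b *_) (^-distribʳ-* k a b)) (ℕₚ.[m*n]*[o*p]≡[m*o]*[n*p] a b (a ^ k) (b ^ k))

module Assembly (G : AbelianGroup 0ℓ 0ℓ) (fin : IsFinite G) (X : Subset G) (X-resp : Respects G X)
    (0∈X : X (AbelianGroup.ε G)) (X? : ∀ x → Dec (X x))
    (d n E K Y M : ℕ) (d≥1 : 1 ≤ d) (n≡ : n ≡ 16 ^ d)
    (E≥ : 68 * (n * (8 * n) ^ n) ≤ E) (E≥51 : 51 ≤ E) (K≥ : 2 * (E + 9) ≤ K)
    (Y≥ : 6 + 2 * K ≤ Y) (Y≥′ : 4 * n + 2 ≤ Y) (M≥ : 8 * n * ((2 * n + 1) * Y ^ (7 ^ n)) + 2 ≤ M) where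
  open Sumsets G fin X X-resp 0∈X X?
  open ℕₚ.≤-Reasoning

  n≥1 : 1 ≤ n
  n≥1 = subst (1 ≤_) (sym n≡) (ℕₚ.m^n>0 16 d)

  Ω : ℕ
  Ω = Y ^ (7 ^ n)

  Y≥1 : 1 ≤ Y
  Y≥1 = ℕₚ.≤-trans (s≤s z≤n) Y≥

  Ω≥1 : 1 ≤ Ω
  Ω≥1 = ℕₚ.m^n>0 Y {{ℕ.>-nonZero Y≥1}} (7 ^ n)

  M≥4 : 4 ≤ M
  M≥4 = ℕₚ.≤-trans (ℕₚ.+-monoˡ-≤ 2 (ℕₚ.≤-trans (s≤s (s≤s z≤n))
    (ℕₚ.*-mono-≤ {8} {8 * n} {1} (ℕₚ.*-monoʳ-≤ 8 n≥1)
      (ℕₚ.*-mono-≤ {1} {2 * n + 1} (ℕₚ.m≤n+m 1 (2 * n)) Ω≥1)))) M≥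

  4^d-^ : ∀ m → (4 * m) ^ d ≡ 4 ^ d * m ^ d
  4^d-^ m = ^-distribʳ-* d 4 m

  m<4m : ∀ m → 1 ≤ m → m < 4 * m
  m<4m m m≥1 = subst (m <_) (ℕₚ.*-comm m 4) (ℕₚ.m<m*n m 4 {{ℕ.>-nonZero m≥1}} (s≤s (s≤s z≤n)))

  -- If W (4 m) > 4 ^ d W m held at every scale m = 4 ^ i ≤ k / M, then W k would exceed (k / M) ^ d W 1.
  findScale : ∀ k T → 1 ≤ k → 1 ≤ T → M ^ d ≤ T → W k * T ≤ k ^ d * W 1 →
              ∃ λ m → 1 ≤ m × m * M ≤ k × W (4 * m) ≤ 4 ^ d * W m
  findScale k T k≥1 T≥1 M^d≤T growth = go k 1 (s≤s z≤n) (ℕₚ.m≤m+n k 1)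
    (ℕₚ.≤-trans (ℕₚ.≤-reflexive (ℕₚ.*-identityˡ M)) M≤k)
    (ℕₚ.≤-reflexive (trans (cong (_* W 1) (ℕₚ.^-zeroˡ d)) (ℕₚ.*-identityˡ (W 1))))
    where
    instance
      W1≢0 : NonZero (W 1)
      W1≢0 = ℕ.>-nonZero (W≥1 1)
      d≢0 : NonZero d
      d≢0 = ℕ.>-nonZero d≥1
    T≤k^d : T ≤ k ^ d
    T≤k^d = ℕₚ.*-cancelʳ-≤ T (k ^ d) (W 1) (begin
      T * W 1       ≡⟨ ℕₚ.*-comm T (W 1) ⟩
      W 1 * T       ≤⟨ ℕₚ.*-monoˡ-≤ T (W-mono k≥1) ⟩
      W k * T       ≤⟨ growth ⟩
      k ^ d * W 1   ∎)
    -- From `M ^ d ≤ T ≤ k ^ d`; this admits `m = 1` as the first scale.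
    M≤k : M ≤ k
    M≤k = ℕₚ.≮⇒≥ λ k<M → ℕₚ.<⇒≱ (ℕₚ.^-monoˡ-< d k<M) (ℕₚ.≤-trans M^d≤T T≤k^d)
    -- `k ≤ fuel + m` is invariant because `m` grows at each step. With the fuel exhausted, `m`
    -- would be at least `k`, against `4 m M ≤ k`.
    go : ∀ fuel m → 1 ≤ m → k ≤ fuel + m → m * M ≤ k → m ^ d * W 1 ≤ W m →
         ∃ λ m → 1 ≤ m × m * M ≤ k × W (4 * m) ≤ 4 ^ d * W m
    go fuel m m≥1 k≤ mM≤k Wm with W (4 * m) ℕ.≤? 4 ^ d * W m
    ... | yes dbl = m , m≥1 , mM≤k , dbl
    ... | no ¬dbl with 4 * m * M ℕ.≤? k
    ...   | no ¬fits = contradiction (ℕₚ.*-cancelʳ-< (W 1) _ _ (ℕₚ.*-cancelˡ-< ((4 * m) ^ d) _ _ overgrown))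
                         (ℕₚ.≤⇒≯ M^d≤T)
      where
      jump : (4 * m) ^ d * W 1 < W (4 * m)
      jump = begin-strict
        (4 * m) ^ d * W 1       ≡⟨ cong (_* W 1) (4^d-^ m) ⟩
        4 ^ d * m ^ d * W 1     ≡⟨ ℕₚ.*-assoc (4 ^ d) (m ^ d) (W 1) ⟩
        4 ^ d * (m ^ d * W 1)   ≤⟨ ℕₚ.*-monoʳ-≤ (4 ^ d) Wm ⟩
        4 ^ d * W m             <⟨ ℕₚ.≰⇒> ¬dbl ⟩
        W (4 * m)               ∎
      lemma : ∀ a t w → a * (t * w) ≡ a * w * t
      lemma = ℕ-Solver.solve-∀
      overgrown : (4 * m) ^ d * (T * W 1) < (4 * m) ^ d * (M ^ d * W 1)
      overgrown = begin-strict
        (4 * m) ^ d * (T * W 1)   ≡⟨ lemma ((4 * m) ^ d) T (W 1) ⟩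
        (4 * m) ^ d * W 1 * T     <⟨ ℕₚ.*-monoˡ-< T {{ℕ.>-nonZero T≥1}} jump ⟩
        W (4 * m) * T             ≤⟨ ℕₚ.*-monoˡ-≤ T (W-mono (ℕₚ.≤-trans (ℕₚ.≤-reflexive (ℕₚ.*-comm 4 m))
                                      (ℕₚ.≤-trans (ℕₚ.*-monoʳ-≤ m M≥4) mM≤k))) ⟩
        W k * T                   ≤⟨ growth ⟩
        k ^ d * W 1               ≤⟨ ℕₚ.*-monoˡ-≤ (W 1) (ℕₚ.^-monoˡ-≤ d (ℕₚ.<⇒≤ (ℕₚ.≰⇒> ¬fits))) ⟩
        (4 * m * M) ^ d * W 1     ≡⟨ cong (_* W 1) (^-distribʳ-* d (4 * m) M) ⟩
        (4 * m) ^ d * M ^ d * W 1 ≡⟨ ℕₚ.*-assoc ((4 * m) ^ d) (M ^ d) (W 1) ⟩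
        (4 * m) ^ d * (M ^ d * W 1) ∎
    go zero m m≥1 k≤ mM≤k Wm | no ¬dbl | yes fits =
      contradiction (ℕₚ.≤-trans (ℕₚ.≤-trans (ℕₚ.m≤m*n (4 * m) M {{ℕ.>-nonZero (ℕₚ.≤-trans (s≤s z≤n) M≥4)}}) fits) k≤)
        (ℕₚ.<⇒≱ (m<4m m m≥1))
    go (suc fuel) m m≥1 k≤ mM≤k Wm | no ¬dbl | yes fits =
      go fuel (4 * m) (ℕₚ.≤-trans m≥1 (ℕₚ.m≤n*m m 4))
        (ℕₚ.≤-trans k≤ (ℕₚ.≤-trans (ℕₚ.≤-reflexive (sym (ℕₚ.+-suc fuel m)))
          (ℕₚ.+-monoʳ-≤ fuel (m<4m m m≥1))))
        fits (begin
          (4 * m) ^ d * W 1       ≡⟨ cong (_* W 1) (4^d-^ m) ⟩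
          4 ^ d * m ^ d * W 1     ≡⟨ ℕₚ.*-assoc (4 ^ d) (m ^ d) (W 1) ⟩
          4 ^ d * (m ^ d * W 1)   ≤⟨ ℕₚ.*-monoʳ-≤ (4 ^ d) Wm ⟩
          4 ^ d * W m             ≤⟨ ℕₚ.<⇒≤ (ℕₚ.≰⇒> ¬dbl) ⟩
          W (4 * m)               ∎)

  module AtScale (k m : ℕ) (m≥1 : 1 ≤ m) (mM≤k : m * M ≤ k) (doubling : W (4 * m) ≤ 4 ^ d * W m) where
    module C = Covering G fin X X-resp 0∈X X? m

    private
      instance
        Wm≢0 : NonZero (W m)
        Wm≢0 = ℕ.>-nonZero (W≥1 m)
        m≢0 : NonZero m
        m≢0 = ℕ.>-nonZero m≥1
        M≢0 : NonZero M
        M≢0 = ℕ.>-nonZero (ℕₚ.≤-trans (s≤s z≤n) M≥4)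
        mM≢0 : NonZero (m * M)
        mM≢0 = ℕₚ.m*n≢0 m M

    nF≤n : C.n ≤ n
    nF≤n = ℕₚ.*-cancelʳ-≤ C.n n (W m * W m) {{ℕₚ.m*n≢0 (W m) (W m)}} (begin
      C.n * (W m * W m)                   ≤⟨ C.F-count ⟩
      W (4 * m) * W (4 * m)               ≤⟨ ℕₚ.*-mono-≤ doubling doubling ⟩
      (4 ^ d * W m) * (4 ^ d * W m)       ≡⟨ lemma (4 ^ d) (W m) ⟩
      (4 ^ d * 4 ^ d) * (W m * W m)       ≡⟨ cong (_* (W m * W m)) (trans (sym (^-distribʳ-* d 4 4)) (sym n≡)) ⟩
      n * (W m * W m)                     ∎)
      where
      lemma : ∀ a w → (a * w) * (a * w) ≡ (a * a) * (w * w)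
      lemma = ℕ-Solver.solve-∀

    -- Rounding down keeps `θ * (m * M)` within `k`, as the count of `R` demands; as the quotient is
    -- at least one, rounding costs no more than a factor 2 in `k≤2θmM`.
    θ : ℕ
    θ = k / (m * M)

    θ≥1 : 1 ≤ θ
    θ≥1 = DM.m≥n⇒m/n>0 mM≤k

    θmM≤k : θ * (m * M) ≤ k
    θmM≤k = DM.m/n*n≤m k (m * M)

    k≤2θmM : k ≤ 2 * M * (θ * m)
    k≤2θmM = begin
      k                                   ≤⟨ ℕₚ.≤-trans (ℕₚ.≤-reflexive (DM.m≡m%n+[m/n]*n k (m * M)))
                                            (ℕₚ.+-monoˡ-≤ (θ * (m * M)) (ℕₚ.<⇒≤ (DM.m%n<n k (m * M)))) ⟩
      (1 + θ) * (m * M)                   ≤⟨ ℕₚ.*-monoˡ-≤ (m * M) (ℕₚ.+-monoˡ-≤ θ θ≥1) ⟩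
      (θ + θ) * (m * M)                   ≡⟨ lemma θ m M ⟩
      2 * M * (θ * m)                     ∎
      where
      lemma : ∀ t m M → (t + t) * (m * M) ≡ 2 * M * (t * m)
      lemma = ℕ-Solver.solve-∀

    module RS = Rescale balls C.F m C.F∈ C.F-covers θ θ≥1

    Result : Set
    Result = ∃ λ (I : BallProperties.Independent balls K RS.c) →
      BallProperties.Independent.D I ≤ n × 1 ≤ BallProperties.Independent.j I
      × BallProperties.Independent.j I ≤ Ω × BallProperties.Independent.u I ≤ Ω

    abstract
      result : Result
      result =
        let (I , D≤ , j≥ , j≤ , u≤) = BallProperties.eliminate balls K Y Y≥ C.n RS.f RS.c (4 * C.n + 2)
              RS.f∈ RS.covers-f (ℕₚ.m≤n⇒m≤o+n (4 * C.n) (s≤s z≤n)) 1 1 (s≤s z≤n)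
              (ℕₚ.≤-trans (ℕₚ.+-monoˡ-≤ 2 (ℕₚ.*-monoʳ-≤ 4 nF≤n)) (ℕₚ.≤-trans Y≥′ (ℕₚ.≤-reflexive (sym (ℕₚ.^-identityʳ Y)))))
              (s≤s z≤n) (ℕₚ.≤-trans Y≥1 (ℕₚ.≤-reflexive (sym (ℕₚ.^-identityʳ Y))))
        in I , ℕₚ.≤-trans D≤ nF≤n , j≥ , ℕₚ.≤-trans (ℕₚ.≤-reflexive (sym (ℕₚ.*-identityʳ _))) (ℕₚ.≤-trans j≤ Ω-mono) ,
           ℕₚ.≤-trans u≤ Ω-mono
        where
        Ω-mono : Y ^ (1 * 7 ^ C.n) ≤ Ω
        Ω-mono = ℕₚ.^-monoʳ-≤ Y {{ℕ.>-nonZero Y≥1}}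
          (ℕₚ.≤-trans (ℕₚ.≤-reflexive (ℕₚ.*-identityˡ (7 ^ C.n))) (ℕₚ.^-monoʳ-≤ 7 nF≤n))

    I = proj₁ result
    open BallProperties.Independent I using (D; j; u; c)
    D≤n = proj₁ (proj₂ result)
    j≥1 = proj₁ (proj₂ (proj₂ result))
    j≤Ω = proj₁ (proj₂ (proj₂ (proj₂ result)))
    u≤Ω = proj₂ (proj₂ (proj₂ (proj₂ result)))

    θm≤c : θ * m ≤ c
    θm≤c = begin
      θ * m                           ≤⟨ ℕₚ.*-monoʳ-≤ θ (ℕₚ.m≤n*m m (2 * C.n + 1) {{ℕ.>-nonZero (ℕₚ.m≤n+m 1 (2 * C.n))}}) ⟩
      θ * ((2 * C.n + 1) * m)         ≤⟨ ℕₚ.m≤n*m _ j {{ℕ.>-nonZero j≥1}} ⟩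
      j * (θ * ((2 * C.n + 1) * m))   ∎

    c≥1 : 1 ≤ c
    c≥1 = ℕₚ.≤-trans (ℕₚ.*-mono-≤ θ≥1 m≥1) θm≤c

    module LC = LocalCover fin balls E K RS.c E≥51 K≥ I
    module PG = Progression fin balls n E K RS.c n≥1 E≥ E≥51 K≥ I D≤n c≥1

    -- The radius `c` is `i * m`, so `R-count` applies. The lower bound on `M` places its first
    -- sumset inside `T k`, and doubling bounds its second by `4 ^ d * W m`.
    ν≤ : LC.ν ≤ 4 ^ d * W k
    ν≤ = ℕₚ.*-cancelʳ-≤ LC.ν (4 ^ d * W k) (W m) (begin
      LC.ν * W m
        ≤⟨ C.R-count i LC.ν LC.R
             (λ l → Balls.B-mono balls (ℕₚ.≤-trans (ℕₚ.≤-reflexive (lemma j θ C.n m)) (ℕₚ.m≤n+m (i * m) m)) (LC.R∈ l))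
             (λ l l′ e → proj₁ (LC.unique l l′ (λ _ → + 0) (λ _ → + 0) (λ _ → z≤n) (λ _ → z≤n)
               (AbelianGroup.∙-congʳ G e))) ⟩
      W (m + C.n * (2 * i * (2 * m) + 2 * i * (2 * m)) + m) * W (m + m)
        ≤⟨ ℕₚ.*-mono-≤ (W-mono fits) (ℕₚ.≤-trans (W-mono (ℕₚ.≤-trans (ℕₚ.m≤m+n (m + m) (m + m))
             (ℕₚ.≤-reflexive (lemma″ m)))) doubling) ⟩
      W k * (4 ^ d * W m)         ≡⟨ lemma‴ (W k) (4 ^ d) (W m) ⟩
      4 ^ d * W k * W m           ∎)
      where
      i = j * (θ * (2 * C.n + 1))
      lemma : ∀ j t n m → j * (t * ((2 * n + 1) * m)) ≡ j * (t * (2 * n + 1)) * m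
      lemma = ℕ-Solver.solve-∀
      lemma′ : ∀ j t n m → m + n * (2 * (j * (t * (2 * n + 1))) * (2 * m) + 2 * (j * (t * (2 * n + 1))) * (2 * m)) + m
                          ≡ (8 * n * ((2 * n + 1) * j) * t + 2 * 1) * m
      lemma′ = ℕ-Solver.solve-∀
      lemma″ : ∀ m → m + m + (m + m) ≡ 4 * m
      lemma″ = ℕ-Solver.solve-∀
      lemma‴ : ∀ a b c → a * (b * c) ≡ b * a * c
      lemma‴ = ℕ-Solver.solve-∀
      lemma⁗ : ∀ a t m → (a * t + 2 * t) * m ≡ t * (m * (a + 2))
      lemma⁗ = ℕ-Solver.solve-∀
      fits : m + C.n * (2 * i * (2 * m) + 2 * i * (2 * m)) + m ≤ k
      fits = begin
        m + C.n * (2 * i * (2 * m) + 2 * i * (2 * m)) + m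
          ≡⟨ lemma′ j θ C.n m ⟩
        (8 * C.n * ((2 * C.n + 1) * j) * θ + 2 * 1) * m
          ≤⟨ ℕₚ.*-monoˡ-≤ m (ℕₚ.+-mono-≤ (ℕₚ.*-monoˡ-≤ θ (ℕₚ.*-mono-≤ (ℕₚ.*-monoʳ-≤ 8 nF≤n)
               (ℕₚ.*-mono-≤ (ℕₚ.+-monoˡ-≤ 1 (ℕₚ.*-monoʳ-≤ 2 nF≤n)) j≤Ω))) (ℕₚ.*-monoʳ-≤ 2 θ≥1)) ⟩
        (8 * n * ((2 * n + 1) * Ω) * θ + 2 * θ) * m
          ≡⟨ lemma⁗ (8 * n * ((2 * n + 1) * Ω)) θ m ⟩
        θ * (m * (8 * n * ((2 * n + 1) * Ω) + 2))
          ≤⟨ ℕₚ.*-monoʳ-≤ θ (ℕₚ.*-monoʳ-≤ m M≥) ⟩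
        θ * (m * M)
          ≤⟨ θmM≤k ⟩
        k ∎

    -- `k ≤ 2 M c` trades `k ^ r` for the `c ^ r` of `PG.count`, at the cost of `(2 * M) ^ n`.
    size-bound : PG.h * PG.q * k ^ PG.r ≤ (2 * M) ^ n * suc ((E + 9) * Ω + (E + 9) * Ω) ^ n * 4 ^ d * W k
    size-bound = begin
      PG.h * PG.q * k ^ PG.r
        ≤⟨ ℕₚ.*-monoʳ-≤ (PG.h * PG.q) (ℕₚ.^-monoˡ-≤ PG.r (ℕₚ.≤-trans k≤2θmM (ℕₚ.*-monoʳ-≤ (2 * M) θm≤c))) ⟩
      PG.h * PG.q * (2 * M * c) ^ PG.r
        ≡⟨ cong (PG.h * PG.q *_) (^-distribʳ-* PG.r (2 * M) c) ⟩
      PG.h * PG.q * ((2 * M) ^ PG.r * c ^ PG.r)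
        ≡⟨ lemma PG.h PG.q ((2 * M) ^ PG.r) (c ^ PG.r) ⟩
      (2 * M) ^ PG.r * (PG.h * (PG.q * c ^ PG.r))
        ≤⟨ ℕₚ.*-mono-≤ (ℕₚ.^-monoʳ-≤ (2 * M) {{ℕₚ.m*n≢0 2 M}} PG.r≤n) PG.count ⟩
      (2 * M) ^ n * (LC.ν * suc ((E + 9) * u + (E + 9) * u) ^ D)
        ≤⟨ ℕₚ.*-monoʳ-≤ ((2 * M) ^ n) (ℕₚ.*-mono-≤ ν≤ (ℕₚ.≤-trans
             (ℕₚ.^-monoˡ-≤ D (s≤s (ℕₚ.+-mono-≤ (ℕₚ.*-monoʳ-≤ (E + 9) u≤Ω) (ℕₚ.*-monoʳ-≤ (E + 9) u≤Ω))))
             (ℕₚ.^-monoʳ-≤ (suc ((E + 9) * Ω + (E + 9) * Ω)) D≤n))) ⟩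
      (2 * M) ^ n * (4 ^ d * W k * suc ((E + 9) * Ω + (E + 9) * Ω) ^ n)
        ≡⟨ lemma′ ((2 * M) ^ n) (4 ^ d) (W k) (suc ((E + 9) * Ω + (E + 9) * Ω) ^ n) ⟩
      (2 * M) ^ n * suc ((E + 9) * Ω + (E + 9) * Ω) ^ n * 4 ^ d * W k ∎
      where
      lemma : ∀ h q a c → h * q * (a * c) ≡ a * (h * (q * c))
      lemma = ℕ-Solver.solve-∀
      lemma′ : ∀ a b w s → a * (b * w * s) ≡ a * s * b * w
      lemma′ = ℕ-Solver.solve-∀

  Conclusion : ℕ → ℕ → ℕ → Set₁
  Conclusion T k nkX = Σ (CosetProgression G) λ P →
      IsProper G P
    × rank P ≤ d
    × (∃ λ s → HasSize G (set P) s × s * k ^ rank P ≤ T * nkX)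
    × _⊆_ G X (set P)

  -- The rank bound is forced by the size bounds |X| k ^ r ≤ |H + Q| k ^ r ≤ T |kX| ≤ k ^ d |X|.
  structure : ∀ T → 1 ≤ T → M ^ d ≤ T →
    (2 * M) ^ n * suc ((E + 9) * Ω + (E + 9) * Ω) ^ n * 4 ^ d ≤ T →
    ∀ k → 2 ≤ k → ∀ nX nkX → HasSize G X nX → HasSize G (sumset G k X) nkX →
    nkX * T ≤ k ^ d * nX → Conclusion T k nkX
  structure T T≥1 M^d≤T T≥ k k≥2 nX nkX X-size kX-size growth =
    finish (findScale k T (ℕₚ.≤-trans (s≤s z≤n) k≥2) T≥1 M^d≤T (begin
      W k * T       ≤⟨ ℕₚ.*-monoˡ-≤ T W≤ ⟩
      nkX * T       ≤⟨ growth ⟩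
      k ^ d * nX    ≤⟨ ℕₚ.*-monoʳ-≤ (k ^ d) (size-mono X-size (W-size 1) X⇒T1) ⟩
      k ^ d * W 1   ∎))
    where
    open Finite G fin using (size-mono)
    W≤ : W k ≤ nkX
    W≤ = size-mono (W-size k) kX-size (T⇒sumset k)
    nX≥1 : 1 ≤ nX
    nX≥1 = ℕₚ.≤-trans (W≥1 1) (size-mono (W-size 1) X-size T1⇒X)
    finish : (∃ λ m → 1 ≤ m × m * M ≤ k × W (4 * m) ≤ 4 ^ d * W m) → Conclusion T k nkX
    finish (m , m≥1 , mM≤k , doubling) =
      S.PG.progression , S.PG.proper , rank≤d , (S.PG.h * S.PG.q , S.PG.set-size , size≤) , X⊆
      where
      module S = AtScale k m m≥1 mM≤k doubling
      X⊆ : _⊆_ G X (set S.PG.progression)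
      X⊆ x∈ = S.PG.contains (T⇒Ball 1 (X⇒T1 x∈))
      size≤ : S.PG.h * S.PG.q * k ^ S.PG.r ≤ T * nkX
      size≤ = ℕₚ.≤-trans S.size-bound (ℕₚ.*-mono-≤ T≥ W≤)
      rank≤d : S.PG.r ≤ d
      rank≤d = ℕₚ.≮⇒≥ λ d<r → ℕₚ.<⇒≱ k≥2 (ℕₚ.*-cancelʳ-≤ k 1 (k ^ d * nX) {{kd≢0}} (begin
        k * (k ^ d * nX)          ≡⟨ lemma k (k ^ d) nX ⟩
        nX * (k * k ^ d)          ≤⟨ ℕₚ.*-mono-≤ (size-mono X-size S.PG.set-size X⊆) (ℕₚ.^-monoʳ-≤ k {{k≢0}} d<r) ⟩
        S.PG.h * S.PG.q * k ^ S.PG.r   ≤⟨ size≤ ⟩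
        T * nkX                   ≡⟨ ℕₚ.*-comm T nkX ⟩
        nkX * T                   ≤⟨ growth ⟩
        k ^ d * nX                ≡⟨ ℕₚ.*-identityˡ _ ⟨
        1 * (k ^ d * nX)          ∎))
        where
        k≢0 : NonZero k
        k≢0 = ℕ.>-nonZero (ℕₚ.≤-trans (s≤s z≤n) k≥2)
        kd≢0 : NonZero (k ^ d * nX)
        kd≢0 = ℕₚ.m*n≢0 (k ^ d) nX {{ℕₚ.m^n≢0 k d {{k≢0}}}} {{ℕ.>-nonZero nX≥1}}
        lemma : ∀ k a x → k * (a * x) ≡ x * (k * a)
        lemma = ℕ-Solver.solve-∀

-- Numerical constants.

module PowersOfTwo where
  open ℕₚ.≤-Reasoning

  -- 2 ^_ made abstract: definitional unfolding of 2 ^ (7 + e) is exponential.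
  abstract
    pow : ℕ → ℕ
    pow e = 2 ^ e

    pow-≡ : ∀ e → pow e ≡ 2 ^ e
    pow-≡ e = refl

    pow-≥ : ∀ {x} e → x ≤ 2 ^ e → x ≤ pow e
    pow-≥ e p = p

    pow-* : ∀ {x y} e f → x ≤ pow e → y ≤ pow f → x * y ≤ pow (e + f)
    pow-* e f p q = ℕₚ.≤-trans (ℕₚ.*-mono-≤ p q) (ℕₚ.≤-reflexive (sym (ℕₚ.^-distribˡ-+-* 2 e f)))

    pow-^ : ∀ {x} e k → x ≤ pow e → x ^ k ≤ pow (e * k)
    pow-^ e k p = ℕₚ.≤-trans (ℕₚ.^-monoˡ-≤ k p) (ℕₚ.≤-reflexive (ℕₚ.^-*-assoc 2 e k))

    pow-+ : ∀ {x y} e → x ≤ pow e → y ≤ pow e → x + y ≤ pow (1 + e)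
    pow-+ e p q = ℕₚ.≤-trans (ℕₚ.+-mono-≤ p q) (ℕₚ.≤-reflexive (cong (λ s → 2 ^ e + s) (sym (ℕₚ.+-identityʳ (2 ^ e)))))

    pow-mono : ∀ {e f} → e ≤ f → pow e ≤ pow f
    pow-mono = ℕₚ.^-monoʳ-≤ 2

    1≤pow : ∀ e → 1 ≤ pow e
    1≤pow = ℕₚ.m^n>0 2

  n≤2^n : ∀ n → n ≤ 2 ^ n
  n≤2^n zero    = z≤n
  n≤2^n (suc n) = ℕₚ.≤-trans (ℕₚ.+-mono-≤ (ℕₚ.m^n>0 2 n) (n≤2^n n))
    (ℕₚ.≤-reflexive (cong (λ s → 2 ^ n + s) (sym (ℕₚ.+-identityʳ (2 ^ n)))))

  record Constants (d n T : ℕ) : Set where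
    field
      E K Y M : ℕ
      E≥  : 68 * (n * (8 * n) ^ n) ≤ E
      E≥51 : 51 ≤ E
      K≥  : 2 * (E + 9) ≤ K
      Y≥  : 6 + 2 * K ≤ Y
      Y≥′ : 4 * n + 2 ≤ Y
      M≥  : 8 * n * ((2 * n + 1) * Y ^ (7 ^ n)) + 2 ≤ M
      M^d≤T : M ^ d ≤ T
      T≥  : (2 * M) ^ n * suc ((E + 9) * Y ^ (7 ^ n) + (E + 9) * Y ^ (7 ^ n)) ^ n * 4 ^ d ≤ T

  n≤pow : ∀ n → n ≤ pow n
  n≤pow n = pow-≥ n (n≤2^n n)

  -- The binary logarithm of the total is at most `5 n w`, where `w = y * 7 ^ n` and `y ≤ 17 n²`;
  -- and `85 n³ 7 ^ n ≤ 2 ^ (7 + 6 n)`. Rounding `13 n` up to `16 n` keeps the exponent a power of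
  -- two when `n` is `16 ^ d`.
  constants : ∀ d n → 1 ≤ n → d ≤ n → 4 ^ d ≤ n → Constants d n (pow (pow (16 * n)))
  constants d n n≥1 d≤n 4^d≤n = record
    { E≥ = ℕₚ.≤-refl
    ; E≥51 = ℕₚ.≤-trans (ℕₚ.m≤m+n 51 17) (ℕₚ.*-monoʳ-≤ 68 (ℕₚ.*-mono-≤ n≥1 (ℕₚ.m^n>0 (8 * n) n)))
    ; K≥ = ℕₚ.≤-refl
    ; Y≥ = ℕₚ.m≤m+n (6 + 2 * K) (4 * n + 2)
    ; Y≥′ = ℕₚ.m≤n+m (4 * n + 2) (6 + 2 * K)
    ; M≥ = ℕₚ.≤-refl
    ; M^d≤T = ℕₚ.≤-trans M^d≤ total
    ; T≥ = total }
    where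
    instance
      8n≢0 : NonZero (8 * n)
      8n≢0 = ℕ.>-nonZero (ℕₚ.≤-trans n≥1 (ℕₚ.m≤n*m n 8))
    E = 68 * (n * (8 * n) ^ n)
    K = 2 * (E + 9)
    Y = 6 + 2 * K + (4 * n + 2)
    Ω = Y ^ (7 ^ n)
    M = 8 * n * ((2 * n + 1) * Ω) + 2
    S = suc ((E + 9) * Ω + (E + 9) * Ω)
    -- `y₀`, `y`, `w` and `μ` bound the binary logarithms of `E`, `Y`, `Ω` and `M`.
    y₀ = 7 + (n + (3 + n) * n)
    y = 5 + y₀
    w = y * 7 ^ n
    small : ∀ {x} f → x ≤ pow f → ∀ {e} → f ≤ e → x ≤ pow e
    small f p f≤e = ℕₚ.≤-trans p (pow-mono f≤e)
    E≤ : E ≤ pow y₀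
    E≤ = pow-* 7 (n + (3 + n) * n) (pow-≥ 7 (ℕₚ.m≤m+n 68 60))
      (pow-* n ((3 + n) * n) (n≤pow n) (pow-^ (3 + n) n (pow-* 3 n (pow-≥ 3 ℕₚ.≤-refl) (n≤pow n))))
    E+9≤ : E + 9 ≤ pow (1 + y₀)
    E+9≤ = pow-+ y₀ E≤ (small 7 (pow-≥ 7 (ℕₚ.m≤m+n 9 119)) (ℕₚ.m≤m+n 7 _))
    2K≤ : 2 * K ≤ pow (3 + y₀)
    2K≤ = pow-* 1 (2 + y₀) (pow-≥ 1 ℕₚ.≤-refl) (pow-* 1 (1 + y₀) (pow-≥ 1 ℕₚ.≤-refl) E+9≤)
    Y≤ : Y ≤ pow y
    Y≤ = pow-+ (4 + y₀)
      (pow-+ (3 + y₀) (small 3 (pow-≥ 3 (ℕₚ.m≤m+n 6 2)) (ℕₚ.m≤m+n 3 y₀)) 2K≤)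
      (pow-+ (3 + y₀) (small (2 + n) (pow-* 2 n (pow-≥ 2 ℕₚ.≤-refl) (n≤pow n))
        (ℕₚ.+-mono-≤ (ℕₚ.m≤m+n 2 1) (ℕₚ.m≤n⇒m≤o+n 7 (ℕₚ.m≤m+n n ((3 + n) * n)))))
        (small 3 (pow-≥ 3 (ℕₚ.m≤m+n 2 6)) (ℕₚ.m≤m+n 3 y₀)))
    Ω≤ : Ω ≤ pow w
    Ω≤ = pow-^ y (7 ^ n) Y≤
    μ = 1 + ((3 + n) + ((2 + n) + w))
    M≤ : M ≤ pow μ
    M≤ = pow-+ ((3 + n) + ((2 + n) + w))
      (pow-* (3 + n) ((2 + n) + w) (pow-* 3 n (pow-≥ 3 ℕₚ.≤-refl) (n≤pow n))
        (pow-* (2 + n) w (pow-+ (1 + n) (pow-* 1 n (pow-≥ 1 ℕₚ.≤-refl) (n≤pow n)) (1≤pow (1 + n))) Ω≤))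
      (small 1 (pow-≥ 1 ℕₚ.≤-refl) (s≤s z≤n))
    S≤ : S ≤ pow (3 + (y₀ + w))
    S≤ = pow-+ (2 + (y₀ + w)) (1≤pow (2 + (y₀ + w)))
      (pow-+ (1 + (y₀ + w)) both both)
      where
      both : (E + 9) * Ω ≤ pow (1 + (y₀ + w))
      both = pow-* (1 + y₀) w E+9≤ Ω≤
    exponent : (1 + μ) * n + (3 + (y₀ + w)) * n + n ≤ pow (16 * n)
    exponent = begin
      (1 + μ) * n + (3 + (y₀ + w)) * n + n          ≤⟨ ℕₚ.+-mono-≤ (ℕₚ.+-mono-≤
        (ℕₚ.*-monoˡ-≤ n 1+μ≤) (ℕₚ.*-monoˡ-≤ n 3+≤)) (ℕₚ.≤-trans (ℕₚ.≤-reflexive (sym (ℕₚ.*-identityˡ n))) (ℕₚ.*-monoˡ-≤ n w≥1)) ⟩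
      (2 * w) * n + (2 * w) * n + w * n             ≡⟨ lemma₁ w n ⟩
      5 * (w * n)                                   ≤⟨ ℕₚ.*-monoʳ-≤ 5 (ℕₚ.*-monoˡ-≤ n (ℕₚ.*-monoˡ-≤ (7 ^ n) y≤)) ⟩
      5 * (17 * (n * n) * 7 ^ n * n)                ≡⟨ lemma₂ n (7 ^ n) ⟩
      85 * (n * (n * (n * 7 ^ n)))                  ≤⟨ pow-* 7 (n + (n + (n + 3 * n))) (pow-≥ 7 (ℕₚ.m≤m+n 85 43))
        (pow-* n (n + (n + 3 * n)) (n≤pow n) (pow-* n (n + 3 * n) (n≤pow n) (pow-* n (3 * n) (n≤pow n)
          (pow-^ 3 n (pow-≥ 3 (ℕₚ.m≤m+n 7 1)))))) ⟩
      pow (7 + (n + (n + (n + 3 * n))))             ≤⟨ pow-mono (begin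
        7 + (n + (n + (n + 3 * n)))                   ≤⟨ ℕₚ.+-monoˡ-≤ _ (ℕₚ.*-monoʳ-≤ 7 n≥1) ⟩
        7 * n + (n + (n + (n + 3 * n)))               ≡⟨ lemma₃ n ⟩
        13 * n                                        ≤⟨ ℕₚ.*-monoˡ-≤ n (ℕₚ.m≤m+n 13 3) ⟩
        16 * n                                        ∎) ⟩
      pow (16 * n)                                  ∎
      where
      y≤w : y ≤ w
      y≤w = ℕₚ.m≤m*n y (7 ^ n) {{ℕₚ.m^n≢0 7 n}}
      w≥1 : 1 ≤ w
      w≥1 = ℕₚ.≤-trans (s≤s z≤n) y≤w
      nn = ℕₚ.*-mono-≤ n≥1 n≥1
      lemma₁ : ∀ w n → (2 * w) * n + (2 * w) * n + w * n ≡ 5 * (w * n)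
      lemma₁ = ℕ-Solver.solve-∀
      lemma₂ : ∀ n s → 5 * (17 * (n * n) * s * n) ≡ 85 * (n * (n * (n * s)))
      lemma₂ = ℕ-Solver.solve-∀
      lemma₃ : ∀ n → 7 * n + (n + (n + (n + 3 * n))) ≡ 13 * n
      lemma₃ = ℕ-Solver.solve-∀
      lemma₄ : ∀ n → 5 + (7 + (n + (3 + n) * n)) ≡ 12 * (1 * 1) + 4 * (n * 1) + n * n
      lemma₄ = ℕ-Solver.solve-∀
      lemma₅ : ∀ s → 12 * s + 4 * s + s ≡ 17 * s
      lemma₅ = ℕ-Solver.solve-∀
      y≤ : y ≤ 17 * (n * n)
      y≤ = begin
        5 + (7 + (n + (3 + n) * n))               ≡⟨ lemma₄ n ⟩
        12 * (1 * 1) + 4 * (n * 1) + n * n        ≤⟨ ℕₚ.+-monoˡ-≤ (n * n) (ℕₚ.+-mono-≤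
          (ℕₚ.*-monoʳ-≤ 12 nn) (ℕₚ.*-monoʳ-≤ 4 (ℕₚ.*-monoʳ-≤ n n≥1))) ⟩
        12 * (n * n) + 4 * (n * n) + n * n        ≡⟨ lemma₅ (n * n) ⟩
        17 * (n * n)                              ∎
      lemma₆ : ∀ n w → 1 + (1 + ((3 + n) + ((2 + n) + w))) ≡ (7 + 2 * n) + w
      lemma₆ = ℕ-Solver.solve-∀
      lemma₇ : ∀ w → w + w ≡ 2 * w
      lemma₇ = ℕ-Solver.solve-∀
      lemma₈ : ∀ n → (7 + 2 * n) + (5 + 2 * n + n * n) ≡ 5 + (7 + (n + (3 + n) * n))
      lemma₈ = ℕ-Solver.solve-∀
      lemma₉ : ∀ a w → 3 + (a + w) ≡ 3 + a + w
      lemma₉ = ℕ-Solver.solve-∀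
      1+μ≤ : 1 + μ ≤ 2 * w
      1+μ≤ = begin
        1 + μ             ≡⟨ lemma₆ n w ⟩
        (7 + 2 * n) + w   ≤⟨ ℕₚ.+-monoˡ-≤ w (ℕₚ.≤-trans (ℕₚ.≤-trans (ℕₚ.m≤m+n (7 + 2 * n) _) (ℕₚ.≤-reflexive (lemma₈ n))) y≤w) ⟩
        w + w             ≡⟨ lemma₇ w ⟩
        2 * w             ∎
      3+≤ : 3 + (y₀ + w) ≤ 2 * w
      3+≤ = begin
        3 + (y₀ + w)      ≡⟨ lemma₉ y₀ w ⟩
        3 + y₀ + w        ≤⟨ ℕₚ.+-monoˡ-≤ w (ℕₚ.≤-trans (ℕₚ.+-monoˡ-≤ y₀ (ℕₚ.m≤m+n 3 2)) y≤w) ⟩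
        w + w             ≡⟨ lemma₇ w ⟩
        2 * w             ∎
    total : (2 * M) ^ n * S ^ n * 4 ^ d ≤ pow (pow (16 * n))
    total = ℕₚ.≤-trans (pow-* ((1 + μ) * n + (3 + (y₀ + w)) * n) n
      (pow-* ((1 + μ) * n) ((3 + (y₀ + w)) * n) (pow-^ (1 + μ) n (pow-* 1 μ (pow-≥ 1 ℕₚ.≤-refl) M≤))
        (pow-^ (3 + (y₀ + w)) n S≤))
      (ℕₚ.≤-trans 4^d≤n (n≤pow n))) (pow-mono exponent)
    M^d≤ : M ^ d ≤ (2 * M) ^ n * S ^ n * 4 ^ d
    M^d≤ = begin
      M ^ d                               ≤⟨ ℕₚ.^-monoˡ-≤ d (ℕₚ.m≤n*m M 2) ⟩
      (2 * M) ^ d                         ≤⟨ ℕₚ.^-monoʳ-≤ (2 * M) {{ℕ.>-nonZero 2M≥1}} d≤n ⟩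
      (2 * M) ^ n                         ≤⟨ ℕₚ.m≤m*n ((2 * M) ^ n) (S ^ n) {{ℕₚ.m^n≢0 S n}} ⟩
      (2 * M) ^ n * S ^ n                 ≤⟨ ℕₚ.m≤m*n _ (4 ^ d) {{ℕₚ.m^n≢0 4 d}} ⟩
      (2 * M) ^ n * S ^ n * 4 ^ d         ∎
      where
      2M≥1 : 1 ≤ 2 * M
      2M≥1 = ℕₚ.≤-trans (s≤s z≤n) (ℕₚ.*-monoʳ-≤ 2 (ℕₚ.m≤n+m 2 (8 * n * ((2 * n + 1) * Ω))))

  -- The value 4 of the absolute constant arises here, as the logarithm of the factor 16 in
  -- `16 * n`.
  16^d : ∀ d → 16 * 16 ^ d ≤ 2 ^ (7 * d + 4)
  16^d d = begin
    16 * 16 ^ d         ≡⟨ ℕₚ.*-comm 16 (16 ^ d) ⟩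
    16 ^ d * 2 ^ 4      ≡⟨ cong (_* 2 ^ 4) (ℕₚ.^-*-assoc 2 4 d) ⟩
    2 ^ (4 * d) * 2 ^ 4 ≡⟨ ℕₚ.^-distribˡ-+-* 2 (4 * d) 4 ⟨
    2 ^ (4 * d + 4)     ≤⟨ ℕₚ.^-monoʳ-≤ 2 (ℕₚ.+-monoˡ-≤ 4 (ℕₚ.*-monoˡ-≤ d (ℕₚ.m≤m+n 4 3))) ⟩
    2 ^ (7 * d + 4)     ∎

theorem2p5 : ∃ λ (C₀ : ℕ) →
    (d : ℕ) → 1 ≤ d →
    (G : AbelianGroup 0ℓ 0ℓ) → IsFinite G →
    (X : Subset G) → Respects G X → X (AbelianGroup.ε G) →
    (k : ℕ) → 2 ≤ k →
    (nX nkX : ℕ) → HasSize G X nX → HasSize G (sumset G k X) nkX →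
    nkX * tower C₀ d ≤ k ^ d * nX →
    Σ (CosetProgression G) λ P →
    IsProper G P
    × rank P ≤ d
    × (∃ λ s → HasSize G (set P) s × s * k ^ rank P ≤ tower C₀ d * nkX)
    × _⊆_ G X (set P)
theorem2p5 = 4 , λ d d≥1 G fin X X-resp 0∈X k k≥2 nX nkX X-size kX-size growth →
  let open PowersOfTwo
      open Constants (constants d (16 ^ d) (ℕₚ.m^n>0 16 d) (ℕₚ.≤-trans (n≤2^n d) (ℕₚ.^-monoˡ-≤ d (ℕₚ.m≤m+n 2 14)))
        (ℕₚ.^-monoˡ-≤ d (ℕₚ.m≤m+n 4 12)))
      T≤tower = ℕₚ.≤-trans (ℕₚ.≤-reflexive (trans (pow-≡ _) (cong (2 ^_) (pow-≡ _))))
        (ℕₚ.^-monoʳ-≤ 2 (ℕₚ.^-monoʳ-≤ 2 (16^d d)))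
  -- `X` is decidable because `X-size` lists it and equality in `G` is decidable.
  in Assembly.structure G fin X X-resp 0∈X (Finite.member? G fin X-resp X-size) d (16 ^ d) E K Y M d≥1 refl
       E≥ E≥51 K≥ Y≥ Y≥′ M≥ (tower 4 d) (ℕₚ.m^n>0 2 (2 ^ (2 ^ (7 * d + 4)))) (ℕₚ.≤-trans M^d≤T T≤tower)
       (ℕₚ.≤-trans T≥ T≤tower) k k≥2 nX nkX X-size kX-size growth
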